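{- Let $t$ be a positive integer. For sufficiently large $n$, $$\mathrm{ex}_3(n,\mathcal{F}_5(f_3;t))=e\big(T_3(n,3)^{t+}\big).$$
   Context: All hypergraphs are $3$-uniform. $\mathrm{ex}_3(n,\mathcal{F})$ is the maximum number of hyperedges in an $n$-vertex $3$-graph with no copy of $\mathcal{F}$. $\mathcal{F}_5$ is the $3$-graph on $\{f_1,\dots,f_5\}$ with hyperedges $f_1f_2f_3,f_1f_2f_4,f_3f_4f_5$. $\mathcal{F}_5(f_3;t)$ is obtained by blowing up $f_3$ into $t$ vertices: its vertices are $f_1,f_2,f_4,f_5,h_1,\dots,h_t$ and its hyperedges are $f_1f_2f_4$ and $f_1f_2h_i$, $h_if_4f_5$ for $i=1,\dots,t$. $T_3(n,3)$ is the complete $3$-partite $3$-graph on $n$ vertices with part sizes $\lfloor n/3\rfloor$ or $\lceil n/3\rceil$. $D(N,3,t,2)$ denotes an $N$-vertex $3$-graph with the maximum possible number of hyperedges subject to every pair of vertices lying in at most $t-1$ hyperedges. $T_3(n,3)^{t+}$ is obtained from $T_3(n,3)$ by placing inside each part (of size $N\in\{\lfloor n/3\rfloor,\lceil n/3\rceil\}$) a copy of $D(N,3,t,2)$; thus $e(T_3(n,3)^{t+})$ equals $e(T_3(n,3))$ plus, for each part of size $N$, the maximum number of hyperedges of an $N$-vertex $3$-graph in which every pair lies in at most $t-1$ hyperedges. -}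

module Defs where

open import Data.Nat using (ℕ; zero; suc; _+_; _*_; _≤_; _<_)
open import Data.Nat.DivMod using (_/_)
open import Data.Fin using (Fin) renaming (_<_ to _<ᶠ_)
open import Data.Fin.Properties using () renaming (_<?_ to _<ᶠ?_)
open import Data.Bool using (Bool; true; false; T)
open import Data.List using (List; []; _∷_; length; filter; concatMap; allFin)
open import Data.Product using (Σ; _×_; _,_; ∃; ∃-syntax)
open import Relation.Binary.PropositionalEquality using (_≡_; _≢_)
open import Relation.Nullary.Decidable using (Dec; yes; no)
open import Function.Definitions using (Injective)

-- A 3-uniform hypergraph (3-graph) on vertex set Fin n.
-- edge a b c = true  iff {a,b,c} is a hyperedge; the indicator is symmetric
-- and vanishes on non-distinct triples, so hyperedges are 3-element sets.
record Graph3 (n : ℕ) : Set where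
  field
    edge   : Fin n → Fin n → Fin n → Bool
    swap₁₂ : ∀ a b c → edge a b c ≡ edge b a c
    swap₂₃ : ∀ a b c → edge a b c ≡ edge a c b
    noLoop : ∀ a c → edge a a c ≡ false
open Graph3 public

Edge : ∀ {n} → Graph3 n → Fin n → Fin n → Fin n → Set
Edge H a b c = T (edge H a b c)

orderedTriples : (n : ℕ) → List (Fin n × Fin n × Fin n)
orderedTriples n =
  concatMap (λ a → concatMap (λ b → concatMap (λ c → tri a b c) (allFin n)) (allFin n)) (allFin n)
  where
  tri : Fin n → Fin n → Fin n → List (Fin n × Fin n × Fin n)
  tri a b c with a <ᶠ? b | b <ᶠ? c
  ... | yes _ | yes _ = (a , b , c) ∷ []
  ... | _     | _     = []

edgeDec : ∀ {n} (H : Graph3 n) (x : Fin n × Fin n × Fin n) →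
          Dec (edge H (Data.Product.proj₁ x) (Data.Product.proj₁ (Data.Product.proj₂ x))
                      (Data.Product.proj₂ (Data.Product.proj₂ x)) ≡ true)
edgeDec H (a , b , c) = Data.Bool._≟_ (edge H a b c) true

numEdges : ∀ {n} → Graph3 n → ℕ
numEdges {n} H = length (filter (edgeDec H) (orderedTriples n))

codeg : ∀ {n} → Graph3 n → Fin n → Fin n → ℕ
codeg {n} H a b = length (filter (λ c → Data.Bool._≟_ (edge H a b c) true) (allFin n))

ContainsF5blowup : ∀ {n} → ℕ → Graph3 n → Set
ContainsF5blowup {n} t H =
  Σ (Fin n) λ f1 → Σ (Fin n) λ f2 → Σ (Fin n) λ f4 → Σ (Fin n) λ f5 →
  Σ (Fin t → Fin n) λ h →
    (f1 ≢ f2) × (f1 ≢ f4) × (f1 ≢ f5) × (f2 ≢ f4) × (f2 ≢ f5) × (f4 ≢ f5) ×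
    Injective _≡_ _≡_ h ×
    (∀ i → (h i ≢ f1) × (h i ≢ f2) × (h i ≢ f4) × (h i ≢ f5)) ×
    Edge H f1 f2 f4 ×
    (∀ i → Edge H f1 f2 (h i) × Edge H (h i) f4 f5)

IsExF5blowup : ℕ → ℕ → ℕ → Set
IsExF5blowup n t m =
  (Σ (Graph3 n) λ H → (ContainsF5blowup t H → Data.Empty.⊥) × numEdges H ≡ m) ×
  (∀ (H : Graph3 n) → (ContainsF5blowup t H → Data.Empty.⊥) → numEdges H ≤ m)
  where import Data.Empty

IsDmax : ℕ → ℕ → ℕ → Set
IsDmax N t m =
  (Σ (Graph3 N) λ H → (∀ a b → codeg H a b < t) × numEdges H ≡ m) ×
  (∀ (H : Graph3 N) → (∀ a b → codeg H a b < t) → numEdges H ≤ m)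

-- part sizes of T_3(n,3): ⌊n/3⌋, ⌊(n+1)/3⌋, ⌊(n+2)/3⌋ (each ⌊n/3⌋ or ⌈n/3⌉, summing to n)
part₁ part₂ part₃ : ℕ → ℕ
part₁ n = n / 3
part₂ n = (n + 1) / 3
part₃ n = (n + 2) / 3

eT3 : ℕ → ℕ
eT3 n = part₁ n * part₂ n * part₃ n

{-# OPTIONS --safe #-}

-- Write l = t − 1. In a 3-graph H without the forbidden configuration, the links of the vertices x with xyz ∈ H
-- meet the link of y in O(n²) pairs altogether. Hence all but O(n²) edges have vertices whose links are pairwise
-- almost disjoint; let J consist of these edges. Suppose that all degrees are at least about n²/9. Five vertices
-- that are pairwise adjacent in the shadow of J have too many link pairs in total, and by Turán's theorem the
-- union of the links of four such vertices contains five. So the shadow is K₄-free, links in J are triangle-free,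
-- and all degrees in the shadow are at least about 2n/3; such a graph is tripartite. Now any l + 2 vertices of one
-- part have a common link pair, which bounds the codegrees inside the parts by l, and an edge u u′ w with u and u′
-- in one part forces almost all triples through u w to be missing, so such edges cost more than they gain.
-- Progressive induction on n, deleting vertices of low degree, removes the assumption on the degrees.
--
-- Balanced part sizes are optimal only because optimal packings are dense: unbalancing the parts by one costs n/3
-- triples, so the numbers d of edges of optimal packings must be known up to less than that. On Z_M together with
-- two apices, take all triples of sum s for l residues s; the uncovered pairs {a, s − 2a} are joined to the apices.
-- This covers all pairs l times, except for N + O(1) pairs that are covered once less, where N = M + 2.

module Submission where

open import Defs
open import Data.Bool using (Bool; true; false; _∧_; _∨_; not; if_then_else_; T)
open import Data.Bool.ListAction using (any)
import Data.Bool.Properties as Boolₚ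
open import Data.Empty using (⊥; ⊥-elim)
open import Data.Fin using (Fin; zero; suc; toℕ; fromℕ<; punchIn; inject≤; _↑ˡ_; _↑ʳ_; splitAt; join)
open import Data.Fin.Patterns using (0F; 1F; 2F; 3F)
open import Data.Fin.Properties using (_≟_; any?; all?; toℕ<n; toℕ-injective; toℕ-fromℕ<; suc-injective; punchIn-injective;
  inject≤-injective; splitAt-↑ˡ; splitAt-↑ʳ; join-splitAt)
import Data.Fin.Properties as Finₚ
open import Data.List using (List; []; _∷_; length; filter; concatMap; tabulate; allFin; _++_)
open import Data.List.Properties using (filter-++; length-++)
open import Data.List.Relation.Unary.All using (All; []; _∷_)
import Data.List.Relation.Unary.All as All
open import Data.List.Relation.Unary.AllPairs using (AllPairs; []; _∷_)
import Data.List.Relation.Unary.AllPairs as AllPairs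
open import Data.Nat hiding (_≟_)
open import Data.Nat.Divisibility using (divides)
open import Data.Nat.DivMod using (m≡m%n+[m/n]*n; m%n<n; /-monoˡ-≤; m*n/n≡m; +-distrib-/-∣ʳ; m<n⇒m/n≡0)
open import Data.Nat.Properties hiding (_≟_; suc-injective)
import Data.Nat.Properties as ℕₚ
open import Algebra.Properties.Semiring.Sum +-*-semiring
  using (sum; sum-cong-≗; ∑-distrib-+; ∑-comm; *-distribˡ-sum; *-distribʳ-sum; sum-remove; sum-replicate-zero)
open import Data.Nat.Tactic.RingSolver using (solve-∀)
open import Data.Product using (Σ; _×_; _,_; proj₁; proj₂; ∃)
open import Data.Sum using (_⊎_; inj₁; inj₂)
open import Data.Unit using (tt)
open import Function using (_∘_; id; case_of_)
open import Relation.Binary using (tri<; tri≈; tri>)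
open import Relation.Binary.PropositionalEquality
open import Relation.Nullary using (¬_; Dec; yes; no; does)
open import Relation.Nullary.Decidable using (dec-true; dec-false; from-yes; _⊎-dec_; _×-dec_; ¬?; decidable-stable)
open import Relation.Unary using (Decidable)

-- Finite sums

⟦_⟧ : Bool → ℕ
⟦ b ⟧ = if b then 1 else 0

opaque
  ∑ : ∀ {n} → (Fin n → ℕ) → ℕ
  ∑ = sum

∑∑ : ∀ {m n} → (Fin m → Fin n → ℕ) → ℕ
∑∑ f = ∑ λ i → ∑ (f i)

-- Proves X ≤ Y from A ≤ B, given Y − X = (B − A) + s; both sides are moved so that no subtraction occurs.
linear : ∀ {A B X Y} s → A ≤ B → X + B + s ≡ Y + A → X ≤ Y
linear {A} {B} {X} {Y} s A≤B eq = +-cancelʳ-≤ B X Y (begin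
  X + B     ≤⟨ m≤m+n (X + B) s ⟩
  X + B + s ≡⟨ eq ⟩
  Y + A     ≤⟨ +-monoʳ-≤ Y A≤B ⟩
  Y + B     ∎)
  where open ≤-Reasoning

⟦⟧≤1 : ∀ b → ⟦ b ⟧ ≤ 1
⟦⟧≤1 true  = ≤-refl
⟦⟧≤1 false = z≤n

opaque
  unfolding ∑
  ∑-cong : ∀ {n} {f g : Fin n → ℕ} → (∀ i → f i ≡ g i) → ∑ f ≡ ∑ g
  ∑-cong = sum-cong-≗

∑∑-cong : ∀ {m n} {f g : Fin m → Fin n → ℕ} → (∀ i j → f i j ≡ g i j) → ∑∑ f ≡ ∑∑ g
∑∑-cong e = ∑-cong λ i → ∑-cong (e i)

opaque
  unfolding ∑
  ∑-mono : ∀ {n} {f g : Fin n → ℕ} → (∀ i → f i ≤ g i) → ∑ f ≤ ∑ g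
  ∑-mono {zero}  le = z≤n
  ∑-mono {suc n} le = +-mono-≤ (le zero) (∑-mono (le ∘ suc))

opaque
  unfolding ∑
  ∑-+ : ∀ {n} (f g : Fin n → ℕ) → ∑ (λ i → f i + g i) ≡ ∑ f + ∑ g
  ∑-+ = ∑-distrib-+

  ∑-swap : ∀ {m n} (f : Fin m → Fin n → ℕ) → ∑ (λ i → ∑ (f i)) ≡ ∑ (λ j → ∑ (λ i → f i j))
  ∑-swap = ∑-comm

  ∑-suc : ∀ {n} (f : Fin (suc n) → ℕ) → ∑ f ≡ f zero + ∑ (f ∘ suc)
  ∑-suc f = refl

  ∑-[] : ∀ (f : Fin 0 → ℕ) → ∑ f ≡ 0
  ∑-[] f = refl

∑∑-mono : ∀ {m n} {f g : Fin m → Fin n → ℕ} → (∀ i j → f i j ≤ g i j) → ∑∑ f ≤ ∑∑ g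
∑∑-mono le = ∑-mono λ i → ∑-mono (le i)

∑∑-+ : ∀ {m n} (f g : Fin m → Fin n → ℕ) → ∑∑ (λ i j → f i j + g i j) ≡ ∑∑ f + ∑∑ g
∑∑-+ f g = trans (∑-cong λ i → ∑-+ (f i) (g i)) (∑-+ (λ i → ∑ (f i)) (λ i → ∑ (g i)))

opaque
  unfolding ∑
  ∑-*ˡ : ∀ {n} c (f : Fin n → ℕ) → ∑ (λ i → c * f i) ≡ c * ∑ f
  ∑-*ˡ c f = sym (*-distribˡ-sum c f)

opaque
  unfolding ∑
  ∑-*ʳ : ∀ {n} c (f : Fin n → ℕ) → ∑ (λ i → f i * c) ≡ ∑ f * c
  ∑-*ʳ c f = sym (*-distribʳ-sum c f)

∑∑-*ˡ : ∀ {m n} c (f : Fin m → Fin n → ℕ) → ∑∑ (λ i j → c * f i j) ≡ c * ∑∑ f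
∑∑-*ˡ c f = trans (∑-cong λ i → ∑-*ˡ c (f i)) (∑-*ˡ c (λ i → ∑ (f i)))

opaque
  unfolding ∑
  ∑-const : ∀ n c → ∑ {n} (λ _ → c) ≡ n * c
  ∑-const zero    c = refl
  ∑-const (suc n) c = cong (c +_) (∑-const n c)

opaque
  unfolding ∑
  ∑-zero : ∀ {n} {f : Fin n → ℕ} → (∀ i → f i ≡ 0) → ∑ f ≡ 0
  ∑-zero {n} e = trans (∑-cong e) (sum-replicate-zero n)

∑-bound : ∀ {n} {f : Fin n → ℕ} c → (∀ i → f i ≤ c) → ∑ f ≤ n * c
∑-bound {n} c le = ≤-trans (∑-mono le) (≤-reflexive (∑-const n c))

opaque
  unfolding ∑
  term≤∑ : ∀ {n} (f : Fin n → ℕ) i → f i ≤ ∑ f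
  term≤∑ f zero    = m≤m+n _ _
  term≤∑ f (suc i) = ≤-trans (term≤∑ (f ∘ suc) i) (m≤n+m _ _)

opaque
  unfolding ∑
  ∑-punchIn : ∀ {n} (f : Fin (suc n) → ℕ) v → ∑ f ≡ f v + ∑ (f ∘ punchIn v)
  ∑-punchIn f v = sum-remove {i = v} f

opaque
  unfolding ∑
  ∑-↑ : ∀ m {n} (f : Fin (m + n) → ℕ) → ∑ f ≡ ∑ (λ i → f (i ↑ˡ n)) + ∑ (λ j → f (m ↑ʳ j))
  ∑-↑ zero    f = refl
  ∑-↑ (suc m) f = trans (cong (f zero +_) (∑-↑ m (f ∘ suc))) (sym (+-assoc (f zero) _ _))

infix 7 _==_
_==_ : ∀ {n} → Fin n → Fin n → Bool
i == j = does (i ≟ j)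

==-refl : ∀ {n} (i : Fin n) → (i == i) ≡ true
==-refl i with i ≟ i
... | yes _ = refl
... | no ¬p = ⊥-elim (¬p refl)

==⇒≡ : ∀ {n} {i j : Fin n} → (i == j) ≡ true → i ≡ j
==⇒≡ {i = i} {j} e with i ≟ j
... | yes p = p

==-sound : ∀ {n} {i j : Fin n} → (i == j) ≡ false → i ≢ j
==-sound {i = i} e refl with trans (sym (==-refl i)) e
... | ()

≢⇒== : ∀ {n} {i j : Fin n} → i ≢ j → (i == j) ≡ false
≢⇒== {i = i} {j} ne with i ≟ j
... | yes p = ⊥-elim (ne p)
... | no _  = refl

==-sym : ∀ {n} (i j : Fin n) → (i == j) ≡ (j == i)
==-sym i j with i ≟ j
... | yes refl = sym (==-refl i)
... | no ¬p    = sym (≢⇒== (¬p ∘ sym))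

opaque
  unfolding ∑
  ∑-point : ∀ {n} (a : Fin n) (f : Fin n → ℕ) → ∑ (λ x → ⟦ a == x ⟧ * f x) ≡ f a
  ∑-point {suc n} zero f = trans (cong (f zero + 0 +_) (∑-zero {n} λ i → refl)) (trans (+-identityʳ _) (+-identityʳ _))
  ∑-point (suc a) f = ∑-point a (f ∘ suc)

∑-point₁ : ∀ {n} (a : Fin n) → ∑ (λ x → ⟦ a == x ⟧) ≡ 1
∑-point₁ a = trans (∑-cong λ x → sym (*-identityʳ _)) (∑-point a (λ _ → 1))

opaque
  unfolding ∑
  ∑⟦⟧≤1 : ∀ {n} (P : Fin n → Bool) → (∀ i j → P i ≡ true → P j ≡ true → i ≡ j) → ∑ (λ i → ⟦ P i ⟧) ≤ 1
  ∑⟦⟧≤1 {zero}  P u = z≤n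
  ∑⟦⟧≤1 {suc n} P u with P zero in eq
  ... | false = ∑⟦⟧≤1 (P ∘ suc) λ i j p q → suc-injective (u (suc i) (suc j) p q)
  ... | true  = ≤-reflexive (cong suc (∑-zero none))
    where
    none : ∀ i → ⟦ P (suc i) ⟧ ≡ 0
    none i with P (suc i) in e
    ... | false = refl
    ... | true with u zero (suc i) eq e
    ...   | ()

pigeonhole : ∀ {n} (f g : Fin n → ℕ) → ∑ g < ∑ f → ∃ λ i → g i < f i
pigeonhole f g lt with any? (λ i → g i <? f i)
... | yes p = p
... | no ¬p = ⊥-elim (<⇒≱ lt (∑-mono λ i → ≮⇒≥ λ l → ¬p (i , l)))

pigeonhole₂ : ∀ {m n} (f g : Fin m → Fin n → ℕ) → ∑∑ g < ∑∑ f → ∃ λ i → ∃ λ j → g i j < f i j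
pigeonhole₂ f g lt with pigeonhole _ _ lt
... | i , l = i , pigeonhole (f i) (g i) l

record Enumeration {n} (P : Fin n → Bool) : Set where
  field
    size    : ℕ
    size-≡  : size ≡ ∑ λ v → ⟦ P v ⟧
    ι       : Fin size → Fin n
    ι-inj   : ∀ i j → ι i ≡ ι j → i ≡ j
    ι-holds : ∀ i → P (ι i) ≡ true
    ι-sum   : ∀ (f : Fin n → ℕ) → ∑ (λ v → ⟦ P v ⟧ * f v) ≡ ∑ (f ∘ ι)

opaque
  unfolding ∑
  enumeration : ∀ {n} (P : Fin n → Bool) → Enumeration P
  enumeration {zero}  P = record
    { size = 0 ; size-≡ = refl ; ι = λ () ; ι-inj = λ () ; ι-holds = λ () ; ι-sum = λ f → refl }
  enumeration {suc n} P = extend (P zero) refl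
    where
    open Enumeration (enumeration (P ∘ suc))
    extend : ∀ b → P zero ≡ b → Enumeration P
    extend false eq = record
      { size    = size
      ; size-≡  = trans size-≡ (cong (λ b → ⟦ b ⟧ + ∑ (λ v → ⟦ P (suc v) ⟧)) (sym eq))
      ; ι       = suc ∘ ι
      ; ι-inj   = λ i j e → ι-inj i j (suc-injective e)
      ; ι-holds = ι-holds
      ; ι-sum   = λ f → trans (cong (λ b → ⟦ b ⟧ * f zero + ∑ (λ v → ⟦ P (suc v) ⟧ * f (suc v))) eq) (ι-sum (f ∘ suc))
      }
    extend true eq = record
      { size    = suc size
      ; size-≡  = trans (cong suc size-≡) (cong (λ b → ⟦ b ⟧ + ∑ (λ v → ⟦ P (suc v) ⟧)) (sym eq))
      ; ι       = ι′
      ; ι-inj   = inj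
      ; ι-holds = holds
      ; ι-sum   = λ f → trans (cong (λ b → ⟦ b ⟧ * f zero + ∑ (λ v → ⟦ P (suc v) ⟧ * f (suc v))) eq)
                              (cong₂ _+_ (+-identityʳ (f zero)) (ι-sum (f ∘ suc)))
      }
      where
      ι′ : Fin (suc size) → Fin (suc n)
      ι′ zero    = zero
      ι′ (suc i) = suc (ι i)
      inj : ∀ i j → ι′ i ≡ ι′ j → i ≡ j
      inj zero    zero    e = refl
      inj (suc i) (suc j) e = cong suc (ι-inj i j (suc-injective e))
      holds : ∀ i → P (ι′ i) ≡ true
      holds zero    = eq
      holds (suc i) = ι-holds i

∧-true : ∀ {a b} → a ∧ b ≡ true → a ≡ true × b ≡ true
∧-true {true} {true} _ = refl , refl

∧-intro : ∀ {a b} → a ≡ true → b ≡ true → a ∧ b ≡ true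
∧-intro refl refl = refl

⟦⟧-∧ : ∀ a b → ⟦ a ∧ b ⟧ ≡ ⟦ a ⟧ * ⟦ b ⟧
⟦⟧-∧ true  b = sym (+-identityʳ _)
⟦⟧-∧ false b = refl

⟦⟧-mono : ∀ {a b} → (a ≡ true → b ≡ true) → ⟦ a ⟧ ≤ ⟦ b ⟧
⟦⟧-mono {true}  f rewrite f refl = ≤-refl
⟦⟧-mono {false} f = z≤n

⟦⟧-not : ∀ b → ⟦ b ⟧ + ⟦ not b ⟧ ≡ 1
⟦⟧-not true  = refl
⟦⟧-not false = refl

bool-≡ : ∀ {a b : Bool} → (a ≡ true → b ≡ true) → (b ≡ true → a ≡ true) → a ≡ b
bool-≡ {true}  {true}  f g = refl
bool-≡ {true}  {false} f g = sym (f refl)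
bool-≡ {false} {true}  f g = g refl
bool-≡ {false} {false} f g = refl

not-true : ∀ {b} → (b ≡ true → ⊥) → b ≡ false
not-true {true}  f = ⊥-elim (f refl)
not-true {false} f = refl

-- Counting edges

∑³ : ∀ {n} → (Fin n → Fin n → Fin n → ℕ) → ℕ
∑³ f = ∑ λ a → ∑∑ (f a)

∑³-cong : ∀ {n} {f g : Fin n → Fin n → Fin n → ℕ} → (∀ a b c → f a b c ≡ g a b c) → ∑³ f ≡ ∑³ g
∑³-cong e = ∑-cong λ a → ∑∑-cong (e a)

∑³-mono : ∀ {n} {f g : Fin n → Fin n → Fin n → ℕ} → (∀ a b c → f a b c ≤ g a b c) → ∑³ f ≤ ∑³ g
∑³-mono le = ∑-mono λ a → ∑∑-mono (le a)

∑³-+ : ∀ {n} (f g : Fin n → Fin n → Fin n → ℕ) → ∑³ (λ a b c → f a b c + g a b c) ≡ ∑³ f + ∑³ g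
∑³-+ f g = trans (∑-cong λ a → ∑∑-+ (f a) (g a)) (∑-+ (λ a → ∑∑ (f a)) (λ a → ∑∑ (g a)))

∑³-+₃ : ∀ {n} (f g h : Fin n → Fin n → Fin n → ℕ) → ∑³ (λ a b c → f a b c + g a b c + h a b c) ≡ ∑³ f + ∑³ g + ∑³ h
∑³-+₃ f g h = trans (∑³-+ (λ a b c → f a b c + g a b c) h) (cong (_+ ∑³ h) (∑³-+ f g))

∑³-swap₁₂ : ∀ {n} (f : Fin n → Fin n → Fin n → ℕ) → ∑³ (λ a b c → f b a c) ≡ ∑³ f
∑³-swap₁₂ f = ∑-swap (λ a b → ∑ (f b a))

∑³-swap₂₃ : ∀ {n} (f : Fin n → Fin n → Fin n → ℕ) → ∑³ (λ a b c → f a c b) ≡ ∑³ f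
∑³-swap₂₃ f = ∑-cong λ a → ∑-swap (λ b c → f a c b)

∑³-rotate : ∀ {n} (f : Fin n → Fin n → Fin n → ℕ) → ∑³ (λ a b c → f b c a) ≡ ∑³ f
∑³-rotate f = trans (∑³-swap₁₂ (λ a b c → f a c b)) (∑³-swap₂₃ f)

χ : ∀ {n} → Graph3 n → Fin n → Fin n → Fin n → ℕ
χ H a b c = ⟦ edge H a b c ⟧

module _ {n} (H : Graph3 n) where

  edge-rotate : ∀ a b c → edge H a b c ≡ edge H b c a
  edge-rotate a b c = trans (swap₁₂ H a b c) (swap₂₃ H b a c)

  edge-swap₁₃ : ∀ a b c → edge H a b c ≡ edge H c b a
  edge-swap₁₃ a b c = trans (edge-rotate a b c) (swap₁₂ H b c a)

  χ-swap₁₂ : ∀ a b c → χ H a b c ≡ χ H b a c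
  χ-swap₁₂ a b c = cong ⟦_⟧ (swap₁₂ H a b c)

  χ-swap₂₃ : ∀ a b c → χ H a b c ≡ χ H a c b
  χ-swap₂₃ a b c = cong ⟦_⟧ (swap₂₃ H a b c)

  χ-rotate : ∀ a b c → χ H a b c ≡ χ H b c a
  χ-rotate a b c = cong ⟦_⟧ (edge-rotate a b c)

  χ-swap₁₃ : ∀ a b c → χ H a b c ≡ χ H c b a
  χ-swap₁₃ a b c = cong ⟦_⟧ (edge-swap₁₃ a b c)

  edge-≢₁₂ : ∀ {a b c} → edge H a b c ≡ true → a ≢ b
  edge-≢₁₂ {a} {c = c} e refl with trans (sym (noLoop H a c)) e
  ... | ()

  edge-≢₂₃ : ∀ {a b c} → edge H a b c ≡ true → b ≢ c
  edge-≢₂₃ e = edge-≢₁₂ (trans (sym (edge-rotate _ _ _)) e)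

  edge-≢₁₃ : ∀ {a b c} → edge H a b c ≡ true → a ≢ c
  edge-≢₁₃ e = edge-≢₁₂ (trans (sym (swap₂₃ H _ _ _)) e)

edges₆ : ∀ {n} → Graph3 n → ℕ
edges₆ H = ∑³ (χ H)

degree₂ : ∀ {n} → Graph3 n → Fin n → ℕ
degree₂ H v = ∑∑ (χ H v)

length-filter-tabulate : ∀ {n} {A : Set} {P : A → Set} (P? : Decidable P) (f : Fin n → A) →
  length (filter P? (tabulate f)) ≡ ∑ (λ i → ⟦ does (P? (f i)) ⟧)
length-filter-tabulate {zero}  P? f = sym (∑-[] _)
length-filter-tabulate {suc n} P? f = trans step (sym (∑-suc λ i → ⟦ does (P? (f i)) ⟧))
  where
  step : length (filter P? (tabulate f)) ≡ ⟦ does (P? (f zero)) ⟧ + ∑ (λ i → ⟦ does (P? (f (suc i))) ⟧)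
  step with does (P? (f zero))
  ... | true  = cong suc (length-filter-tabulate P? (f ∘ suc))
  ... | false = length-filter-tabulate P? (f ∘ suc)

length-filter-concatMap : ∀ {n} {A B : Set} {P : B → Set} (P? : Decidable P) (f : A → List B) (g : Fin n → A) →
  length (filter P? (concatMap f (tabulate g))) ≡ ∑ (λ i → length (filter P? (f (g i))))
length-filter-concatMap {zero}  P? f g = sym (∑-[] _)
length-filter-concatMap {suc n} P? f g = begin
  length (filter P? (f (g zero) ++ concatMap f (tabulate (g ∘ suc))))
    ≡⟨ cong length (filter-++ P? (f (g zero)) _) ⟩
  length (filter P? (f (g zero)) ++ filter P? (concatMap f (tabulate (g ∘ suc))))
    ≡⟨ length-++ (filter P? (f (g zero))) ⟩
  length (filter P? (f (g zero))) + length (filter P? (concatMap f (tabulate (g ∘ suc))))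
    ≡⟨ cong (length (filter P? (f (g zero))) +_) (length-filter-concatMap P? f (g ∘ suc)) ⟩
  length (filter P? (f (g zero))) + ∑ (λ i → length (filter P? (f (g (suc i)))))
    ≡⟨ ∑-suc (λ i → length (filter P? (f (g i)))) ⟨
  ∑ (λ i → length (filter P? (f (g i)))) ∎
  where open ≡-Reasoning

does-≟true : ∀ b → does (b Boolₚ.≟ true) ≡ b
does-≟true true  = refl
does-≟true false = refl

codeg-∑ : ∀ {n} (H : Graph3 n) a b → codeg H a b ≡ ∑ (χ H a b)
codeg-∑ H a b = trans (length-filter-tabulate (λ c → edge H a b c Boolₚ.≟ true) id)
                      (∑-cong λ c → cong ⟦_⟧ (does-≟true (edge H a b c)))

-- Unification recovers the function that is local to the definition of orderedTriples.
orderedTriples-concatMap : ∀ n → ∃ λ (f : Fin n → Fin n → Fin n → List (Fin n × Fin n × Fin n)) →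
  orderedTriples n ≡ concatMap (λ a → concatMap (λ b → concatMap (λ c → f a b c) (allFin n)) (allFin n)) (allFin n)
orderedTriples-concatMap n = _ , refl

sortedTriple : ∀ n → Fin n → Fin n → Fin n → List (Fin n × Fin n × Fin n)
sortedTriple n = proj₁ (orderedTriples-concatMap n)

module _ {n} (H : Graph3 n) where

  sorted : Fin n → Fin n → Fin n → ℕ
  sorted a b c = ⟦ does (a Finₚ.<? b) ∧ does (b Finₚ.<? c) ⟧ * χ H a b c

  numEdges-∑ : numEdges H ≡ ∑³ sorted
  numEdges-∑ = begin
    length (filter (edgeDec H) (orderedTriples n))
      ≡⟨ cong (length ∘ filter (edgeDec H)) (proj₂ (orderedTriples-concatMap n)) ⟩
    length (filter (edgeDec H) (concatMap (λ a → concatMap (λ b → concatMap (sortedTriple n a b) (allFin n)) (allFin n)) (allFin n)))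
      ≡⟨ length-filter-concatMap (edgeDec H) (λ a → concatMap (λ b → concatMap (sortedTriple n a b) (allFin n)) (allFin n)) id ⟩
    ∑ (λ a → length (filter (edgeDec H) (concatMap (λ b → concatMap (sortedTriple n a b) (allFin n)) (allFin n))))
      ≡⟨ ∑-cong (λ a → length-filter-concatMap (edgeDec H) (λ b → concatMap (sortedTriple n a b) (allFin n)) id) ⟩
    ∑∑ (λ a b → length (filter (edgeDec H) (concatMap (sortedTriple n a b) (allFin n))))
      ≡⟨ ∑∑-cong (λ a b → length-filter-concatMap (edgeDec H) (sortedTriple n a b) id) ⟩
    ∑³ (λ a b c → length (filter (edgeDec H) (sortedTriple n a b c)))
      ≡⟨ ∑³-cong single ⟩
    ∑³ sorted ∎
    where
    open ≡-Reasoning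
    single : ∀ a b c → length (filter (edgeDec H) (sortedTriple n a b c)) ≡ sorted a b c
    single a b c with a Finₚ.<? b | b Finₚ.<? c
    ... | yes p | yes q rewrite dec-true (a Finₚ.<? b) p | dec-true (b Finₚ.<? c) q with edge H a b c
    ...   | true  = refl
    ...   | false = refl
    single a b c | yes p | no q rewrite dec-true (a Finₚ.<? b) p | dec-false (b Finₚ.<? c) q = refl
    single a b c | no p  | _    rewrite dec-false (a Finₚ.<? b) p = refl

  sixOrders : ∀ a b c → χ H a b c ≡
    (sorted a b c + sorted b c a + sorted c a b) + (sorted a c b + sorted c b a + sorted b a c)
  sixOrders a b c
    rewrite sym (χ-rotate H a b c) | χ-rotate H c a b | sym (χ-swap₂₃ H a b c) | sym (χ-swap₁₃ H a b c) | sym (χ-swap₁₂ H a b c)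
    with edge H a b c in e
  ... | false
    rewrite *-zeroʳ ⟦ does (a Finₚ.<? b) ∧ does (b Finₚ.<? c) ⟧ | *-zeroʳ ⟦ does (b Finₚ.<? c) ∧ does (c Finₚ.<? a) ⟧
          | *-zeroʳ ⟦ does (c Finₚ.<? a) ∧ does (a Finₚ.<? b) ⟧ | *-zeroʳ ⟦ does (a Finₚ.<? c) ∧ does (c Finₚ.<? b) ⟧
          | *-zeroʳ ⟦ does (c Finₚ.<? b) ∧ does (b Finₚ.<? a) ⟧ | *-zeroʳ ⟦ does (b Finₚ.<? a) ∧ does (a Finₚ.<? c) ⟧ = refl
  ... | true with Finₚ.<-cmp a b | Finₚ.<-cmp b c | Finₚ.<-cmp a c
  ...   | tri≈ _ p _ | _ | _ = ⊥-elim (edge-≢₁₂ H e p)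
  ...   | _ | tri≈ _ p _ | _ = ⊥-elim (edge-≢₂₃ H e p)
  ...   | _ | _ | tri≈ _ p _ = ⊥-elim (edge-≢₁₃ H e p)
  ...   | tri< ab _ _ | tri< bc _ _ | tri> ¬ac _ _ = ⊥-elim (¬ac (Finₚ.<-trans ab bc))
  ...   | tri> ¬ab _ ba | tri> ¬bc _ cb | tri< ac _ _ = ⊥-elim (¬ab (<-trans ac cb))
  ...   | tri< ab _ ¬ba | tri< bc _ ¬cb | tri< ac _ ¬ca
    rewrite dec-true (a Finₚ.<? b) ab | dec-false (b Finₚ.<? a) ¬ba | dec-true (b Finₚ.<? c) bc
          | dec-false (c Finₚ.<? b) ¬cb | dec-true (a Finₚ.<? c) ac | dec-false (c Finₚ.<? a) ¬ca = refl
  ...   | tri< ab _ ¬ba | tri> ¬bc _ cb | tri< ac _ ¬ca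
    rewrite dec-true (a Finₚ.<? b) ab | dec-false (b Finₚ.<? a) ¬ba | dec-false (b Finₚ.<? c) ¬bc
          | dec-true (c Finₚ.<? b) cb | dec-true (a Finₚ.<? c) ac | dec-false (c Finₚ.<? a) ¬ca = refl
  ...   | tri< ab _ ¬ba | tri> ¬bc _ cb | tri> ¬ac _ ca
    rewrite dec-true (a Finₚ.<? b) ab | dec-false (b Finₚ.<? a) ¬ba | dec-false (b Finₚ.<? c) ¬bc
          | dec-true (c Finₚ.<? b) cb | dec-false (a Finₚ.<? c) ¬ac | dec-true (c Finₚ.<? a) ca = refl
  ...   | tri> ¬ab _ ba | tri< bc _ ¬cb | tri< ac _ ¬ca
    rewrite dec-false (a Finₚ.<? b) ¬ab | dec-true (b Finₚ.<? a) ba | dec-true (b Finₚ.<? c) bc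
          | dec-false (c Finₚ.<? b) ¬cb | dec-true (a Finₚ.<? c) ac | dec-false (c Finₚ.<? a) ¬ca = refl
  ...   | tri> ¬ab _ ba | tri< bc _ ¬cb | tri> ¬ac _ ca
    rewrite dec-false (a Finₚ.<? b) ¬ab | dec-true (b Finₚ.<? a) ba | dec-true (b Finₚ.<? c) bc
          | dec-false (c Finₚ.<? b) ¬cb | dec-false (a Finₚ.<? c) ¬ac | dec-true (c Finₚ.<? a) ca = refl
  ...   | tri> ¬ab _ ba | tri> ¬bc _ cb | tri> ¬ac _ ca
    rewrite dec-false (a Finₚ.<? b) ¬ab | dec-true (b Finₚ.<? a) ba | dec-false (b Finₚ.<? c) ¬bc
          | dec-true (c Finₚ.<? b) cb | dec-false (a Finₚ.<? c) ¬ac | dec-true (c Finₚ.<? a) ca = refl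

  edges₆-numEdges : edges₆ H ≡ 6 * numEdges H
  edges₆-numEdges = begin
    edges₆ H
      ≡⟨ ∑³-cong sixOrders ⟩
    ∑³ (λ a b c → (sorted a b c + sorted b c a + sorted c a b) + (sorted a c b + sorted c b a + sorted b a c))
      ≡⟨ trans (∑³-+ _ _) (cong₂ _+_ (∑³-+₃ sorted (λ a b c → sorted b c a) (λ a b c → sorted c a b))
                                     (∑³-+₃ (λ a b c → sorted a c b) (λ a b c → sorted c b a) (λ a b c → sorted b a c))) ⟩
    (∑³ sorted + ∑³ (λ a b c → sorted b c a) + ∑³ (λ a b c → sorted c a b))
      + (∑³ (λ a b c → sorted a c b) + ∑³ (λ a b c → sorted c b a) + ∑³ (λ a b c → sorted b a c))
      ≡⟨ cong₂ _+_
           (cong₂ _+_ (cong (∑³ sorted +_) (∑³-rotate sorted)) (trans (∑³-rotate (λ a b c → sorted b c a)) (∑³-rotate sorted)))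
           (cong₂ _+_ (cong₂ _+_ (∑³-swap₂₃ sorted) (trans (∑³-rotate (λ a b c → sorted b a c)) (∑³-swap₁₂ sorted))) (∑³-swap₁₂ sorted)) ⟩
    (∑³ sorted + ∑³ sorted + ∑³ sorted) + (∑³ sorted + ∑³ sorted + ∑³ sorted)
      ≡⟨ six (∑³ sorted) ⟩
    6 * ∑³ sorted
      ≡⟨ cong (6 *_) numEdges-∑ ⟨
    6 * numEdges H ∎
    where
    open ≡-Reasoning
    six : ∀ x → (x + x + x) + (x + x + x) ≡ 6 * x
    six = solve-∀

-- Edges whose links are almost disjoint

Free : ∀ {n} → ℕ → Graph3 n → Set
Free t H = ContainsF5blowup t H → ⊥

≡⇒T : ∀ {b} → b ≡ true → T b
≡⇒T refl = tt

∑⟦⟧≤n : ∀ {n} (P : Fin n → Bool) → ∑ (λ i → ⟦ P i ⟧) ≤ n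
∑⟦⟧≤n {n} P = ≤-trans (∑-bound 1 λ i → ⟦⟧≤1 (P i)) (≤-reflexive (*-identityʳ n))

choose : ∀ {n} t (P : Fin n → Bool) → t ≤ ∑ (λ i → ⟦ P i ⟧) →
  Σ (Fin t → Fin n) λ h → (∀ i j → h i ≡ h j → i ≡ j) × (∀ i → P (h i) ≡ true)
choose t P le = (λ i → ι (inject≤ i le′)) , (λ i j e → inject≤-injective le′ le′ i j (ι-inj _ _ e)) , λ i → ι-holds _
  where
  open Enumeration (enumeration P)
  le′ : t ≤ size
  le′ = ≤-trans le (≤-reflexive (sym size-≡))

linkIntersection : ∀ {n} → Graph3 n → Fin n → Fin n → ℕ
linkIntersection H x y = ∑∑ λ p q → χ H x p q * χ H y p q

linkIntersection-sym : ∀ {n} (H : Graph3 n) x y → linkIntersection H x y ≡ linkIntersection H y x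
linkIntersection-sym H x y = ∑∑-cong λ p q → *-comm (χ H x p q) (χ H y p q)

module _ {n} (H : Graph3 n) (l : ℕ) (free : Free (suc l) H) where

  ¬blowup : ∀ {f₁ f₂ f₄ f₅} (h : Fin (suc l) → Fin n) → (∀ i j → h i ≡ h j → i ≡ j) → f₁ ≢ f₅ → f₂ ≢ f₅ →
    edge H f₁ f₂ f₄ ≡ true → (∀ i → edge H f₁ f₂ (h i) ≡ true) → (∀ i → edge H (h i) f₄ f₅ ≡ true) → ⊥
  ¬blowup {f₁} {f₂} {f₄} {f₅} h inj f₁≢f₅ f₂≢f₅ e e₁ e₂ = free
    ( f₁ , f₂ , f₄ , f₅ , h , edge-≢₁₂ H e , edge-≢₁₃ H e , f₁≢f₅ , edge-≢₂₃ H e , f₂≢f₅ , edge-≢₂₃ H (e₂ zero)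
    , (λ {i} {j} → inj i j)
    , (λ i → (λ r → edge-≢₁₃ H (e₁ i) (sym r)) , (λ r → edge-≢₂₃ H (e₁ i) (sym r)) , edge-≢₁₂ H (e₂ i) , edge-≢₁₃ H (e₂ i))
    , ≡⇒T e , λ i → ≡⇒T (e₁ i) , ≡⇒T (e₂ i))

  commonNeighbours : ∀ f₁ f₂ f₄ f₅ → f₁ ≢ f₅ → f₂ ≢ f₅ → edge H f₁ f₂ f₄ ≡ true →
    ∑ (λ h → ⟦ edge H f₁ f₂ h ∧ edge H h f₄ f₅ ⟧) ≤ l
  commonNeighbours f₁ f₂ f₄ f₅ f₁≢f₅ f₂≢f₅ e with suc l ≤? ∑ (λ h → ⟦ edge H f₁ f₂ h ∧ edge H h f₄ f₅ ⟧)
  ... | no ¬p = ≤-pred (≰⇒> ¬p)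
  ... | yes p with choose (suc l) _ p
  ...   | h , inj , holds = ⊥-elim (¬blowup h inj f₁≢f₅ f₂≢f₅ e
    (λ i → proj₁ (∧-true (holds i))) (λ i → proj₂ (∧-true {edge H f₁ f₂ (h i)} (holds i))))

  private
    I = linkIntersection H

  sharedPair : ∀ y z p q →
    ∑ (λ x → χ H x y z * (χ H x p q * χ H y p q)) ≤ l + (⟦ z == p ⟧ * n + ⟦ z == q ⟧ * n)
  sharedPair y z p q with edge H y p q in e | z == p in zp | z == q in zq
  ... | false | _ | _ = ≤-trans (≤-reflexive (∑-zero λ x → trans (cong (χ H x y z *_) (*-zeroʳ (χ H x p q))) (*-zeroʳ (χ H x y z)))) z≤n
  ... | true | true | _ = ≤-trans (≤-trans (∑-mono le) (∑⟦⟧≤n λ x → edge H x y z))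
                            (≤-trans (≤-trans (m≤m+n n 0) (m≤m+n _ _)) (m≤n+m _ l))
    where
    le : ∀ x → χ H x y z * (χ H x p q * 1) ≤ χ H x y z
    le x = ≤-trans (*-monoʳ-≤ (χ H x y z) (≤-trans (≤-reflexive (*-identityʳ (χ H x p q))) (⟦⟧≤1 (edge H x p q)))) (≤-reflexive (*-identityʳ _))
  ... | true | false | true = ≤-trans (≤-trans (∑-mono le) (∑⟦⟧≤n λ x → edge H x y z))
                            (≤-trans (m≤m+n n 0) (m≤n+m _ l))
    where
    le : ∀ x → χ H x y z * (χ H x p q * 1) ≤ χ H x y z
    le x = ≤-trans (*-monoʳ-≤ (χ H x y z) (≤-trans (≤-reflexive (*-identityʳ (χ H x p q))) (⟦⟧≤1 (edge H x p q)))) (≤-reflexive (*-identityʳ _))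
  ... | true | false | false = ≤-trans (≤-reflexive (∑-cong eq))
    (≤-trans (commonNeighbours p q y z (λ r → ==-sound zp (sym r)) (λ r → ==-sound zq (sym r)) (trans (sym (edge-rotate H y p q)) e)) (m≤m+n l _))
    where
    eq : ∀ x → χ H x y z * (χ H x p q * 1) ≡ ⟦ edge H p q x ∧ edge H x y z ⟧
    eq x rewrite edge-rotate H x p q = trans (cong (χ H x y z *_) (*-identityʳ (χ H p q x)))
      (trans (*-comm (χ H x y z) _) (sym (⟦⟧-∧ (edge H p q x) (edge H x y z))))

  linkIntersection-∑ : ∀ y z → ∑ (λ x → χ H x y z * I x y) ≤ (l + 2) * (n * n)
  linkIntersection-∑ y z = begin
    ∑ (λ x → χ H x y z * I x y)
      ≡⟨ ∑-cong (λ x → sym (∑∑-*ˡ (χ H x y z) (λ p q → χ H x p q * χ H y p q))) ⟩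
    ∑³ (λ x p q → χ H x y z * (χ H x p q * χ H y p q))
      ≡⟨ ∑³-rotate (λ p q x → χ H x y z * (χ H x p q * χ H y p q)) ⟩
    ∑∑ (λ p q → ∑ (λ x → χ H x y z * (χ H x p q * χ H y p q)))
      ≤⟨ ∑∑-mono (sharedPair y z) ⟩
    ∑∑ (λ p q → l + (⟦ z == p ⟧ * n + ⟦ z == q ⟧ * n))
      ≡⟨ trans (∑∑-+ (λ p q → l) (λ p q → ⟦ z == p ⟧ * n + ⟦ z == q ⟧ * n))
               (cong (∑∑ (λ _ _ → l) +_) (∑∑-+ (λ p q → ⟦ z == p ⟧ * n) (λ p q → ⟦ z == q ⟧ * n))) ⟩
    ∑∑ {n} {n} (λ _ _ → l) + (∑∑ {n} {n} (λ p q → ⟦ z == p ⟧ * n) + ∑∑ {n} {n} (λ p q → ⟦ z == q ⟧ * n))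
      ≡⟨ cong₂ _+_ (trans (∑-cong λ _ → ∑-const n l) (∑-const n (n * l))) (cong₂ _+_
           (trans (∑-cong λ p → trans (∑-const n _) (*-comm n _)) (trans (∑-cong λ p → *-assoc ⟦ z == p ⟧ n n) (∑-point z λ _ → n * n)))
           (trans (∑-cong λ p → ∑-point z λ _ → n) (∑-const n n))) ⟩
    n * (n * l) + (n * n + n * n)
      ≡⟨ arith n l ⟩
    (l + 2) * (n * n) ∎
    where
    open ≤-Reasoning
    arith : ∀ n l → n * (n * l) + (n * n + n * n) ≡ (l + 2) * (n * n)
    arith = solve-∀

  module Cleaning (B : ℕ) .{{_ : NonZero n}} where

    bad : Fin n → Fin n → Bool
    bad x y = does (n * n <? B * I x y)

    bad-sym : ∀ x y → bad x y ≡ bad y x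
    bad-sym x y = cong (λ k → does (n * n <? B * k)) (linkIntersection-sym H x y)

    bad-∑ : ∀ y z → ∑ (λ x → ⟦ edge H x y z ∧ bad x y ⟧) ≤ (l + 2) * B
    bad-∑ y z = *-cancelˡ-≤ (n * n) {{m*n≢0 n n}} (begin
      n * n * ∑ (λ x → ⟦ edge H x y z ∧ bad x y ⟧)
        ≡⟨ ∑-*ˡ (n * n) _ ⟨
      ∑ (λ x → n * n * ⟦ edge H x y z ∧ bad x y ⟧)
        ≤⟨ ∑-mono le ⟩
      ∑ (λ x → B * (χ H x y z * I x y))
        ≡⟨ ∑-*ˡ B _ ⟩
      B * ∑ (λ x → χ H x y z * I x y)
        ≤⟨ *-monoʳ-≤ B (linkIntersection-∑ y z) ⟩
      B * ((l + 2) * (n * n))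
        ≡⟨ arith B (l + 2) (n * n) ⟩
      n * n * ((l + 2) * B) ∎)
      where
      open ≤-Reasoning
      arith : ∀ B k m → B * (k * m) ≡ m * (k * B)
      arith = solve-∀
      le : ∀ x → n * n * ⟦ edge H x y z ∧ bad x y ⟧ ≤ B * (χ H x y z * I x y)
      le x with edge H x y z
      ... | false = ≤-trans (≤-reflexive (*-zeroʳ (n * n))) z≤n
      ... | true with n * n <? B * I x y
      ...   | no ¬p rewrite dec-false (n * n <? B * I x y) ¬p = ≤-trans (≤-reflexive (*-zeroʳ (n * n))) z≤n
      ...   | yes p rewrite dec-true (n * n <? B * I x y) p | *-identityʳ (n * n) | +-identityʳ (I x y) = <⇒≤ p

    clean : Graph3 n
    clean .edge a b c = edge H a b c ∧ (not (bad a b) ∧ not (bad b c) ∧ not (bad a c))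
    clean .swap₁₂ a b c rewrite swap₁₂ H a b c | bad-sym b a =
      cong (λ t → edge H b a c ∧ (not (bad a b) ∧ t)) (Boolₚ.∧-comm (not (bad b c)) (not (bad a c)))
    clean .swap₂₃ a b c rewrite swap₂₃ H a b c | bad-sym c b =
      cong (edge H a c b ∧_) (trans (Boolₚ.∧-comm (not (bad a b)) _) (trans
        (cong (_∧ not (bad a b)) (Boolₚ.∧-comm (not (bad b c)) (not (bad a c)))) (Boolₚ.∧-assoc (not (bad a c)) _ _)))
    clean .noLoop a c rewrite noLoop H a c = refl

    clean⊆ : ∀ {a b c} → edge clean a b c ≡ true → edge H a b c ≡ true
    clean⊆ e = proj₁ (∧-true e)

    clean-links : ∀ {a b c} → edge clean a b c ≡ true → B * linkIntersection clean a b ≤ n * n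
    clean-links {a} {b} {c} e = ≤-trans (*-monoʳ-≤ B (∑∑-mono λ p q → *-mono-≤ (⟦⟧-mono {edge clean a p q} clean⊆) (⟦⟧-mono {edge clean b p q} clean⊆)))
                                (≮⇒≥ λ lt → not-false (dec-true (n * n <? B * I a b) lt))
      where
      not-false : bad a b ≡ true → ⊥
      not-false t with trans (sym (cong not t)) (proj₁ (∧-true (proj₂ (∧-true {edge H a b c} e))))
      ... | ()

    degree-clean : ∀ v → degree₂ H v ≤ degree₂ clean v + 3 * (n * ((l + 2) * B))
    degree-clean v = begin
      ∑∑ (χ H v)
        ≤⟨ ∑∑-mono le ⟩
      ∑∑ (λ x z → χ clean v x z + (b₁ x z + (b₂ x z + b₃ x z)))
        ≡⟨ trans (∑∑-+ (χ clean v) (λ x z → b₁ x z + (b₂ x z + b₃ x z))) (cong (degree₂ clean v +_)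
             (trans (∑∑-+ b₁ (λ x z → b₂ x z + b₃ x z)) (cong (∑∑ b₁ +_) (∑∑-+ b₂ b₃)))) ⟩
      degree₂ clean v + (∑∑ b₁ + (∑∑ b₂ + ∑∑ b₃))
        ≤⟨ +-monoʳ-≤ (degree₂ clean v) (+-mono-≤ (≤-trans (≤-reflexive (∑-swap b₁)) (∑-bound K λ z → le₁ z))
             (+-mono-≤ (∑-bound K le₂) (∑-bound K le₃))) ⟩
      degree₂ clean v + (n * K + (n * K + n * K))
        ≡⟨ cong (degree₂ clean v +_) (arith (n * K)) ⟩
      degree₂ clean v + 3 * (n * K) ∎
      where
      open ≤-Reasoning
      K = (l + 2) * B
      b₁ b₂ b₃ : Fin n → Fin n → ℕ
      b₁ x z = ⟦ edge H v x z ∧ bad v x ⟧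
      b₂ x z = ⟦ edge H v x z ∧ bad v z ⟧
      b₃ x z = ⟦ edge H v x z ∧ bad x z ⟧
      arith : ∀ k → k + (k + k) ≡ 3 * k
      arith = solve-∀
      le : ∀ x z → χ H v x z ≤ χ clean v x z + (b₁ x z + (b₂ x z + b₃ x z))
      le x z with edge H v x z | bad v x | bad x z | bad v z
      ... | false | _     | _     | _     = z≤n
      ... | true  | true  | _     | _     = s≤s z≤n
      ... | true  | false | true  | true  = s≤s z≤n
      ... | true  | false | true  | false = s≤s z≤n
      ... | true  | false | false | true  = s≤s z≤n
      ... | true  | false | false | false = s≤s z≤n
      le₁ : ∀ z → ∑ (λ x → b₁ x z) ≤ K
      le₁ z = ≤-trans (≤-reflexive (∑-cong λ x → cong ⟦_⟧ (cong₂ _∧_ (swap₁₂ H v x z) (bad-sym v x)))) (bad-∑ v z)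
      le₂ : ∀ x → ∑ (b₂ x) ≤ K
      le₂ x = ≤-trans (≤-reflexive (∑-cong λ z → cong ⟦_⟧ (cong₂ _∧_ (trans (swap₂₃ H v x z) (swap₁₂ H v z x)) (bad-sym v z)))) (bad-∑ v x)
      le₃ : ∀ x → ∑ (b₃ x) ≤ K
      le₃ x = ≤-trans (≤-reflexive (∑-cong λ z → cong ⟦_⟧ (cong₂ _∧_ (edge-swap₁₃ H v x z) (bad-sym x z)))) (bad-∑ x v)

-- Turán's theorem

2xy≤x²+y² : ∀ x y → 2 * (x * y) ≤ x * x + y * y
2xy≤x²+y² x y with ≤-total x y
... | inj₁ le = ordered x y le
  where
  ordered : ∀ x y → x ≤ y → 2 * (x * y) ≤ x * x + y * y
  ordered x y le with m≤n⇒∃[o]m+o≡n le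
  ... | k , refl = linear (k * k) (z≤n {0}) (arith x k)
    where
    arith : ∀ x k → 2 * (x * (x + k)) + 0 + k * k ≡ x * x + (x + k) * (x + k) + 0
    arith = solve-∀
... | inj₂ le with m≤n⇒∃[o]m+o≡n le
...   | k , refl = linear (k * k) (z≤n {0}) (arith y k)
  where
  arith : ∀ y k → 2 * ((y + k) * y) + 0 + k * k ≡ (y + k) * (y + k) + y * y + 0
  arith = solve-∀

products≤squares : ∀ a b c → a * b + b * c + c * a ≤ a * a + b * b + c * c
products≤squares a b c = *-cancelˡ-≤ 2 (linear 0 (+-mono-≤ (2xy≤x²+y² a b) (+-mono-≤ (2xy≤x²+y² b c) (2xy≤x²+y² c a))) (arith a b c))
  where
  arith : ∀ a b c → 2 * (a * b + b * c + c * a) + (a * a + b * b + (b * b + c * c + (c * c + a * a))) + 0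
    ≡ 2 * (a * a + b * b + c * c) + (2 * (a * b) + (2 * (b * c) + 2 * (c * a)))
  arith = solve-∀

argmax : ∀ {n} (P : Fin n → Bool) (f : Fin n → ℕ) →
  (∀ v → P v ≡ false) ⊎ ∃ λ v → P v ≡ true × ∀ u → P u ≡ true → f u ≤ f v
argmax {zero}  P f = inj₁ λ ()
argmax {suc n} P f with argmax (P ∘ suc) (f ∘ suc) | P zero in eq
... | inj₁ none | false = inj₁ λ { zero → eq ; (suc v) → none v }
... | inj₁ none | true  = inj₂ (zero , eq , λ { zero _ → ≤-refl ; (suc u) p → case trans (sym p) (none u) of λ () })
... | inj₂ (v , pv , max) | false = inj₂ (suc v , pv , λ { zero p → case trans (sym p) eq of λ () ; (suc u) p → max u p })
... | inj₂ (v , pv , max) | true with ≤-total (f zero) (f (suc v))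
...   | inj₁ le = inj₂ (suc v , pv , λ { zero _ → le ; (suc u) p → max u p })
...   | inj₂ le = inj₂ (zero , eq , λ { zero _ → ≤-refl ; (suc u) p → ≤-trans (max u p) le })

module CliqueFree {n} (G : Fin n → Fin n → Bool) (G-sym : ∀ u v → G u v ≡ G v u) where

  NoClique : ℕ → (Fin n → Bool) → Set
  NoClique zero    W = ⊥
  NoClique (suc r) W = ∀ v → W v ≡ true → NoClique r (λ u → W u ∧ G v u)

  size : (Fin n → Bool) → ℕ
  size W = ∑ λ u → ⟦ W u ⟧

  edgesIn : (Fin n → Bool) → ℕ
  edgesIn W = ∑∑ λ u v → ⟦ W u ∧ (W v ∧ G u v) ⟧

  -- Erdős' degree majorisation: an edge lies inside the neighbourhood of a vertex of maximum degree, or meets the rest.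
  turán : ∀ r W → NoClique (2 + r) W → suc r * edgesIn W ≤ r * (size W * size W)
  turán zero W none = ≤-reflexive (cong (_+ 0) (∑-zero λ u → ∑-zero λ v → zero-edge u v))
    where
    zero-edge : ∀ u v → ⟦ W u ∧ (W v ∧ G u v) ⟧ ≡ 0
    zero-edge u v with W u in eu | W v in ev | G u v in eg
    ... | false | _ | _ = refl
    ... | true | false | _ = refl
    ... | true | true | false = refl
    ... | true | true | true  = ⊥-elim (none u eu v (∧-intro ev eg))
  turán (suc r) W none with argmax W (λ v → size (λ u → W u ∧ G v u))
  ... | inj₁ empty = ≤-trans (≤-reflexive (trans (cong (suc (suc r) *_) (∑-zero λ u → ∑-zero λ v → cong (λ b → ⟦ b ∧ (W v ∧ G u v) ⟧) (empty u)))
                       (*-zeroʳ (suc (suc r))))) z≤n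
  ... | inj₂ (m , Wm , max) = *-cancelˡ-≤ (suc r) (begin
      suc r * (suc (suc r) * edgesIn W)
        ≤⟨ *-monoʳ-≤ (suc r) (*-monoʳ-≤ (suc (suc r)) split) ⟩
      suc r * (suc (suc r) * (E′ + 2 * (d * Δ)))
        ≤⟨ linear 0 (+-mono-≤ (*-monoʳ-≤ (suc (suc r)) (turán r W′ (none m Wm))) (2xy≤x²+y² Δ (suc r * d))) (arith r E′ d Δ) ⟩
      suc r * (suc r * ((Δ + d) * (Δ + d)))
        ≡⟨ cong (λ s → suc r * (suc r * (s * s))) (sym size-split) ⟩
      suc r * (suc r * (size W * size W)) ∎)
    where
    open ≤-Reasoning
    W′ : Fin n → Bool
    W′ u = W u ∧ G m u
    R : Fin n → Bool
    R u = W u ∧ not (G m u)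
    E′ Δ d : ℕ
    E′ = edgesIn W′
    Δ = size W′
    d = size R
    arith : ∀ r E d Δ →
      suc r * (suc (suc r) * (E + 2 * (d * Δ))) + (suc (suc r) * (r * (Δ * Δ)) + (Δ * Δ + suc r * d * (suc r * d))) + 0
      ≡ suc r * (suc r * ((Δ + d) * (Δ + d))) + (suc (suc r) * (suc r * E) + 2 * (Δ * (suc r * d)))
    arith = solve-∀
    size-split : size W ≡ Δ + d
    size-split = trans (∑-cong pointwise) (∑-+ _ _)
      where
      pointwise : ∀ u → ⟦ W u ⟧ ≡ ⟦ W′ u ⟧ + ⟦ R u ⟧
      pointwise u with W u | G m u
      ... | false | _     = refl
      ... | true  | true  = refl
      ... | true  | false = refl
    outside : ∑ (λ u → ⟦ R u ⟧ * size (λ v → W v ∧ G u v)) ≤ d * Δ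
    outside = ≤-trans (∑-mono le) (≤-reflexive (∑-*ʳ Δ (λ u → ⟦ R u ⟧)))
      where
      le : ∀ u → ⟦ R u ⟧ * size (λ v → W v ∧ G u v) ≤ ⟦ R u ⟧ * Δ
      le u with W u in eu | G m u
      ... | false | _     = z≤n
      ... | true  | true  = z≤n
      ... | true  | false = +-monoˡ-≤ 0 (max u eu)
    split : edgesIn W ≤ E′ + 2 * (d * Δ)
    split = begin
      edgesIn W
        ≤⟨ ∑∑-mono pointwise ⟩
      ∑∑ (λ u v → ⟦ W′ u ∧ (W′ v ∧ G u v) ⟧ + (⟦ R u ⟧ * ⟦ W v ∧ G u v ⟧ + ⟦ R v ⟧ * ⟦ W u ∧ G v u ⟧))
        ≡⟨ trans (∑∑-+ _ _) (cong (E′ +_) (∑∑-+ _ _)) ⟩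
      E′ + (∑∑ (λ u v → ⟦ R u ⟧ * ⟦ W v ∧ G u v ⟧) + ∑∑ (λ u v → ⟦ R v ⟧ * ⟦ W u ∧ G v u ⟧))
        ≡⟨ cong (E′ +_) (cong (∑∑ (λ u v → ⟦ R u ⟧ * ⟦ W v ∧ G u v ⟧) +_) (∑-swap _)) ⟩
      E′ + (∑∑ (λ u v → ⟦ R u ⟧ * ⟦ W v ∧ G u v ⟧) + ∑∑ (λ u v → ⟦ R u ⟧ * ⟦ W v ∧ G u v ⟧))
        ≡⟨ cong (λ s → E′ + (s + s)) (∑-cong λ u → ∑-*ˡ ⟦ R u ⟧ (λ v → ⟦ W v ∧ G u v ⟧)) ⟩
      E′ + (∑ (λ u → ⟦ R u ⟧ * size (λ v → W v ∧ G u v)) + ∑ (λ u → ⟦ R u ⟧ * size (λ v → W v ∧ G u v)))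
        ≤⟨ +-monoʳ-≤ E′ (+-mono-≤ outside outside) ⟩
      E′ + (d * Δ + d * Δ)
        ≡⟨ cong (λ s → E′ + (d * Δ + s)) (sym (+-identityʳ (d * Δ))) ⟩
      E′ + 2 * (d * Δ) ∎
      where
      pointwise : ∀ u v → ⟦ W u ∧ (W v ∧ G u v) ⟧ ≤
        ⟦ W′ u ∧ (W′ v ∧ G u v) ⟧ + (⟦ R u ⟧ * ⟦ W v ∧ G u v ⟧ + ⟦ R v ⟧ * ⟦ W u ∧ G v u ⟧)
      pointwise u v rewrite G-sym v u with W u | W v | G u v | G m u | G m v
      ... | false | _ | _ | _ | _ = z≤n
      ... | true | false | _ | _ | _ = z≤n
      ... | true | true | false | _ | _ = z≤n
      ... | true | true | true | true | true = s≤s z≤n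
      ... | true | true | true | false | _ = s≤s z≤n
      ... | true | true | true | true | false = s≤s z≤n

-- The shadow graph

module Shadow {n} (J : Graph3 n) (B : ℕ) .{{_ : NonZero n}} (200≤B : 200 ≤ B)
  (min-degree : ∀ v → 2 * B * (n * n) ≤ 9 * B * degree₂ J v + 2 * (n * n))
  (links-disjoint : ∀ {a b c} → edge J a b c ≡ true → B * linkIntersection J a b ≤ n * n) where

  S : Fin n → Fin n → Bool
  S u v = does (any? λ z → edge J u v z Boolₚ.≟ true)

  S-intro : ∀ {u v z} → edge J u v z ≡ true → S u v ≡ true
  S-intro {u} {v} {z} e = dec-true (any? λ z → edge J u v z Boolₚ.≟ true) (z , e)

  S-elim : ∀ {u v} → S u v ≡ true → ∃ λ z → edge J u v z ≡ true
  S-elim {u} {v} e with any? (λ z → edge J u v z Boolₚ.≟ true)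
  ... | yes p = p
  ... | no ¬p = case e of λ ()

  S-sym : ∀ u v → S u v ≡ S v u
  S-sym u v = bool-≡ (flipped u v) (flipped v u)
    where
    flipped : ∀ u v → S u v ≡ true → S v u ≡ true
    flipped u v s with S-elim {u} {v} s
    ... | z , e = S-intro (trans (swap₁₂ J v u z) e)

  open CliqueFree S S-sym public

  all : Fin n → Bool
  all _ = true

  private
    N² = n * n
    instance
      N²≢0 : NonZero N²
      N²≢0 = m*n≢0 n n

  covered : List (Fin n) → Fin n → Fin n → Bool
  covered []       p q = false
  covered (v ∷ vs) p q = edge J v p q ∨ covered vs p q

  multiplicity : List (Fin n) → Fin n → Fin n → ℕ
  multiplicity []       p q = 0
  multiplicity (v ∷ vs) p q = χ J v p q + multiplicity vs p q

  overlaps : List (Fin n) → Fin n → Fin n → ℕ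
  overlaps []       p q = 0
  overlaps (v ∷ vs) p q = χ J v p q * multiplicity vs p q + overlaps vs p q

  bonferroni : ∀ vs p q → multiplicity vs p q ≤ ⟦ covered vs p q ⟧ + overlaps vs p q
  bonferroni []       p q = z≤n
  bonferroni (v ∷ vs) p q with edge J v p q
  ... | true  = s≤s (≤-trans (m≤m+n _ 0) (m≤m+n _ _))
  ... | false = bonferroni vs p q

  pairs : ℕ → ℕ
  pairs zero    = 0
  pairs (suc k) = k + pairs k

  Adjacent : Fin n → Fin n → Set
  Adjacent u v = S u v ≡ true

  cross-overlap : ∀ v vs → All (Adjacent v) vs →
    B * ∑∑ (λ p q → χ J v p q * multiplicity vs p q) ≤ length vs * N²
  cross-overlap v []       [] = ≤-reflexive (trans (cong (B *_) (∑-zero λ p → ∑-zero λ q → *-zeroʳ (χ J v p q))) (*-zeroʳ B))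
  cross-overlap v (w ∷ vs) (s ∷ ss) = begin
    B * ∑∑ (λ p q → χ J v p q * (χ J w p q + multiplicity vs p q))
      ≡⟨ cong (B *_) (trans (∑∑-cong λ p q → *-distribˡ-+ (χ J v p q) _ _) (∑∑-+ _ _)) ⟩
    B * (linkIntersection J v w + ∑∑ (λ p q → χ J v p q * multiplicity vs p q))
      ≡⟨ *-distribˡ-+ B _ _ ⟩
    B * linkIntersection J v w + B * ∑∑ (λ p q → χ J v p q * multiplicity vs p q)
      ≤⟨ +-mono-≤ (links-disjoint (proj₂ (S-elim {v} {w} s))) (cross-overlap v vs ss) ⟩
    N² + length vs * N² ∎
    where open ≤-Reasoning

  clique-overlap : ∀ vs → AllPairs Adjacent vs → B * ∑∑ (overlaps vs) ≤ pairs (length vs) * N²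
  clique-overlap []       [] = ≤-reflexive (trans (cong (B *_) (∑-zero λ p → ∑-zero λ q → refl)) (*-zeroʳ B))
  clique-overlap (v ∷ vs) (ss ∷ sss) = begin
    B * ∑∑ (overlaps (v ∷ vs))
      ≡⟨ trans (cong (B *_) (∑∑-+ _ _)) (*-distribˡ-+ B _ _) ⟩
    B * ∑∑ (λ p q → χ J v p q * multiplicity vs p q) + B * ∑∑ (overlaps vs)
      ≤⟨ +-mono-≤ (cross-overlap v vs ss) (clique-overlap vs sss) ⟩
    length vs * N² + pairs (length vs) * N²
      ≡⟨ *-distribʳ-+ N² (length vs) (pairs (length vs)) ⟨
    (length vs + pairs (length vs)) * N² ∎
    where open ≤-Reasoning

  total-degree : ∀ vs → length vs * (2 * B * N²) ≤ 9 * B * ∑∑ (multiplicity vs) + length vs * (2 * N²)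
  total-degree []       = z≤n
  total-degree (v ∷ vs) = begin
    2 * B * N² + length vs * (2 * B * N²)
      ≤⟨ +-mono-≤ (min-degree v) (total-degree vs) ⟩
    (9 * B * degree₂ J v + 2 * N²) + (9 * B * ∑∑ (multiplicity vs) + length vs * (2 * N²))
      ≡⟨ arith (9 * B) (degree₂ J v) (∑∑ (multiplicity vs)) (2 * N²) (length vs * (2 * N²)) ⟩
    9 * B * (degree₂ J v + ∑∑ (multiplicity vs)) + (2 * N² + length vs * (2 * N²))
      ≡⟨ cong (λ s → 9 * B * s + _) (sym (∑∑-+ (χ J v) (multiplicity vs))) ⟩
    9 * B * ∑∑ (multiplicity (v ∷ vs)) + length (v ∷ vs) * (2 * N²) ∎
    where
    open ≤-Reasoning
    arith : ∀ b d m x y → (b * d + x) + (b * m + y) ≡ b * (d + m) + (x + y)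
    arith = solve-∀

  clique-cover : ∀ vs → AllPairs Adjacent vs →
    length vs * (2 * B * N²) ≤ 9 * B * ∑∑ (λ p q → ⟦ covered vs p q ⟧) + (9 * pairs (length vs) + 2 * length vs) * N²
  clique-cover vs ss = begin
    length vs * (2 * B * N²)
      ≤⟨ total-degree vs ⟩
    9 * B * ∑∑ (multiplicity vs) + length vs * (2 * N²)
      ≤⟨ +-monoˡ-≤ _ (*-monoʳ-≤ (9 * B) (≤-trans (∑∑-mono (bonferroni vs)) (≤-reflexive (∑∑-+ _ _)))) ⟩
    9 * B * (U + ∑∑ (overlaps vs)) + length vs * (2 * N²)
      ≤⟨ linear 0 (*-monoʳ-≤ 9 (clique-overlap vs ss)) (arith B U (∑∑ (overlaps vs)) (length vs) (pairs (length vs)) N²) ⟩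
    9 * B * U + (9 * pairs (length vs) + 2 * length vs) * N² ∎
    where
    open ≤-Reasoning
    U = ∑∑ (λ p q → ⟦ covered vs p q ⟧)
    arith : ∀ B U o k c m → (9 * B * (U + o) + k * (2 * m)) + 9 * (c * m) + 0 ≡ (9 * B * U + (9 * c + 2 * k) * m) + 9 * (B * o)
    arith = solve-∀

  size-all : size all ≡ n
  size-all = trans (∑-const n 1) (*-identityʳ n)

  no-K₅ : NoClique 5 all
  no-K₅ a _ b ab c abc d abcd e abcde with ∧-true {_} abc | ∧-true {_} abcd | ∧-true {_} abcde
  ... | ac , bc | abd , cd | abce , de with ∧-true {_} abd | ∧-true {_} abce
  ...   | ad , bd | abe , ce with ∧-true {_} abe
  ...     | ae , be = <⇒≱ (≤-trans (m≤m+n 101 99) 200≤B) (*-cancelʳ-≤ B 100 N² (begin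
    B * N²
      ≤⟨ linear 0 (+-mono-≤ (clique-cover (a ∷ b ∷ c ∷ d ∷ e ∷ [])
           ((ab ∷ ac ∷ ad ∷ ae ∷ []) ∷ (bc ∷ bd ∷ be ∷ []) ∷ (cd ∷ ce ∷ []) ∷ (de ∷ []) ∷ [] ∷ []))
           (*-monoʳ-≤ (9 * B) U≤)) (arith B _ N²) ⟩
    100 * N² ∎))
    where
    open ≤-Reasoning
    U≤ : ∑∑ (λ p q → ⟦ covered (a ∷ b ∷ c ∷ d ∷ e ∷ []) p q ⟧) ≤ N²
    U≤ = ∑-bound n λ p → ∑⟦⟧≤n _
    arith : ∀ B U m → B * m + (9 * B * U + 100 * m + 9 * B * m) + 0 ≡ 100 * m + (5 * (2 * B * m) + 9 * B * U)
    arith = solve-∀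

  covered⇒adjacent : ∀ vs {p q} → covered vs p q ≡ true → S p q ≡ true
  covered⇒adjacent (v ∷ vs) {p} {q} e with edge J v p q in eq
  ... | true  = S-intro (trans (sym (edge-rotate J v p q)) eq)
  ... | false = covered⇒adjacent vs e

  no-K₄ : NoClique 4 all
  no-K₄ a _ b ab c abc d abcd with ∧-true {_} abc | ∧-true {_} abcd
  ... | ac , bc | abd , cd with ∧-true {_} abd
  ...   | ad , bd = <⇒≱ (≤-trans (m≤m+n 51 149) 200≤B) (*-cancelʳ-≤ B 50 (5 * N²) {{m*n≢0 5 N²}} (begin
    B * (5 * N²)
      ≤⟨ linear (2 * N²) (+-mono-≤ (*-monoʳ-≤ 4 (clique-cover (a ∷ b ∷ c ∷ d ∷ []) ((ab ∷ ac ∷ ad ∷ []) ∷ (bc ∷ bd ∷ []) ∷ (cd ∷ []) ∷ [] ∷ [])))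
           (*-monoʳ-≤ (9 * B) 4U≤)) (arith B U N²) ⟩
    50 * (5 * N²) ∎))
    where
    open ≤-Reasoning
    U = ∑∑ (λ p q → ⟦ covered (a ∷ b ∷ c ∷ d ∷ []) p q ⟧)
    4U≤ : 4 * U ≤ 3 * N²
    4U≤ = begin
      4 * U                      ≤⟨ *-monoʳ-≤ 4 (∑∑-mono λ p q → ⟦⟧-mono (covered⇒adjacent (a ∷ b ∷ c ∷ d ∷ []))) ⟩
      4 * edgesIn all            ≤⟨ turán 3 all no-K₅ ⟩
      3 * (size all * size all)  ≡⟨ cong (λ s → 3 * (s * s)) size-all ⟩
      3 * N²                     ∎
    arith : ∀ B U m → B * (5 * m) + (4 * (9 * B * U + 62 * m) + 9 * B * (3 * m)) + 2 * m ≡ 50 * (5 * m) + (4 * (4 * (2 * B * m)) + 9 * B * (4 * U))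
    arith = solve-∀

  neighbours : Fin n → ℕ
  neighbours v = size (S v)

  link-turán : ∀ v → 2 * degree₂ J v ≤ neighbours v * neighbours v
  link-turán v = begin
    2 * degree₂ J v                  ≤⟨ *-monoʳ-≤ 2 (∑∑-mono le) ⟩
    2 * Link.edgesIn (S v)           ≤⟨ Link.turán 1 (S v) triangle-free ⟩
    1 * (neighbours v * neighbours v) ≡⟨ *-identityˡ _ ⟩
    neighbours v * neighbours v      ∎
    where
    open ≤-Reasoning
    module Link = CliqueFree (edge J v) (swap₂₃ J v)
    le : ∀ p q → χ J v p q ≤ ⟦ S v p ∧ (S v q ∧ edge J v p q) ⟧
    le p q with edge J v p q in e
    ... | false = z≤n
    ... | true rewrite S-intro {v} {p} e | S-intro {v} {q} (trans (swap₂₃ J v q p) e) = ≤-refl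
    triangle-free : Link.NoClique 3 (S v)
    triangle-free p vp q vpq r vpqr with ∧-true {_} vpq | ∧-true {_} vpqr
    ... | vq , pq | vpr , qr with ∧-true {_} vpr
    ...   | vr , pr = no-K₄ v refl p vp q (∧-intro vq (adj pq)) r (∧-intro (∧-intro vr (adj pr)) (adj qr))
      where
      adj : ∀ {x y} → edge J v x y ≡ true → S x y ≡ true
      adj {x} {y} e = S-intro (trans (sym (edge-rotate J v x y)) e)

  nonNeighbours : Fin n → ℕ
  nonNeighbours v = ∑ λ u → ⟦ not (S v u) ⟧

  neighbours+non : ∀ v → neighbours v + nonNeighbours v ≡ n
  neighbours+non v = trans (sym (∑-+ _ _)) (trans (∑-cong λ u → ⟦⟧-not (S v u)) size-all)

  neighbours-≥ : ∀ v → 2 * B * n ≤ 3 * B * neighbours v + 2 * n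
  neighbours-≥ v = bound B 200≤B (neighbours v) (begin
    4 * B * N²                               ≤⟨ linear 0 (*-monoʳ-≤ 2 (min-degree v)) (arith B (degree₂ J v) N²) ⟩
    9 * B * (2 * degree₂ J v) + 4 * N²       ≤⟨ +-monoˡ-≤ _ (*-monoʳ-≤ (9 * B) (link-turán v)) ⟩
    9 * B * (neighbours v * neighbours v) + 4 * N² ∎)
    where
    open ≤-Reasoning
    arith : ∀ B d m → 4 * B * m + 2 * (9 * B * d + 2 * m) + 0 ≡ 9 * B * (2 * d) + 4 * m + 2 * (2 * B * m)
    arith = solve-∀
    bound : ∀ B → 200 ≤ B → ∀ w → 4 * B * N² ≤ 9 * B * (w * w) + 4 * N² → 2 * B * n ≤ 3 * B * w + 2 * n
    bound (suc b) _ w h with 2 * b * n ≤? 3 * suc b * w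
    ... | yes p = linear 0 p (shift b n w)
      where
      shift : ∀ b n w → 2 * suc b * n + 3 * suc b * w + 0 ≡ 3 * suc b * w + 2 * n + 2 * b * n
      shift = solve-∀
    ... | no ¬p = ⊥-elim (<⇒≱ (*-mono-< (≰⇒> ¬p) (≰⇒> ¬p)) (begin
      2 * b * n * (2 * b * n)           ≤⟨ linear (4 * (b * (n * n))) (*-monoʳ-≤ (suc b) h) (square b n w) ⟩
      3 * suc b * w * (3 * suc b * w) ∎))
      where
      square : ∀ b n w → 2 * b * n * (2 * b * n) + suc b * (9 * suc b * (w * w) + 4 * (n * n)) + 4 * (b * (n * n))
                 ≡ 3 * suc b * w * (3 * suc b * w) + suc b * (4 * suc b * (n * n))
      square = solve-∀

  nonNeighbours-≤ : ∀ v → 3 * B * nonNeighbours v ≤ B * n + 2 * n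
  nonNeighbours-≤ v = bound n (neighbours+non v) (neighbours-≥ v)
    where
    arith : ∀ B w k → 3 * B * k + (3 * B * w + 2 * (w + k)) + 0 ≡ B * (w + k) + 2 * (w + k) + 2 * B * (w + k)
    arith = solve-∀
    bound : ∀ n → neighbours v + nonNeighbours v ≡ n → 2 * B * n ≤ 3 * B * neighbours v + 2 * n →
      3 * B * nonNeighbours v ≤ B * n + 2 * n
    bound _ refl h = linear 0 h (arith B (neighbours v) (nonNeighbours v))

-- Tripartition of the shadow

module Tripartition {n} (J : Graph3 n) (B : ℕ) .{{_ : NonZero n}} (200≤B : 200 ≤ B)
  (min-degree : ∀ v → 2 * B * (n * n) ≤ 9 * B * degree₂ J v + 2 * (n * n))
  (links-disjoint : ∀ {a b c} → edge J a b c ≡ true → B * linkIntersection J a b ≤ n * n) where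

  open Shadow J B 200≤B min-degree links-disjoint

  private
    VertexSet = Fin n → Bool
    0<n : 0 < n
    0<n = >-nonZero⁻¹ n

  Disjoint : VertexSet → VertexSet → Set
  Disjoint X Y = ∀ u → X u ≡ true → Y u ≡ true → ⊥

  Independent : VertexSet → Set
  Independent X = ∀ u v → X u ≡ true → X v ≡ true → S u v ≡ true → ⊥

  Avoids : VertexSet → Fin n → Set
  Avoids X v = ∀ u → X u ≡ true → S v u ≡ true → ⊥

  -- X has at least about n / 3 elements.
  Big : VertexSet → Set
  Big X = B * n ≤ 3 * B * size X + 4 * n

  Large : VertexSet → Fin n → Set
  Large X v = 4 * n < B * size (λ u → X u ∧ S v u)

  nonNeighboursOutside : VertexSet → Fin n → ℕ
  nonNeighboursOutside X v = ∑ λ u → ⟦ not (X u) ∧ not (S v u) ⟧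

  record Frame (X Y Z : VertexSet) : Set where
    field
      bigX : Big X
      bigY : Big Y
      bigZ : Big Z
      indX : Independent X
      indY : Independent Y
      indZ : Independent Z
      disjXY : Disjoint X Y
      disjYZ : Disjoint Y Z
      disjZX : Disjoint Z X

  rotate : ∀ {X Y Z} → Frame X Y Z → Frame Y Z X
  rotate f = record { bigX = bigY ; bigY = bigZ ; bigZ = bigX ; indX = indY ; indY = indZ ; indZ = indX
                    ; disjXY = disjYZ ; disjYZ = disjZX ; disjZX = disjXY }
    where open Frame f

  avoids-outside : ∀ {X v} → Big X → Avoids X v → B * nonNeighboursOutside X v ≤ 2 * n
  avoids-outside {X} {v} big avoids = *-cancelˡ-≤ 3
    (linear 0 (+-mono-≤ big (≤-trans (*-monoʳ-≤ (3 * B) count) (nonNeighbours-≤ v))) (arith B (size X) (nonNeighboursOutside X v) n))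
    where
    arith : ∀ B s o n → 3 * (B * o) + (3 * B * s + 4 * n + (B * n + 2 * n)) + 0 ≡ 3 * (2 * n) + (B * n + 3 * B * (s + o))
    arith = solve-∀
    pointwise : ∀ u → ⟦ X u ⟧ + ⟦ not (X u) ∧ not (S v u) ⟧ ≤ ⟦ not (S v u) ⟧
    pointwise u with X u in xu | S v u in su
    ... | true  | true  = ⊥-elim (avoids u xu su)
    ... | true  | false = ≤-refl
    ... | false | _     = ≤-refl
    count : size X + nonNeighboursOutside X v ≤ nonNeighbours v
    count = ≤-trans (≤-reflexive (sym (∑-+ _ _))) (∑-mono pointwise)

  private
    common : ∀ (P Q : VertexSet) → ∑ (λ u → ⟦ Q u ⟧) < size P → ∃ λ u → P u ≡ true × Q u ≡ false
    common P Q lt with pigeonhole (λ u → ⟦ P u ⟧) (λ u → ⟦ Q u ⟧) lt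
    ... | u , l with P u in pu | Q u in qu
    ...   | true | false = u , pu , qu
    common P Q lt | u , s≤s () | true | true

    adjacent : ∀ {x s} → not x ∧ not s ≡ false → (x ≡ true → ⊥) → s ≡ true
    adjacent {true}          _ ¬x = ⊥-elim (¬x refl)
    adjacent {false} {true}  _ ¬x = refl

  extend-to-K₄ : ∀ {X Y Z} → Frame X Y Z → ∀ v p → S v p ≡ true → Avoids X p → Large Y v → Large Z v → ⊥
  extend-to-K₄ {X} {Y} {Z} frame v p vp avoids largeY largeZ = step₁ (common (λ u → Y u ∧ S v u) (λ u → not (X u) ∧ not (S p u)) few₁)
    where
    open Frame frame
    few₁ : nonNeighboursOutside X p < size (λ u → Y u ∧ S v u)
    few₁ = *-cancelˡ-< B _ _ (≤-<-trans (avoids-outside bigX avoids) (≤-<-trans (*-monoˡ-≤ n (m≤m+n 2 2)) largeY))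
    ∨-≤ : ∀ a b → ⟦ a ∨ b ⟧ ≤ ⟦ a ⟧ + ⟦ b ⟧
    ∨-≤ true  b = s≤s z≤n
    ∨-≤ false b = ≤-refl
    ∨-false : ∀ {a b} → a ∨ b ≡ false → a ≡ false × b ≡ false
    ∨-false {false} e = refl , e
    arith : ∀ B x y n → B * (x + y) + (2 * n + 2 * n) + 0 ≡ 4 * n + (B * x + B * y)
    arith = solve-∀
    step₁ : (∃ λ q → Y q ∧ S v q ≡ true × not (X q) ∧ not (S p q) ≡ false) → ⊥
    step₁ (q , Yvq , pq) = step₂ (common (λ u → Z u ∧ S v u) missed few₂)
      where
      Yq : Y q ≡ true
      Yq = proj₁ (∧-true {Y q} Yvq)
      missed : VertexSet
      missed u = (not (X u) ∧ not (S p u)) ∨ (not (Y u) ∧ not (S q u))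
      missed-≤ : ∑ (λ u → ⟦ missed u ⟧) ≤ nonNeighboursOutside X p + nonNeighboursOutside Y q
      missed-≤ = ≤-trans (∑-mono λ u → ∨-≤ (not (X u) ∧ not (S p u)) (not (Y u) ∧ not (S q u))) (≤-reflexive (∑-+ _ _))
      few₂ : ∑ (λ u → ⟦ missed u ⟧) < size (λ u → Z u ∧ S v u)
      few₂ = *-cancelˡ-< B _ _ (≤-<-trans (*-monoʳ-≤ B missed-≤)
        (≤-<-trans (linear 0 (+-mono-≤ (avoids-outside bigX avoids) (avoids-outside bigY λ u → indY q u Yq))
          (arith B (nonNeighboursOutside X p) (nonNeighboursOutside Y q) n)) largeZ))
      step₂ : (∃ λ r → Z r ∧ S v r ≡ true × missed r ≡ false) → ⊥
      step₂ (r , Zvr , pqr) = no-K₄ v refl p vp q (∧-intro (proj₂ (∧-true {Y q} Yvq)) (adjacent pq λ Xq → disjXY q Xq Yq))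
        r (∧-intro (∧-intro (proj₂ (∧-true {Z r} Zvr)) (adjacent (proj₁ (∨-false pqr)) λ Xr → disjZX r Zr Xr))
                   (adjacent (proj₂ (∨-false {not (X r) ∧ not (S p r)} pqr)) λ Yr → disjYZ r Yr Zr))
        where
        Zr : Z r ≡ true
        Zr = proj₁ (∧-true {Z r} Zvr)

  not-both-small : ∀ {X Y Z} → Frame X Y Z → ∀ v p → X p ≡ true → ¬ Large Y v → ¬ Large Z v → ⊥
  not-both-small {X} {Y} {Z} frame v p Xp smallY smallZ = <⇒≱ (≤-trans (m≤m+n 41 159) 200≤B)
    (*-cancelʳ-≤ B 40 n (linear 0 (+-mono-≤ (+-mono-≤ (+-mono-≤ bigX bigY) bigZ)
      (+-mono-≤ (+-mono-≤ (*-monoʳ-≤ 3 (≮⇒≥ smallY)) (*-monoʳ-≤ 3 (≮⇒≥ smallZ)))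
      (+-mono-≤ (*-monoʳ-≤ (3 * B) count) (+-mono-≤ (≤-trans (*-monoʳ-≤ (3 * B) X-small) (nonNeighbours-≤ p)) (nonNeighbours-≤ v)))))
      (arith B (size X) (size Y) (size Z) (size λ u → Y u ∧ S v u) (size λ u → Z u ∧ S v u) (nonNeighbours v) n)))
    where
    open Frame frame
    arith : ∀ B x y z y′ z′ o n →
      B * n + ((3 * B * x + 4 * n + (3 * B * y + 4 * n) + (3 * B * z + 4 * n))
        + (3 * (4 * n) + 3 * (4 * n) + (3 * B * (x + y′ + z′ + o) + (B * n + 2 * n + (B * n + 2 * n))))) + 0
      ≡ 40 * n + ((B * n + B * n + B * n) + (3 * (B * y′) + 3 * (B * z′) + (3 * B * (x + y + z) + (3 * B * x + 3 * B * o))))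
    arith = solve-∀
    X-small : size X ≤ nonNeighbours p
    X-small = ∑-mono pointwise
      where
      pointwise : ∀ u → ⟦ X u ⟧ ≤ ⟦ not (S p u) ⟧
      pointwise u with X u in xu | S p u in su
      ... | true  | true  = ⊥-elim (indX p u Xp xu su)
      ... | true  | false = ≤-refl
      ... | false | _     = z≤n
    count : size X + size Y + size Z ≤ size X + size (λ u → Y u ∧ S v u) + size (λ u → Z u ∧ S v u) + nonNeighbours v
    count = ≤-trans (≤-reflexive (sym (trans (∑-+ _ _) (cong (_+ size Z) (∑-+ _ _)))))
      (≤-trans (∑-mono pointwise) (≤-reflexive (trans (∑-+ _ _) (cong (_+ nonNeighbours v) (trans (∑-+ _ _) (cong (_+ size (λ u → Z u ∧ S v u)) (∑-+ _ _)))))))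
      where
      pointwise : ∀ u → ⟦ X u ⟧ + ⟦ Y u ⟧ + ⟦ Z u ⟧ ≤ ⟦ X u ⟧ + ⟦ Y u ∧ S v u ⟧ + ⟦ Z u ∧ S v u ⟧ + ⟦ not (S v u) ⟧
      pointwise u with X u in xu | Y u in yu | Z u in zu | S v u
      ... | true  | true  | _     | _     = ⊥-elim (disjXY u xu yu)
      ... | _     | true  | true  | _     = ⊥-elim (disjYZ u yu zu)
      ... | true  | _     | true  | _     = ⊥-elim (disjZX u zu xu)
      ... | true  | false | false | s     = s≤s z≤n
      ... | false | true  | false | true  = ≤-refl
      ... | false | true  | false | false = ≤-refl
      ... | false | false | true  | true  = ≤-refl
      ... | false | false | true  | false = ≤-refl
      ... | false | false | false | s     = z≤n

  private
    large? : ∀ X v → Dec (Large X v)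
    large? X v = 4 * n <? B * size (λ u → X u ∧ S v u)

  ¬touches-all : ∀ {X Y Z} → Frame X Y Z → ∀ v →
    (∃ λ p → X p ≡ true × S v p ≡ true) → (∃ λ p → Y p ≡ true × S v p ≡ true) → (∃ λ p → Z p ≡ true × S v p ≡ true) → ⊥
  ¬touches-all {X} {Y} {Z} f v (p , Xp , vp) (q , Yq , vq) (r , Zr , vr) with large? X v | large? Y v | large? Z v
  ... | _      | yes lY | yes lZ = extend-to-K₄ f v p vp (λ u → Frame.indX f p u Xp) lY lZ
  ... | yes lX | _      | yes lZ = extend-to-K₄ (rotate f) v q vq (λ u → Frame.indY f q u Yq) lZ lX
  ... | yes lX | yes lY | _      = extend-to-K₄ (rotate (rotate f)) v r vr (λ u → Frame.indZ f r u Zr) lX lY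
  ... | _      | no sY  | no sZ  = not-both-small f v p Xp sY sZ
  ... | no sX  | _      | no sZ  = not-both-small (rotate f) v q Yq sZ sX
  ... | no sX  | no sY  | _      = not-both-small (rotate (rotate f)) v r Zr sX sY

  avoiders-independent : ∀ {X Y Z} → Frame X Y Z → ∀ u v → Avoids X u → Avoids X v → S u v ≡ true → ⊥
  avoiders-independent {X} {Y} {Z} f u v au av uv = extend-to-K₄ f u v uv av (large bigY disjXY) (large bigZ λ w x z → disjZX w z x)
    where
    open Frame f
    large : ∀ {Y} → Big Y → Disjoint X Y → Large Y u
    large {Y} big disj with large? Y u
    ... | yes p = p
    ... | no ¬p = ⊥-elim (<⇒≱ (≤-trans (m≤m+n 23 177) 200≤B) (*-cancelʳ-≤ B 22 n
        (linear 0 (+-mono-≤ big (+-mono-≤ (*-monoʳ-≤ (3 * B) count) (+-mono-≤ (*-monoʳ-≤ 3 (≮⇒≥ ¬p)) (*-monoʳ-≤ 3 (avoids-outside bigX au)))))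
        (arith B (size Y) (size λ w → Y w ∧ S u w) (nonNeighboursOutside X u) n))))
      where
      arith : ∀ B y y′ o n → B * n + (3 * B * y + 4 * n + (3 * B * (y′ + o) + (3 * (4 * n) + 3 * (2 * n)))) + 0
        ≡ 22 * n + (B * n + (3 * B * y + (3 * (B * y′) + 3 * (B * o))))
      arith = solve-∀
      count : size Y ≤ size (λ w → Y w ∧ S u w) + nonNeighboursOutside X u
      count = ≤-trans (∑-mono pointwise) (≤-reflexive (∑-+ _ _))
        where
        pointwise : ∀ w → ⟦ Y w ⟧ ≤ ⟦ Y w ∧ S u w ⟧ + ⟦ not (X w) ∧ not (S u w) ⟧
        pointwise w with Y w in yw | X w in xw | S u w
        ... | false | _     | _     = z≤n
        ... | true  | true  | _     = ⊥-elim (disj w xw yw)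
        ... | true  | false | true  = ≤-refl
        ... | true  | false | false = ≤-refl

  commonNeighbourhood : Fin n → Fin n → VertexSet
  commonNeighbourhood a b u = S a u ∧ S b u

  commonNeighbourhood-big : ∀ a b → Big (commonNeighbourhood a b)
  commonNeighbourhood-big a b = linear 0 (+-mono-≤ (*-monoʳ-≤ (3 * B) count) (+-mono-≤ (nonNeighbours-≤ a) (nonNeighbours-≤ b)))
    (arith B (size (commonNeighbourhood a b)) (nonNeighbours a) (nonNeighbours b) n)
    where
    arith : ∀ B s x y n → B * n + (3 * B * (s + x + y) + (B * n + 2 * n + (B * n + 2 * n))) + 0
      ≡ 3 * B * s + 4 * n + (3 * B * n + (3 * B * x + 3 * B * y))
    arith = solve-∀
    pointwise : ∀ u → 1 ≤ ⟦ S a u ∧ S b u ⟧ + ⟦ not (S a u) ⟧ + ⟦ not (S b u) ⟧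
    pointwise u with S a u | S b u
    ... | true  | true  = ≤-refl
    ... | true  | false = ≤-refl
    ... | false | _     = s≤s z≤n
    count : n ≤ size (commonNeighbourhood a b) + nonNeighbours a + nonNeighbours b
    count = ≤-trans (≤-reflexive (sym size-all)) (≤-trans (∑-mono pointwise)
      (≤-reflexive (trans (∑-+ _ _) (cong (_+ nonNeighbours b) (∑-+ _ _)))))

  commonNeighbourhood-independent : ∀ a b → S a b ≡ true → Independent (commonNeighbourhood a b)
  commonNeighbourhood-independent a b ab u v au av uv = no-K₄ a refl b ab u au v (∧-intro av uv)

  module _ {a b c} (abc : edge J a b c ≡ true) where

    private
      ab : S a b ≡ true
      ab = S-intro abc
      bc : S b c ≡ true
      bc = S-intro (trans (sym (edge-rotate J a b c)) abc)
      ca : S c a ≡ true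
      ca = S-intro (trans (edge-rotate J c a b) abc)
      X Y Z : VertexSet
      X = commonNeighbourhood b c
      Y = commonNeighbourhood c a
      Z = commonNeighbourhood a b
      no-common : ∀ u → S a u ≡ true → S b u ≡ true → S c u ≡ true → ⊥
      no-common u au bu cu = no-K₄ a refl b ab c (∧-intro (trans (S-sym a c) ca) bc) u (∧-intro (∧-intro au bu) cu)

    frame : Frame X Y Z
    frame = record
      { bigX = commonNeighbourhood-big b c
      ; bigY = commonNeighbourhood-big c a
      ; bigZ = commonNeighbourhood-big a b
      ; indX = commonNeighbourhood-independent b c bc
      ; indY = commonNeighbourhood-independent c a ca
      ; indZ = commonNeighbourhood-independent a b ab
      ; disjXY = λ u x y → no-common u (proj₂ (∧-true {S c u} y)) (proj₁ (∧-true {S b u} x)) (proj₁ (∧-true {S c u} y))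
      ; disjYZ = λ u y z → no-common u (proj₁ (∧-true {S a u} z)) (proj₂ (∧-true {S a u} z)) (proj₁ (∧-true {S c u} y))
      ; disjZX = λ u z x → no-common u (proj₁ (∧-true {S a u} z)) (proj₁ (∧-true {S b u} x)) (proj₂ (∧-true {S b u} x))
      }

    private
      touches? : ∀ X v → (∃ λ p → X p ≡ true × S v p ≡ true) ⊎ Avoids X v
      touches? X v with any? (λ p → X p ∧ S v p Boolₚ.≟ true)
      ... | yes (p , e) = inj₁ (p , ∧-true e)
      ... | no ¬e       = inj₂ λ u Xu vu → ¬e (u , ∧-intro Xu vu)

    class : Fin 3 → VertexSet
    class 0F             = X
    class 1F       = Y
    class 2F = Z

    part : ∀ v → Σ (Fin 3) λ i → Avoids (class i) v
    part v with touches? X v | touches? Y v | touches? Z v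
    ... | inj₂ av | _       | _       = 0F , av
    ... | inj₁ _  | inj₂ av | _       = 1F , av
    ... | inj₁ _  | inj₁ _  | inj₂ av = 2F , av
    ... | inj₁ p  | inj₁ q  | inj₁ r  = ⊥-elim (¬touches-all frame v p q r)

    class-independent : ∀ i u v → Avoids (class i) u → Avoids (class i) v → S u v ≡ true → ⊥
    class-independent 0F             = avoiders-independent frame
    class-independent 1F       = avoiders-independent (rotate frame)
    class-independent 2F = avoiders-independent (rotate (rotate frame))

    part-proper : ∀ {u v w} → edge J u v w ≡ true → proj₁ (part u) ≢ proj₁ (part v)
    part-proper {u} {v} e eq with part u | part v
    part-proper {u} {v} e refl | i , au | .i , av = class-independent i u v au av (S-intro e)

  some-edge : ∃ λ a → ∃ λ b → ∃ λ c → edge J a b c ≡ true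
  some-edge = find 0<n
    where
    find : 0 < n → ∃ λ a → ∃ λ b → ∃ λ c → edge J a b c ≡ true
    find (s≤s {n = m} _) with pigeonhole₂ (χ J zero) (λ _ _ → 0) (≤-<-trans (≤-reflexive (∑-zero λ i → ∑-zero λ j → refl)) positive)
      where
      positive : 0 < degree₂ J zero
      positive with degree₂ J zero | min-degree zero
      ... | suc _ | _ = s≤s z≤n
      ... | zero  | h = ⊥-elim (<⇒≱ (≤-trans (m≤m+n 2 198) 200≤B) (*-cancelʳ-≤ B 1 (2 * (suc m * suc m)) {{m*n≢0 2 (suc m * suc m)}} (linear 0 h (arith B (suc m * suc m)))))
        where
        arith : ∀ B k → B * (2 * k) + (9 * B * 0 + 2 * k) + 0 ≡ 1 * (2 * k) + 2 * B * k
        arith = solve-∀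
    ... | b , c , lt with edge J zero b c in e
    ...   | true = zero , b , c , e

  partition : Σ (Fin n → Fin 3) λ π → ∀ {u v w} → edge J u v w ≡ true → π u ≢ π v
  partition with some-edge
  ... | a , b , c , abc = (λ v → proj₁ (part abc v)) , part-proper abc

-- Colour classes

rainbow : Fin 3 → Fin 3 → Fin 3 → Bool
rainbow x y z = not (x == y) ∧ (not (y == z) ∧ not (x == z))

next prev : Fin 3 → Fin 3
next 0F             = 1F
next 1F       = 2F
next 2F = 0F
prev 0F             = 2F
prev 1F       = 0F
prev 2F = 1F

∑-Fin3 : (f : Fin 3 → ℕ) → ∑ f ≡ f 0F + (f 1F + f 2F)
∑-Fin3 f = trans (∑-suc f) (cong (f 0F +_) (trans (∑-suc λ i → f (suc i)) (cong (f 1F +_)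
  (trans (∑-suc λ i → f (suc (suc i))) (trans (cong (f 2F +_) (∑-[] λ i → f (suc (suc (suc i))))) (+-identityʳ _))))))

rainbow-split : ∀ x y z → ⟦ rainbow x y z ⟧ ≡ ⟦ next x == y ⟧ * ⟦ prev x == z ⟧ + ⟦ prev x == y ⟧ * ⟦ next x == z ⟧
rainbow-split = from-yes (all? λ (x : Fin 3) → all? λ (y : Fin 3) → all? λ (z : Fin 3) →
  ⟦ rainbow x y z ⟧ ℕₚ.≟ ⟦ next x == y ⟧ * ⟦ prev x == z ⟧ + ⟦ prev x == y ⟧ * ⟦ next x == z ⟧)

rainbow-swap : ∀ x y z → rainbow x y z ≡ rainbow y x z
rainbow-swap = from-yes (all? λ (x : Fin 3) → all? λ (y : Fin 3) → all? λ (z : Fin 3) → rainbow x y z Boolₚ.≟ rainbow y x z)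

rainbow-onto : ∀ x y z i → rainbow x y z ∧ (not (x == i) ∧ (not (y == i) ∧ not (z == i))) ≡ false
rainbow-onto = from-yes (all? λ (x : Fin 3) → all? λ (y : Fin 3) → all? λ (z : Fin 3) → all? λ i →
  rainbow x y z ∧ (not (x == i) ∧ (not (y == i) ∧ not (z == i))) Boolₚ.≟ false)

pattern-split : ∀ (x y z : Fin 3) → 1 ≡ ⟦ (x == y) ∧ (y == z) ⟧ + (⟦ rainbow x y z ⟧
  + (⟦ (x == y) ∧ not (y == z) ⟧ + (⟦ (y == z) ∧ not (z == x) ⟧ + ⟦ (z == x) ∧ not (x == y) ⟧)))
pattern-split = from-yes (all? λ (x : Fin 3) → all? λ (y : Fin 3) → all? λ (z : Fin 3) → 1 ℕₚ.≟ ⟦ (x == y) ∧ (y == z) ⟧ + (⟦ rainbow x y z ⟧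
  + (⟦ (x == y) ∧ not (y == z) ⟧ + (⟦ (y == z) ∧ not (z == x) ⟧ + ⟦ (z == x) ∧ not (x == y) ⟧))))

mixed-split : ∀ (x y z : Fin 3) → ⟦ not (x == y) ⟧ * ⟦ (z == x) ∨ (z == y) ⟧ ≡ ⟦ (y == z) ∧ not (z == x) ⟧ + ⟦ (z == x) ∧ not (x == y) ⟧
mixed-split = from-yes (all? λ (x : Fin 3) → all? λ (y : Fin 3) → all? λ (z : Fin 3) →
  ⟦ not (x == y) ⟧ * ⟦ (z == x) ∨ (z == y) ⟧ ℕₚ.≟ ⟦ (y == z) ∧ not (z == x) ⟧ + ⟦ (z == x) ∧ not (x == y) ⟧)

mono-split : ∀ (x y z : Fin 3) → ⟦ (x == y) ∧ (y == z) ⟧ ≡ ∑ λ i → ⟦ i == x ⟧ * (⟦ i == y ⟧ * ⟦ i == z ⟧)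
mono-split x y z = trans (pointwise x y z) (sym (∑-Fin3 λ i → ⟦ i == x ⟧ * (⟦ i == y ⟧ * ⟦ i == z ⟧)))
  where
  term : Fin 3 → Fin 3 → Fin 3 → Fin 3 → ℕ
  term x y z i = ⟦ i == x ⟧ * (⟦ i == y ⟧ * ⟦ i == z ⟧)
  pointwise : ∀ (x y z : Fin 3) → ⟦ (x == y) ∧ (y == z) ⟧ ≡ term x y z 0F + (term x y z 1F + term x y z 2F)
  pointwise = from-yes (all? λ (x : Fin 3) → all? λ (y : Fin 3) → all? λ (z : Fin 3) →
    ⟦ (x == y) ∧ (y == z) ⟧ ℕₚ.≟ term x y z 0F + (term x y z 1F + term x y z 2F))

module Coloured {n} (π : Fin n → Fin 3) where

  partSize : Fin 3 → ℕ
  partSize i = ∑ λ v → ⟦ i == π v ⟧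

  ∑-by-colour : ∀ (g : Fin 3 → ℕ) → ∑ (λ v → g (π v)) ≡ ∑ (λ i → partSize i * g i)
  ∑-by-colour g = begin
    ∑ (λ v → g (π v))                            ≡⟨ ∑-cong (λ v → sym (trans (∑-cong λ i → cong (λ b → ⟦ b ⟧ * g i) (==-sym i (π v))) (∑-point (π v) g))) ⟩
    ∑ (λ v → ∑ λ i → ⟦ i == π v ⟧ * g i)         ≡⟨ ∑-swap _ ⟩
    ∑ (λ i → ∑ λ v → ⟦ i == π v ⟧ * g i)         ≡⟨ ∑-cong (λ i → ∑-*ʳ (g i) _) ⟩
    ∑ (λ i → partSize i * g i)                   ∎
    where open ≡-Reasoning

  partSize-sum : partSize 0F + (partSize 1F + partSize 2F) ≡ n
  partSize-sum = trans (sym (trans (∑-cong λ i → *-identityʳ (partSize i)) (∑-Fin3 partSize)))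
    (trans (sym (∑-by-colour λ _ → 1)) (trans (∑-const n 1) (*-identityʳ n)))

  rainbowPairs : Fin 3 → ℕ
  rainbowPairs x = ∑∑ λ p q → ⟦ rainbow x (π p) (π q) ⟧

  ∑∑-product : ∀ i j → ∑∑ (λ p q → ⟦ i == π p ⟧ * ⟦ j == π q ⟧) ≡ partSize i * partSize j
  ∑∑-product i j = trans (∑-cong λ p → ∑-*ˡ ⟦ i == π p ⟧ _) (∑-*ʳ (partSize j) _)

  rainbowPairs-≡ : ∀ x → rainbowPairs x ≡ 2 * (partSize (next x) * partSize (prev x))
  rainbowPairs-≡ x = begin
    rainbowPairs x
      ≡⟨ ∑∑-cong (λ p q → rainbow-split x (π p) (π q)) ⟩
    ∑∑ (λ p q → ⟦ next x == π p ⟧ * ⟦ prev x == π q ⟧ + ⟦ prev x == π p ⟧ * ⟦ next x == π q ⟧)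
      ≡⟨ ∑∑-+ _ _ ⟩
    ∑∑ (λ p q → ⟦ next x == π p ⟧ * ⟦ prev x == π q ⟧) + ∑∑ (λ p q → ⟦ prev x == π p ⟧ * ⟦ next x == π q ⟧)
      ≡⟨ cong₂ _+_ (∑∑-product (next x) (prev x)) (∑∑-product (prev x) (next x)) ⟩
    partSize (next x) * partSize (prev x) + partSize (prev x) * partSize (next x)
      ≡⟨ double (partSize (next x)) (partSize (prev x)) ⟩
    2 * (partSize (next x) * partSize (prev x)) ∎
    where
    open ≡-Reasoning
    double : ∀ a b → a * b + b * a ≡ 2 * (a * b)
    double = solve-∀

  rainbowTriples : ∑³ (λ a b c → ⟦ rainbow (π a) (π b) (π c) ⟧) ≡ 6 * (partSize 0F * partSize 1F * partSize 2F)
  rainbowTriples = begin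
    ∑ (λ a → rainbowPairs (π a))
      ≡⟨ ∑-by-colour rainbowPairs ⟩
    ∑ (λ i → partSize i * rainbowPairs i)
      ≡⟨ ∑-cong (λ i → cong (partSize i *_) (rainbowPairs-≡ i)) ⟩
    ∑ (λ i → partSize i * (2 * (partSize (next i) * partSize (prev i))))
      ≡⟨ ∑-Fin3 (λ i → partSize i * (2 * (partSize (next i) * partSize (prev i)))) ⟩
    _ ≡⟨ arith (partSize 0F) (partSize 1F) (partSize 2F) ⟩
    6 * (partSize 0F * partSize 1F * partSize 2F) ∎
    where
    open ≡-Reasoning
    arith : ∀ a b c → a * (2 * (b * c)) + (b * (2 * (c * a)) + c * (2 * (a * b))) ≡ 6 * (a * b * c)
    arith = solve-∀

  induced : Graph3 n → ∀ i → Graph3 (Enumeration.size (enumeration (λ v → i == π v)))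
  induced H i = record
    { edge   = λ a b c → edge H (ι a) (ι b) (ι c)
    ; swap₁₂ = λ a b c → swap₁₂ H (ι a) (ι b) (ι c)
    ; swap₂₃ = λ a b c → swap₂₃ H (ι a) (ι b) (ι c)
    ; noLoop = λ a c → noLoop H (ι a) (ι c)
    }
    where open Enumeration (enumeration (λ v → i == π v))

  induced-edges : ∀ H i → edges₆ (induced H i) ≡ ∑³ λ a b c → (⟦ i == π a ⟧ * (⟦ i == π b ⟧ * ⟦ i == π c ⟧)) * χ H a b c
  induced-edges H i = begin
    ∑ (λ a → ∑ λ b → ∑ λ c → χ H (ι a) (ι b) (ι c))
      ≡⟨ ∑∑-cong (λ a b → sym (ι-sum (χ H (ι a) (ι b)))) ⟩
    ∑ (λ a → ∑ λ b → ∑ λ c → ⟦ i == π c ⟧ * χ H (ι a) (ι b) c)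
      ≡⟨ ∑-cong (λ a → sym (ι-sum λ b → ∑ λ c → ⟦ i == π c ⟧ * χ H (ι a) b c)) ⟩
    ∑ (λ a → ∑ λ b → ⟦ i == π b ⟧ * ∑ λ c → ⟦ i == π c ⟧ * χ H (ι a) b c)
      ≡⟨ sym (ι-sum λ a → ∑ λ b → ⟦ i == π b ⟧ * ∑ λ c → ⟦ i == π c ⟧ * χ H a b c) ⟩
    ∑ (λ a → ⟦ i == π a ⟧ * ∑ λ b → ⟦ i == π b ⟧ * ∑ λ c → ⟦ i == π c ⟧ * χ H a b c)
      ≡⟨ ∑-cong (λ a → trans (sym (∑-*ˡ ⟦ i == π a ⟧ _)) (∑-cong λ b → trans (cong (⟦ i == π a ⟧ *_) (sym (∑-*ˡ ⟦ i == π b ⟧ _)))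
           (trans (sym (∑-*ˡ ⟦ i == π a ⟧ _)) (∑-cong λ c → assoc ⟦ i == π a ⟧ ⟦ i == π b ⟧ ⟦ i == π c ⟧ (χ H a b c))))) ⟩
    ∑³ (λ a b c → (⟦ i == π a ⟧ * (⟦ i == π b ⟧ * ⟦ i == π c ⟧)) * χ H a b c) ∎
    where
    open Enumeration (enumeration (λ v → i == π v))
    open ≡-Reasoning
    assoc : ∀ x y z w → x * (y * (z * w)) ≡ (x * (y * z)) * w
    assoc = solve-∀

  induced-total : ∀ H → ∑³ (λ a b c → ⟦ (π a == π b) ∧ (π b == π c) ⟧ * χ H a b c) ≡ ∑ (λ i → edges₆ (induced H i))
  induced-total H = begin
    ∑³ (λ a b c → ⟦ (π a == π b) ∧ (π b == π c) ⟧ * χ H a b c)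
      ≡⟨ ∑³-cong (λ a b c → trans (cong (_* χ H a b c) (mono-split (π a) (π b) (π c))) (sym (∑-*ʳ (χ H a b c) _))) ⟩
    ∑³ (λ a b c → ∑ λ i → t i a b c)
      ≡⟨ ∑∑-cong (λ a b → ∑-swap λ c i → t i a b c) ⟩
    ∑∑ (λ a b → ∑ λ i → ∑ λ c → t i a b c)
      ≡⟨ ∑-cong (λ a → ∑-swap λ b i → ∑ λ c → t i a b c) ⟩
    ∑ (λ a → ∑ λ i → ∑∑ λ b c → t i a b c)
      ≡⟨ ∑-swap (λ a i → ∑∑ λ b c → t i a b c) ⟩
    ∑ (λ i → ∑³ (t i))
      ≡⟨ ∑-cong (λ i → sym (induced-edges H i)) ⟩
    ∑ (λ i → edges₆ (induced H i)) ∎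
    where
    open ≡-Reasoning
    t : Fin 3 → Fin n → Fin n → Fin n → ℕ
    t i a b c = (⟦ i == π a ⟧ * (⟦ i == π b ⟧ * ⟦ i == π c ⟧)) * χ H a b c

-- Edges across the parts

third : Fin 3 → Fin 3 → Fin 3
third x y = if next x == y then prev x else next x

rainbow-third : ∀ x y z → x ≡ y ⊎ rainbow x y z ≡ (third x y == z)
rainbow-third = from-yes (all? λ (x : Fin 3) → all? λ (y : Fin 3) → all? λ (z : Fin 3) →
  (x ≟ y) ⊎-dec (rainbow x y z Boolₚ.≟ (third x y == z)))

module Stable {n} (H J : Graph3 n) (l B : ℕ) .{{_ : NonZero n}} (free : Free (suc l) H)
  (J⊆H : ∀ {a b c} → edge J a b c ≡ true → edge H a b c ≡ true)
  (π : Fin n → Fin 3) (proper : ∀ {u v w} → edge J u v w ≡ true → π u ≢ π v)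
  (nonempty : ∃ λ a → ∃ λ b → ∃ λ c → edge J a b c ≡ true)
  (B-large : 200 + 3 * l ≤ B) (n-large : 100 * B ≤ n)
  (min-degree : ∀ v → 2 * B * (n * n) ≤ 9 * B * degree₂ J v + 2 * (n * n)) where

  open Coloured π public

  private
    N² = n * n
    instance
      N²≢0 : NonZero N²
      N²≢0 = m*n≢0 n n
    200≤B : 200 ≤ B
    200≤B = ≤-trans (m≤m+n 200 _) B-large
    instance
      B≢0 : NonZero B
      B≢0 = >-nonZero (≤-trans (s≤s z≤n) 200≤B)

    Γ : Fin n → Fin n → Fin n → Bool
    Γ u v w = rainbow (π u) (π v) (π w)

  J-rainbow : ∀ {u v w} → edge J u v w ≡ true → Γ u v w ≡ true
  J-rainbow {u} {v} {w} e
    rewrite ≢⇒== (proper e) | ≢⇒== (proper (trans (sym (edge-rotate J u v w)) e)) | ≢⇒== (proper (trans (sym (swap₂₃ J u v w)) e)) = refl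

  missing : Fin n → ℕ
  missing v = ∑∑ λ p q → ⟦ Γ v p q ∧ not (edge H v p q) ⟧

  degree+missing : ∀ v → degree₂ J v + missing v ≤ rainbowPairs (π v)
  degree+missing v = ≤-trans (≤-reflexive (sym (∑∑-+ _ _))) (∑∑-mono pointwise)
    where
    pointwise : ∀ p q → χ J v p q + ⟦ Γ v p q ∧ not (edge H v p q) ⟧ ≤ ⟦ Γ v p q ⟧
    pointwise p q with edge J v p q in e
    ... | true rewrite J-rainbow e | J⊆H e = ≤-refl
    ... | false with Γ v p q
    ...   | false = z≤n
    ...   | true  = ⟦⟧≤1 _

  colour-used : ∀ i → ∃ λ v → π v ≡ i
  colour-used i = find nonempty
    where
    find : (∃ λ a → ∃ λ b → ∃ λ c → edge J a b c ≡ true) → ∃ λ v → π v ≡ i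
    find (a , b , c , e) with π a ≟ i | π b ≟ i | π c ≟ i
    ... | yes p | _     | _     = a , p
    ... | _     | yes p | _     = b , p
    ... | _     | _     | yes p = c , p
    ... | no p  | no q  | no r  = case trans (sym contra) (rainbow-onto (π a) (π b) (π c) i) of λ ()
      where
      contra : Γ a b c ∧ (not (π a == i) ∧ (not (π b == i) ∧ not (π c == i))) ≡ true
      contra rewrite J-rainbow e | ≢⇒== p | ≢⇒== q | ≢⇒== r = refl

  rainbowPairs-≥ : ∀ i → 2 * B * N² ≤ 9 * B * rainbowPairs i + 2 * N²
  rainbowPairs-≥ i with colour-used i
  ... | v , refl = ≤-trans (min-degree v) (+-monoˡ-≤ (2 * N²) (*-monoʳ-≤ (9 * B) (≤-trans (m≤m+n _ (missing v)) (degree+missing v))))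

  rainbowPairs-total : 3 * (rainbowPairs 0F + (rainbowPairs 1F + rainbowPairs 2F)) ≤ 2 * N²
  rainbowPairs-total rewrite rainbowPairs-≡ 0F | rainbowPairs-≡ 1F | rainbowPairs-≡ 2F =
    bound (partSize 0F) (partSize 1F) (partSize 2F) n partSize-sum
    where
    arith : ∀ a b c → 3 * (2 * (b * c) + (2 * (c * a) + 2 * (a * b))) + ((a * a + b * b) + ((b * b + c * c) + (a * a + c * c))) + 0
      ≡ 2 * ((a + (b + c)) * (a + (b + c))) + (2 * (a * b) + (2 * (b * c) + 2 * (a * c)))
    arith = solve-∀
    bound : ∀ a b c n → a + (b + c) ≡ n → 3 * (2 * (b * c) + (2 * (c * a) + 2 * (a * b))) ≤ 2 * (n * n)
    bound a b c _ refl = linear 0 (+-mono-≤ (2xy≤x²+y² a b) (+-mono-≤ (2xy≤x²+y² b c) (2xy≤x²+y² a c))) (arith a b c)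

  rainbowPairs-≤ : ∀ i → 9 * B * rainbowPairs i ≤ 2 * B * N² + 4 * N²
  rainbowPairs-≤ i = bound i (rainbowPairs-≥ (next i)) (rainbowPairs-≥ (prev i)) (≤-trans (≤-reflexive (cong (3 *_) (cyclic i))) rainbowPairs-total)
    where
    cyclic : ∀ i → rainbowPairs i + (rainbowPairs (next i) + rainbowPairs (prev i)) ≡ rainbowPairs 0F + (rainbowPairs 1F + rainbowPairs 2F)
    cyclic 0F = refl
    cyclic 1F = arith (rainbowPairs 0F) (rainbowPairs 1F) (rainbowPairs 2F)
      where
      arith : ∀ x y z → y + (z + x) ≡ x + (y + z)
      arith = solve-∀
    cyclic 2F = arith (rainbowPairs 0F) (rainbowPairs 1F) (rainbowPairs 2F)
      where
      arith : ∀ x y z → z + (x + y) ≡ x + (y + z)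
      arith = solve-∀
    arith : ∀ B x y z m → 9 * B * x + (3 * B * (2 * m) + (9 * B * y + 2 * m + (9 * B * z + 2 * m))) + 0
      ≡ 2 * B * m + 4 * m + (3 * B * (3 * (x + (y + z))) + (2 * B * m + 2 * B * m))
    arith = solve-∀
    bound : ∀ i {y z} → 2 * B * N² ≤ 9 * B * y + 2 * N² → 2 * B * N² ≤ 9 * B * z + 2 * N² → 3 * (rainbowPairs i + (y + z)) ≤ 2 * N² →
      9 * B * rainbowPairs i ≤ 2 * B * N² + 4 * N²
    bound i {y} {z} y≥ z≥ total = linear 0 (+-mono-≤ (*-monoʳ-≤ (3 * B) total) (+-mono-≤ y≥ z≥)) (arith B (rainbowPairs i) y z N²)

  missing-≤ : ∀ v → 3 * B * missing v ≤ 2 * N²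
  missing-≤ v = *-cancelˡ-≤ 3 (linear 0 (+-mono-≤ (*-monoʳ-≤ (9 * B) (degree+missing v)) (+-mono-≤ (rainbowPairs-≤ (π v)) (min-degree v)))
    (arith B (missing v) (degree₂ J v) (rainbowPairs (π v)) N²))
    where
    arith : ∀ B x d r m → 3 * (3 * B * x) + (9 * B * r + (2 * B * m + 4 * m + (9 * B * d + 2 * m))) + 0
      ≡ 3 * (2 * m) + (9 * B * (d + x) + (9 * B * r + 2 * B * m))
    arith = solve-∀

  partSize-≥ : ∀ k → n ≤ 10 * partSize k
  partSize-≥ k = *-cancelˡ-≤ B (*-cancelˡ-≤ 9 (linear (190 * n) (+-mono-≤ (*-monoʳ-≤ 10 main) (*-monoˡ-≤ n 200≤B)) (arith₂ B n (partSize k))))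
    where
    open ≤-Reasoning
    size≤n : ∀ i → partSize i ≤ n
    size≤n i = ∑⟦⟧≤n _
    product : ∀ k → rainbowPairs (next k) ≤ 2 * (n * partSize k)
    product 0F             = ≤-trans (≤-reflexive (rainbowPairs-≡ 1F)) (*-monoʳ-≤ 2 (*-monoˡ-≤ _ (size≤n 2F)))
    product 1F       = ≤-trans (≤-reflexive (rainbowPairs-≡ 2F)) (*-monoʳ-≤ 2 (*-monoˡ-≤ _ (size≤n 0F)))
    product 2F = ≤-trans (≤-reflexive (rainbowPairs-≡ 0F)) (*-monoʳ-≤ 2 (*-monoˡ-≤ _ (size≤n 1F)))
    arith₁ : ∀ B n a r → n * (2 * (B * n)) + (9 * B * (2 * (n * a)) + (9 * B * r + 2 * (n * n))) + 0 ≡ n * (2 * (9 * B * a + n)) + (9 * B * r + 2 * B * (n * n))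
    arith₁ = solve-∀
    main : B * n ≤ 9 * B * partSize k + n
    main = *-cancelˡ-≤ 2 (*-cancelˡ-≤ n (linear 0 (+-mono-≤ (*-monoʳ-≤ (9 * B) (product k)) (rainbowPairs-≥ (next k))) (arith₁ B n (partSize k) (rainbowPairs (next k)))))
    arith₂ : ∀ B n a → 9 * (B * n) + (10 * (9 * B * a + n) + B * n) + 190 * n ≡ 9 * (B * (10 * a)) + (10 * (B * n) + 200 * n)
    arith₂ = solve-∀

  private
    100Bn≤N² : 100 * (B * n) ≤ N²
    100Bn≤N² = ≤-trans (≤-reflexive (sym (*-assoc 100 B n))) (*-monoˡ-≤ n n-large)

  -- The links of any l + 2 vertices of one part share a pair avoiding w.
  sameColour : ∀ u w → ∑ (λ h → ⟦ (π u == π h) ∧ edge H h u w ⟧) ≤ l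
  sameColour u w with suc l ≤? ∑ (λ h → ⟦ (π u == π h) ∧ edge H h u w ⟧)
  ... | no ¬p = ≤-pred (≰⇒> ¬p)
  ... | yes enough = ⊥-elim (conclude (choose (suc l) _ enough))
    where
    conclude : (Σ (Fin (suc l) → Fin n) λ h → (∀ i j → h i ≡ h j → i ≡ j) × (∀ i → (π u == π (h i)) ∧ edge H (h i) u w ≡ true)) → ⊥
    conclude (h , inj , holds) = use (pigeonhole₂ (λ p q → ⟦ Γ u p q ⟧) g few)
      where
      lost : Fin n → Fin n → Fin n → ℕ
      lost v p q = ⟦ Γ v p q ∧ not (edge H v p q) ⟧
      g : Fin n → Fin n → ℕ
      g p q = lost u p q + (∑ (λ i → lost (h i) p q) + (⟦ w == p ⟧ + ⟦ w == q ⟧))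
      g-total : ∑∑ g ≡ missing u + (∑ (λ i → missing (h i)) + (n + n))
      g-total = trans (∑∑-+ (lost u) _) (cong (missing u +_) (trans (∑∑-+ (λ p q → ∑ λ i → lost (h i) p q) _)
        (cong₂ _+_ (trans (∑-cong λ p → ∑-swap λ q i → lost (h i) p q) (∑-swap λ p i → ∑ λ q → lost (h i) p q))
          (trans (∑∑-+ {n} {n} (λ p q → ⟦ w == p ⟧) (λ p q → ⟦ w == q ⟧)) (cong₂ _+_
            (trans (∑-cong λ p → trans (∑-const n ⟦ w == p ⟧) (*-comm n _)) (∑-point w λ _ → n))
            (trans (∑-cong λ p → ∑-point₁ w) (trans (∑-const n 1) (*-identityʳ n))))))))
      missing-h : 3 * B * ∑ (λ i → missing (h i)) ≤ suc l * (2 * N²)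
      missing-h = ≤-trans (≤-reflexive (sym (∑-*ˡ (3 * B) _))) (∑-bound (2 * N²) λ i → missing-≤ (h i))
      few : ∑∑ g < rainbowPairs (π u)
      few = ≰⇒> λ le → <⇒≱ (≤-trans (m≤m+n (16 + 6 * l) (384)) (≤-trans (≤-reflexive (arith₁ l)) (*-monoʳ-≤ 2 B-large)))
        (*-cancelʳ-≤ (2 * B) (15 + 6 * l) N² (linear (82 * (B * n)) (+-mono-≤ (rainbowPairs-≥ (π u)) (+-mono-≤ (*-monoʳ-≤ (9 * B) (≤-trans le (≤-reflexive g-total)))
            (+-mono-≤ (*-monoʳ-≤ 3 (missing-≤ u)) (+-mono-≤ (*-monoʳ-≤ 3 missing-h) 100Bn≤N²))))
          (arith₂ B l N² n (rainbowPairs (π u)) (missing u) (∑ (λ i → missing (h i))))))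
        where
        arith₁ : ∀ l → 16 + 6 * l + 384 ≡ 2 * (200 + 3 * l)
        arith₁ = solve-∀
        arith₂ : ∀ B l m n r x y → 2 * B * m + (9 * B * r + 2 * m + (9 * B * (x + (y + (n + n))) + (3 * (2 * m) + (3 * (suc l * (2 * m)) + m)))) + 82 * (B * n)
          ≡ (15 + 6 * l) * m + (2 * B * m + (9 * B * r + (3 * (3 * B * x) + (3 * (3 * B * y) + 100 * (B * n)))))
        arith₂ = solve-∀
      use : (∃ λ p → ∃ λ q → g p q < ⟦ Γ u p q ⟧) → ⊥
      use (p , q , lt) = ¬blowup H l free h inj
        (λ p≡w → point-absurd (trans (cong ⟦_⟧ (trans (cong (w ==_) p≡w) (==-refl w))) refl) (≤-trans (m≤m+n _ _) (≤-trans (m≤n+m _ (∑ λ i → lost (h i) p q)) (m≤n+m _ (lost u p q)))))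
        (λ q≡w → point-absurd (trans (cong ⟦_⟧ (trans (cong (w ==_) q≡w) (==-refl w))) refl) (≤-trans (m≤n+m _ ⟦ w == p ⟧) (≤-trans (m≤n+m _ (∑ λ i → lost (h i) p q)) (m≤n+m _ (lost u p q)))))
        (trans (sym (edge-rotate H u p q)) (present u Γupq (m≤m+n _ _)))
        (λ i → trans (sym (edge-rotate H (h i) p q)) (present (h i) (trans (cong (λ x → rainbow x (π p) (π q)) (sym (==⇒≡ {i = π u} {π (h i)} (proj₁ (∧-true (holds i)))))) Γupq)
          (≤-trans (term≤∑ (λ i → lost (h i) p q) i) (≤-trans (m≤m+n _ _) (m≤n+m _ (lost u p q))))))
        (λ i → proj₂ (∧-true {π u == π (h i)} (holds i)))
        where
        g≡0 : g p q ≡ 0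
        g≡0 = n≤0⇒n≡0 (≤-pred (≤-trans lt (⟦⟧≤1 (Γ u p q))))
        Γupq : Γ u p q ≡ true
        Γupq = positive (Γ u p q) lt
          where
          positive : ∀ b → g p q < ⟦ b ⟧ → b ≡ true
          positive true _ = refl
        point-absurd : ∀ {x} → x ≡ 1 → x ≤ g p q → ⊥
        point-absurd refl le rewrite g≡0 = case le of λ ()
        present : ∀ v → Γ v p q ≡ true → lost v p q ≤ g p q → edge H v p q ≡ true
        present v r le with Γ v p q | edge H v p q
        ... | true | true  = refl
        ... | true | false = ⊥-elim (point-absurd refl le)

  missingPair : Fin n → Fin n → ℕ
  missingPair u w = ∑ λ c → ⟦ Γ u w c ∧ not (edge H u w c) ⟧

  -- If u, u′ share a part and u u′ w is an edge, then h = c ranges over few vertices in the copies with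
  -- edges u w u′, u w c and c u′ b; as u′ has almost full link, the pair u w has almost empty link.
  mixed⇒missing : ∀ u u′ w → π u ≡ π u′ → π u ≢ π w → edge H u u′ w ≡ true → 3 * l ≤ missingPair u w
  mixed⇒missing u u′ w same differ e = *-cancelˡ-≤ 30 (linear (480 * l + 39700) (+-mono-≤ missing-≥ (*-monoʳ-≤ 2 (≤-trans (*-monoʳ-≤ 100 B-large) n-large)))
      (arith₃ l n (missingPair u w) B))
    where
    present : Fin n → Bool
    present c = Γ u w c ∧ edge H u w c
    cd : ℕ
    cd = ∑ λ c → ⟦ present c ⟧
    a k : ℕ
    a = partSize (π w)
    k = partSize (third (π u) (π w))
    k-split : k ≡ missingPair u w + cd
    k-split = trans (∑-cong pointwise) (∑-+ _ _)
      where
      pointwise : ∀ c → ⟦ third (π u) (π w) == π c ⟧ ≡ ⟦ Γ u w c ∧ not (edge H u w c) ⟧ + ⟦ present c ⟧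
      pointwise c with rainbow-third (π u) (π w) (π c)
      ... | inj₁ eq = ⊥-elim (differ eq)
      ... | inj₂ eq rewrite sym eq with Γ u w c | edge H u w c
      ...   | false | _     = refl
      ...   | true  | true  = refl
      ...   | true  | false = refl
    row : ∀ b → ⟦ π w == π b ⟧ * cd ≤ ⟦ π w == π b ⟧ * l + (⟦ w == b ⟧ * n + ∑ λ c → ⟦ Γ u′ b c ∧ not (edge H u′ b c) ⟧)
    row b with π w == π b in wb
    ... | false = z≤n
    ... | true with w == b in w≡b
    ...   | true  = ≤-trans (+-monoˡ-≤ 0 (∑⟦⟧≤n present)) (≤-trans (m≤m+n (n + 0) _) (m≤n+m _ (l + 0)))
    ...   | false =
        ≤-trans (≤-reflexive (+-identityʳ cd)) (≤-trans (∑-mono pointwise) (≤-trans (≤-reflexive (∑-+ _ _))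
          (+-monoˡ-≤ _ (≤-trans (commonNeighbours H l free u w u′ b (λ u≡b → differ (trans (cong π u≡b) (sym (==⇒≡ wb)))) (==-sound w≡b)
            (trans (swap₂₃ H u w u′) e)) (m≤m+n l 0)))))
      where
      pointwise : ∀ c → ⟦ present c ⟧ ≤ ⟦ edge H u w c ∧ edge H c u′ b ⟧ + ⟦ Γ u′ b c ∧ not (edge H u′ b c) ⟧
      pointwise c rewrite edge-rotate H c u′ b | sym same | sym (==⇒≡ {i = π w} {π b} wb) with Γ u w c | edge H u w c | edge H u′ b c
      ... | false | _     | _     = z≤n
      ... | true  | false | _     = z≤n
      ... | true  | true  | true  = s≤s z≤n
      ... | true  | true  | false = ≤-refl
    a·cd : a * cd ≤ a * l + (n + missing u′)
    a·cd = begin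
      a * cd
        ≡⟨ ∑-*ʳ cd (λ b → ⟦ π w == π b ⟧) ⟨
      ∑ (λ b → ⟦ π w == π b ⟧ * cd)
        ≤⟨ ∑-mono row ⟩
      ∑ (λ b → ⟦ π w == π b ⟧ * l + (⟦ w == b ⟧ * n + ∑ λ c → ⟦ Γ u′ b c ∧ not (edge H u′ b c) ⟧))
        ≡⟨ trans (∑-+ _ _) (cong₂ _+_ (∑-*ʳ l _) (trans (∑-+ _ _) (cong (_+ missing u′) (∑-point w λ _ → n)))) ⟩
      a * l + (n + missing u′) ∎
      where open ≤-Reasoning
    instance
      a≢0 : NonZero a
      a≢0 = ≢-nonZero λ a≡0 → <⇒≱ (>-nonZero⁻¹ n) (≤-trans (partSize-≥ (π w)) (≤-reflexive (trans (cong (10 *_) a≡0) refl)))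
    cd-≤ : 3 * B * cd ≤ 3 * B * l + 30 * B + 20 * n
    cd-≤ = *-cancelˡ-≤ a (linear 0 (+-mono-≤ (*-monoʳ-≤ (3 * B) a·cd) (+-mono-≤ (missing-≤ u′) (*-monoˡ-≤ (3 * B + 2 * n) (partSize-≥ (π w)))))
      (arith₁ a B cd l n (missing u′)))
      where
      arith₁ : ∀ a B c l n x → a * (3 * B * c) + (3 * B * (a * l + (n + x)) + (2 * (n * n) + 10 * a * (3 * B + 2 * n))) + 0
        ≡ a * (3 * B * l + 30 * B + 20 * n) + (3 * B * (a * c) + (3 * B * x + n * (3 * B + 2 * n)))
      arith₁ = solve-∀
    missing-≥ : 2 * n ≤ 30 * missingPair u w + 30 * l + 300
    missing-≥ = *-cancelˡ-≤ B (linear 0 (+-mono-≤ (*-monoʳ-≤ (3 * B) (≤-trans (partSize-≥ (third (π u) (π w))) (≤-reflexive (cong (10 *_) k-split))))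
      (+-mono-≤ (*-monoʳ-≤ 10 cd-≤) (*-monoˡ-≤ n 200≤B))) (arith₂ B n (missingPair u w) cd l))
      where
      arith₂ : ∀ B n m c l → B * (2 * n) + (3 * B * (10 * (m + c)) + (10 * (3 * B * l + 30 * B + 20 * n) + B * n)) + 0
        ≡ B * (30 * m + 30 * l + 300) + (3 * B * n + (10 * (3 * B * c) + 200 * n))
      arith₂ = solve-∀
    arith₃ : ∀ l n m B → 30 * (3 * l) + (30 * m + 30 * l + 300 + 2 * n) + (480 * l + 39700) ≡ 30 * m + (2 * n + 2 * (100 * (200 + 3 * l)))
    arith₃ = solve-∀

  mixed : Fin n → Fin n → ℕ
  mixed u w = ∑ λ z → ⟦ (π z == π u) ∨ (π z == π w) ⟧ * χ H u w z

  mixed-≤ : ∀ u w → mixed u w ≤ 2 * l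
  mixed-≤ u w = ≤-trans (∑-mono pointwise) (≤-trans (≤-reflexive (∑-+ _ _))
    (≤-trans (+-mono-≤ (sameColour u w) (sameColour w u)) (≤-reflexive (cong (l +_) (sym (+-identityʳ l))))))
    where
    pointwise : ∀ z → ⟦ (π z == π u) ∨ (π z == π w) ⟧ * χ H u w z ≤ ⟦ (π u == π z) ∧ edge H z u w ⟧ + ⟦ (π w == π z) ∧ edge H z w u ⟧
    pointwise z rewrite ==-sym (π z) (π u) | ==-sym (π z) (π w) | edge-rotate H z u w | edge-swap₁₃ H z w u with π u == π z | π w == π z | edge H u w z
    ... | true  | _     | true  = s≤s z≤n
    ... | true  | _     | false = z≤n
    ... | false | true  | true  = s≤s z≤n
    ... | false | true  | false = z≤n
    ... | false | false | _     = z≤n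

  mixed-missing : ∀ u w → π u ≢ π w → 3 * mixed u w ≤ 2 * missingPair u w
  mixed-missing u w differ with 1 ≤? mixed u w
  ... | no ¬p = ≤-trans (≤-reflexive (cong (3 *_) (n≤0⇒n≡0 (≤-pred (≰⇒> ¬p))))) z≤n
  ... | yes p = ≤-trans (*-monoʳ-≤ 3 (mixed-≤ u w)) (≤-trans (≤-reflexive (arith l)) (*-monoʳ-≤ 2 (many (pigeonhole _ (λ _ → 0) (≤-<-trans (≤-reflexive (∑-zero λ _ → refl)) p)))))
    where
    arith : ∀ l → 3 * (2 * l) ≡ 2 * (3 * l)
    arith = solve-∀
    missingPair-sym : missingPair w u ≡ missingPair u w
    missingPair-sym = ∑-cong λ c → cong₂ (λ x y → ⟦ x ∧ not y ⟧) (rainbow-swap (π w) (π u) (π c)) (swap₁₂ H w u c)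
    many : (∃ λ z → 0 < ⟦ (π z == π u) ∨ (π z == π w) ⟧ * χ H u w z) → 3 * l ≤ missingPair u w
    many (z , lt) with edge H u w z in e | π z ≟ π u | π z ≟ π w
    ... | true | yes zu | _      = mixed⇒missing u z w (sym zu) differ (trans (swap₂₃ H u z w) e)
    ... | true | no _   | yes zw = ≤-trans (mixed⇒missing w z u (sym zw) (differ ∘ sym) (trans (edge-rotate H w z u) (trans (edge-rotate H z u w) e))) (≤-reflexive missingPair-sym)
    many (z , ()) | true | no _ | no _
    many (z , lt) | false | a | b = ⊥-elim (n≮0 (≤-trans lt (≤-reflexive (*-zeroʳ ⟦ does a ∨ does b ⟧))))

  edges₆-≤ : edges₆ H ≤ 6 * (partSize 0F * partSize 1F * partSize 2F) + ∑ (λ i → edges₆ (induced H i))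
  edges₆-≤ = begin
    edges₆ H
      ≡⟨ ∑³-cong split ⟩
    ∑³ (λ a b c → mono a b c + (cross a b c + (f a b c + (f b c a + f c a b))))
      ≡⟨ trans (∑³-+ mono _) (cong (∑³ mono +_) (trans (∑³-+ cross _) (cong (∑³ cross +_)
           (trans (∑³-+ f _) (cong (∑³ f +_) (trans (∑³-+ (λ a b c → f b c a) (λ a b c → f c a b)) (cong₂ _+_ rotate₁ rotate₂))))))) ⟩
    ∑³ mono + (∑³ cross + (M + (M + M)))
      ≤⟨ +-monoʳ-≤ (∑³ mono) (+-monoʳ-≤ (∑³ cross) (*-cancelˡ-≤ 2 (≤-trans (≤-reflexive (arith M)) M-≤))) ⟩
    ∑³ mono + (∑³ cross + ∑³ absent)
      ≡⟨ cong₂ _+_ (induced-total H) (trans (sym (∑³-+ cross absent)) (trans (∑³-cong cross+absent) rainbowTriples)) ⟩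
    ∑ (λ i → edges₆ (induced H i)) + 6 * (partSize 0F * partSize 1F * partSize 2F)
      ≡⟨ +-comm (∑ λ i → edges₆ (induced H i)) _ ⟩
    6 * (partSize 0F * partSize 1F * partSize 2F) + ∑ (λ i → edges₆ (induced H i)) ∎
    where
    open ≤-Reasoning
    mono cross f absent : Fin n → Fin n → Fin n → ℕ
    mono a b c = ⟦ (π a == π b) ∧ (π b == π c) ⟧ * χ H a b c
    cross a b c = ⟦ Γ a b c ⟧ * χ H a b c
    f a b c = ⟦ (π a == π b) ∧ not (π b == π c) ⟧ * χ H a b c
    absent a b c = ⟦ Γ a b c ∧ not (edge H a b c) ⟧
    M : ℕ
    M = ∑³ f
    rotate₁ : ∑³ (λ a b c → f b c a) ≡ M
    rotate₁ = ∑³-rotate f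
    rotate₂ : ∑³ (λ a b c → f c a b) ≡ M
    rotate₂ = trans (∑³-rotate (λ a b c → f b c a)) (∑³-rotate f)
    arith : ∀ m → 2 * (m + (m + m)) ≡ 3 * (m + m)
    arith = solve-∀
    f-bca : ∀ a b c → f b c a ≡ ⟦ (π b == π c) ∧ not (π c == π a) ⟧ * χ H a b c
    f-bca a b c = cong (⟦ (π b == π c) ∧ not (π c == π a) ⟧ *_) (sym (χ-rotate H a b c))
    f-cab : ∀ a b c → f c a b ≡ ⟦ (π c == π a) ∧ not (π a == π b) ⟧ * χ H a b c
    f-cab a b c = cong (⟦ (π c == π a) ∧ not (π a == π b) ⟧ *_) (χ-rotate H c a b)
    split : ∀ a b c → χ H a b c ≡ mono a b c + (cross a b c + (f a b c + (f b c a + f c a b)))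
    split a b c rewrite f-bca a b c | f-cab a b c = trans (sym (*-identityˡ (χ H a b c)))
      (trans (cong (_* χ H a b c) (pattern-split (π a) (π b) (π c)))
        (distrib ⟦ (π a == π b) ∧ (π b == π c) ⟧ ⟦ Γ a b c ⟧ ⟦ (π a == π b) ∧ not (π b == π c) ⟧
          ⟦ (π b == π c) ∧ not (π c == π a) ⟧ ⟦ (π c == π a) ∧ not (π a == π b) ⟧ (χ H a b c)))
      where
      distrib : ∀ p q r s t x → (p + (q + (r + (s + t)))) * x ≡ p * x + (q * x + (r * x + (s * x + t * x)))
      distrib = solve-∀
    cross+absent : ∀ a b c → cross a b c + absent a b c ≡ ⟦ Γ a b c ⟧
    cross+absent a b c with Γ a b c | edge H a b c
    ... | false | _     = refl
    ... | true  | true  = refl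
    ... | true  | false = refl
    mixed-total : ∑∑ (λ u w → ⟦ not (π u == π w) ⟧ * mixed u w) ≡ M + M
    mixed-total = trans (∑∑-cong λ u w → trans (sym (∑-*ˡ ⟦ not (π u == π w) ⟧ _)) (∑-cong λ z → pointwise u w z))
      (trans (∑³-+ (λ a b c → f b c a) (λ a b c → f c a b)) (cong₂ _+_ rotate₁ rotate₂))
      where
      pointwise : ∀ u w z → ⟦ not (π u == π w) ⟧ * (⟦ (π z == π u) ∨ (π z == π w) ⟧ * χ H u w z) ≡ f w z u + f z u w
      pointwise u w z rewrite f-bca u w z | f-cab u w z = trans (sym (*-assoc ⟦ not (π u == π w) ⟧ _ _))
        (trans (cong (_* χ H u w z) (mixed-split (π u) (π w) (π z)))
          (*-distribʳ-+ (χ H u w z) ⟦ (π w == π z) ∧ not (π z == π u) ⟧ ⟦ (π z == π u) ∧ not (π u == π w) ⟧))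
    absent-total : ∑∑ (λ u w → ⟦ not (π u == π w) ⟧ * missingPair u w) ≡ ∑³ absent
    absent-total = ∑∑-cong λ u w → trans (sym (∑-*ˡ ⟦ not (π u == π w) ⟧ _)) (∑-cong λ c → pointwise u w c)
      where
      pointwise : ∀ u w c → ⟦ not (π u == π w) ⟧ * absent u w c ≡ absent u w c
      pointwise u w c with π u == π w
      ... | true  = refl
      ... | false = *-identityˡ _
    M-≤ : 3 * (M + M) ≤ 2 * ∑³ absent
    M-≤ = begin
      3 * (M + M)
        ≡⟨ trans (cong (3 *_) (sym mixed-total)) (sym (∑∑-*ˡ 3 _)) ⟩
      ∑∑ (λ u w → 3 * (⟦ not (π u == π w) ⟧ * mixed u w))
        ≤⟨ ∑∑-mono pointwise ⟩
      ∑∑ (λ u w → 2 * (⟦ not (π u == π w) ⟧ * missingPair u w))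
        ≡⟨ trans (∑∑-*ˡ 2 _) (cong (2 *_) absent-total) ⟩
      2 * ∑³ absent ∎
      where
      pointwise : ∀ u w → 3 * (⟦ not (π u == π w) ⟧ * mixed u w) ≤ 2 * (⟦ not (π u == π w) ⟧ * missingPair u w)
      pointwise u w = go (π u == π w) refl
        where
        go : ∀ b → (π u == π w) ≡ b → 3 * (⟦ not b ⟧ * mixed u w) ≤ 2 * (⟦ not b ⟧ * missingPair u w)
        go true  eq = z≤n
        go false eq = subst₂ _≤_ (cong (3 *_) (sym (*-identityˡ (mixed u w)))) (cong (2 *_) (sym (*-identityˡ (missingPair u w))))
                        (mixed-missing u w (==-sound eq))

  induced-codeg : ∀ i a b → codeg (induced H i) a b < suc l
  induced-codeg i a b = s≤s (begin
    codeg (induced H i) a b                      ≡⟨ codeg-∑ (induced H i) a b ⟩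
    ∑ (λ c → χ H (ι a) (ι b) (ι c))              ≡⟨ ι-sum (χ H (ι a) (ι b)) ⟨
    ∑ (λ v → ⟦ i == π v ⟧ * χ H (ι a) (ι b) v)   ≤⟨ ∑-mono pointwise ⟩
    ∑ (λ v → ⟦ (π (ι a) == π v) ∧ edge H v (ι a) (ι b) ⟧) ≤⟨ sameColour (ι a) (ι b) ⟩
    l ∎)
    where
    open Enumeration (enumeration (λ v → i == π v))
    open ≤-Reasoning
    pointwise : ∀ v → ⟦ i == π v ⟧ * χ H (ι a) (ι b) v ≤ ⟦ (π (ι a) == π v) ∧ edge H v (ι a) (ι b) ⟧
    pointwise v rewrite sym (==⇒≡ {i = i} {π (ι a)} (ι-holds a)) | edge-rotate H v (ι a) (ι b) =
      ≤-reflexive (sym (⟦⟧-∧ (i == π v) _))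

-- Progressive induction

opaque
  slack : ℕ → ℕ
  slack l = 200 + 3 * l

  threshold : ℕ → ℕ
  threshold l = 100 * slack l + 27 * (slack l * ((l + 2) * slack l))

  slack-≥ : ∀ l → 200 + 3 * l ≤ slack l
  slack-≥ l = ≤-refl

  threshold-≥₁ : ∀ l → 100 * slack l ≤ threshold l
  threshold-≥₁ l = m≤m+n _ _

  threshold-≥₂ : ∀ l → 27 * (slack l * ((l + 2) * slack l)) ≤ threshold l
  threshold-≥₂ l = m≤n+m _ (100 * slack l)

200≤slack : ∀ l → 200 ≤ slack l
200≤slack l = ≤-trans (m≤m+n 200 _) (slack-≥ l)

threshold-≥ : ∀ l → 3 * l ≤ threshold l
threshold-≥ l = ≤-trans (≤-trans (≤-trans (m≤n+m (3 * l) 200) (slack-≥ l)) (m≤n*m (slack l) 100)) (threshold-≥₁ l)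

-- degree₂ counts ordered pairs, so a balanced complete 3-partite graph has about 2n²/9.
HighDegree : ∀ {n} → ℕ → Graph3 n → Fin n → Set
HighDegree {n} l H v = 2 * slack l * (n * n) ≤ 9 * slack l * degree₂ H v + n * n

record Decomposition {n} (l : ℕ) (H : Graph3 n) : Set where
  field
    s₀ s₁ s₂   : ℕ
    G₀         : Graph3 s₀
    G₁         : Graph3 s₁
    G₂         : Graph3 s₂
    sizes      : s₀ + (s₁ + s₂) ≡ n
    codeg₀     : ∀ a b → codeg G₀ a b < suc l
    codeg₁     : ∀ a b → codeg G₁ a b < suc l
    codeg₂     : ∀ a b → codeg G₂ a b < suc l
    edges₆-≤   : edges₆ H ≤ 6 * (s₀ * s₁ * s₂) + (edges₆ G₀ + (edges₆ G₁ + edges₆ G₂))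

decomposition : ∀ {n} l (H : Graph3 n) → Free (suc l) H → threshold l ≤ n → (∀ v → HighDegree l H v) → Decomposition l H
decomposition {n} l H free n-large high = record
  { s₀       = Enumeration.size (enumeration λ v → 0F == π v)
  ; s₁       = Enumeration.size (enumeration λ v → 1F == π v)
  ; s₂       = Enumeration.size (enumeration λ v → 2F == π v)
  ; G₀       = induced H 0F
  ; G₁       = induced H 1F
  ; G₂       = induced H 2F
  ; sizes    = trans (cong₂ _+_ (size≡ 0F) (cong₂ _+_ (size≡ 1F) (size≡ 2F))) partSize-sum
  ; codeg₀   = induced-codeg 0F
  ; codeg₁   = induced-codeg 1F
  ; codeg₂   = induced-codeg 2F
  ; edges₆-≤ = ≤-trans edges₆-≤ (≤-reflexive (cong₂ _+_
      (cong (6 *_) (cong₂ _*_ (cong₂ _*_ (sym (size≡ 0F)) (sym (size≡ 1F))) (sym (size≡ 2F))))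
      (∑-Fin3 λ i → edges₆ (induced H i))))
  }
  where
  B : ℕ
  B = slack l
  instance
    n≢0 : NonZero n
    n≢0 = >-nonZero (≤-trans (≤-trans (s≤s z≤n) (200≤slack l)) (≤-trans (≤-trans (m≤n*m (slack l) 100) (threshold-≥₁ l)) n-large))
  open Cleaning H l free B
  min-degree : ∀ v → 2 * B * (n * n) ≤ 9 * B * degree₂ clean v + 2 * (n * n)
  min-degree v = linear 0 (+-mono-≤ (high v) (+-mono-≤ (*-monoʳ-≤ (9 * B) (degree-clean v)) (*-monoˡ-≤ n (≤-trans (threshold-≥₂ l) n-large))))
    (arith B (degree₂ H v) (degree₂ clean v) ((l + 2) * B) n)
    where
    arith : ∀ B d c k n → 2 * B * (n * n) + (9 * B * d + n * n + (9 * B * (c + 3 * (n * k)) + n * n)) + 0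
      ≡ 9 * B * c + 2 * (n * n) + (2 * B * (n * n) + (9 * B * d + 27 * (B * k) * n))
    arith = solve-∀
  open Tripartition clean B (200≤slack l) min-degree clean-links using (partition; some-edge)
  π : Fin n → Fin 3
  π = proj₁ partition
  open Stable H clean l B free clean⊆ π (proj₂ partition) some-edge (slack-≥ l) (≤-trans (threshold-≥₁ l) n-large) min-degree
  size≡ : ∀ i → Enumeration.size (enumeration λ v → i == π v) ≡ partSize i
  size≡ i = Enumeration.size-≡ (enumeration λ v → i == π v)

edges₆-codeg : ∀ {m} l (G : Graph3 m) → (∀ a b → codeg G a b < suc l) → edges₆ G + l * m ≤ l * (m * m)
edges₆-codeg {m} l G small = begin
  edges₆ G + l * m
    ≡⟨ cong (edges₆ G +_) (trans (*-comm l m) (trans (sym (∑-const m l)) (∑-cong λ a → sym (∑-point a λ _ → l)))) ⟩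
  edges₆ G + ∑∑ (λ a b → ⟦ a == b ⟧ * l)
    ≡⟨ ∑∑-+ (λ a b → ∑ (χ G a b)) (λ a b → ⟦ a == b ⟧ * l) ⟨
  ∑∑ (λ a b → ∑ (χ G a b) + ⟦ a == b ⟧ * l)
    ≤⟨ ∑-bound (m * l) (λ a → ∑-bound l (pointwise a)) ⟩
  m * (m * l)
    ≡⟨ arith m l ⟩
  l * (m * m) ∎
  where
  open ≤-Reasoning
  arith : ∀ m l → m * (m * l) ≡ l * (m * m)
  arith = solve-∀
  pointwise : ∀ a b → ∑ (χ G a b) + ⟦ a == b ⟧ * l ≤ l
  pointwise a b with a ≟ b
  ... | no _     = ≤-trans (≤-reflexive (+-identityʳ _)) (≤-trans (≤-reflexive (sym (codeg-∑ G a b))) (≤-pred (small a b)))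
  ... | yes refl = ≤-reflexive (trans (cong (_+ (l + 0)) (∑-zero λ c → cong ⟦_⟧ (noLoop G a c))) (+-identityʳ l))

delete : ∀ {m} → Graph3 (suc m) → Fin (suc m) → Graph3 m
delete H v = record
  { edge   = λ a b c → edge H (punchIn v a) (punchIn v b) (punchIn v c)
  ; swap₁₂ = λ a b c → swap₁₂ H (punchIn v a) (punchIn v b) (punchIn v c)
  ; swap₂₃ = λ a b c → swap₂₃ H (punchIn v a) (punchIn v b) (punchIn v c)
  ; noLoop = λ a c → noLoop H (punchIn v a) (punchIn v c)
  }

delete-free : ∀ {m t} (H : Graph3 (suc m)) v → Free t H → Free t (delete H v)
delete-free H v free (f₁ , f₂ , f₄ , f₅ , h , n₁₂ , n₁₄ , n₁₅ , n₂₄ , n₂₅ , n₄₅ , inj , h≢ , e , es) = free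
  ( ι f₁ , ι f₂ , ι f₄ , ι f₅ , ι ∘ h , n₁₂ ∘ ι-inj , n₁₄ ∘ ι-inj , n₁₅ ∘ ι-inj , n₂₄ ∘ ι-inj , n₂₅ ∘ ι-inj , n₄₅ ∘ ι-inj
  , inj ∘ ι-inj
  , (λ i → let (a , b , c , d) = h≢ i in a ∘ ι-inj , b ∘ ι-inj , c ∘ ι-inj , d ∘ ι-inj)
  , e , es)
  where
  ι = punchIn v
  ι-inj : ∀ {i j} → ι i ≡ ι j → i ≡ j
  ι-inj {i} {j} = punchIn-injective v i j

delete-edges : ∀ {m} (H : Graph3 (suc m)) v → edges₆ H ≤ edges₆ (delete H v) + 3 * degree₂ H v
delete-edges {m} H v = begin
  edges₆ H
    ≡⟨ ∑-punchIn (λ a → ∑∑ (χ H a)) v ⟩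
  d + ∑ (λ a → ∑∑ (χ H (ι a)))
    ≡⟨ cong (d +_) (∑-cong λ a → trans (∑-punchIn (λ b → ∑ (χ H (ι a) b)) v) (cong (∑ (χ H (ι a) v) +_) (∑-cong λ b → ∑-punchIn (χ H (ι a) (ι b)) v))) ⟩
  d + ∑ (λ a → ∑ (χ H (ι a) v) + ∑ (λ b → χ H (ι a) (ι b) v + ∑ (λ c → χ H (ι a) (ι b) (ι c))))
    ≡⟨ cong (d +_) (trans (∑-+ _ _) (cong (∑ (λ a → ∑ (χ H (ι a) v)) +_) (∑∑-+ _ _))) ⟩
  d + (∑ (λ a → ∑ (χ H (ι a) v)) + (∑∑ (λ a b → χ H (ι a) (ι b) v) + edges₆ (delete H v)))
    ≤⟨ +-monoʳ-≤ d (+-mono-≤ second-vertex (+-monoˡ-≤ (edges₆ (delete H v)) third-vertex)) ⟩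
  d + (d + (d + edges₆ (delete H v)))
    ≡⟨ arith d (edges₆ (delete H v)) ⟩
  edges₆ (delete H v) + 3 * d ∎
  where
  open ≤-Reasoning
  ι = punchIn v
  d = degree₂ H v
  arith : ∀ d e → d + (d + (d + e)) ≡ e + 3 * d
  arith = solve-∀
  drop : ∀ (f : Fin (suc m) → ℕ) → ∑ (f ∘ ι) ≤ ∑ f
  drop f = ≤-trans (m≤n+m _ (f v)) (≤-reflexive (sym (∑-punchIn f v)))
  second-vertex : ∑ (λ a → ∑ (χ H (ι a) v)) ≤ d
  second-vertex = ≤-trans (drop λ a → ∑ (χ H a v)) (≤-reflexive (∑∑-cong λ a c → χ-swap₁₂ H a v c))
  third-vertex : ∑∑ (λ a b → χ H (ι a) (ι b) v) ≤ d
  third-vertex = ≤-trans (≤-trans (∑-mono λ a → drop λ b → χ H (ι a) b v) (drop λ a → ∑ λ b → χ H a b v))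
    (≤-reflexive (∑∑-cong λ a b → sym (χ-rotate H v a b)))

rearrangement : ∀ {a b c d} → a ≤ b → c ≤ d → a * d + b * c ≤ a * c + b * d
rearrangement {a} {c = c} a≤b c≤d with m≤n⇒∃[o]m+o≡n a≤b | m≤n⇒∃[o]m+o≡n c≤d
... | x , refl | y , refl = linear (x * y) (z≤n {0}) (arith a c x y)
  where
  arith : ∀ a c x y → a * (c + y) + (a + x) * c + 0 + x * y ≡ a * c + (a + x) * (c + y) + 0
  arith = solve-∀

balanced-best : ∀ l a b c n → a + (b + c) ≡ n → 3 * l ≤ n →
  54 * (a * b * c) + 9 * l * (a * a + b * b + c * c) ≤ 2 * (n * n * n) + 3 * l * (n * n)
balanced-best l a b c n refl 3l≤n = linear 0
  (+-mono-≤ (*-monoʳ-≤ 2 (rearrangement 3l≤n (products≤squares a b c))) (*-monoʳ-≤ 6 (+-mono-≤ (*-monoʳ-≤ a (2xy≤x²+y² b c)) (+-mono-≤ (*-monoʳ-≤ b (2xy≤x²+y² a c)) (*-monoʳ-≤ c (2xy≤x²+y² a b))))))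
  (arith l a b c)
  where
  arith : ∀ l a b c →
    54 * (a * b * c) + 9 * l * (a * a + b * b + c * c)
      + (2 * (3 * l * (a * b + b * c + c * a) + (a + (b + c)) * (a * a + b * b + c * c))
        + 6 * (a * (b * b + c * c) + (b * (a * a + c * c) + c * (a * a + b * b)))) + 0
    ≡ 2 * ((a + (b + c)) * (a + (b + c)) * (a + (b + c))) + 3 * l * ((a + (b + c)) * (a + (b + c)))
      + (2 * (3 * l * (a * a + b * b + c * c) + (a + (b + c)) * (a * b + b * c + c * a))
        + 6 * (a * (2 * (b * c)) + (b * (2 * (a * c)) + c * (2 * (a * b)))))
  arith = solve-∀

decomposed-≤ : ∀ {n} l (H : Graph3 n) → threshold l ≤ n → Decomposition l H → 9 * edges₆ H ≤ 2 * (n * n * n) + 3 * l * (n * n)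
decomposed-≤ {n} l H n-large D = ≤-trans (linear (9 * l * n)
    (+-mono-≤ (*-monoʳ-≤ 9 edges₆-≤) (*-monoʳ-≤ 9 (+-mono-≤ (edges₆-codeg l G₀ codeg₀) (+-mono-≤ (edges₆-codeg l G₁ codeg₁) (edges₆-codeg l G₂ codeg₂)))))
    (trans (cong (λ n → 9 * edges₆ H + _ + 9 * l * n) (sym sizes)) (arith l s₀ s₁ s₂ (edges₆ H) (edges₆ G₀) (edges₆ G₁) (edges₆ G₂))))
  (balanced-best l s₀ s₁ s₂ n sizes (≤-trans (threshold-≥ l) n-large))
  where
  open Decomposition D
  arith : ∀ l a b c e x y z → 9 * e + (9 * (6 * (a * b * c) + (x + (y + z))) + 9 * (l * (a * a) + (l * (b * b) + l * (c * c)))) + 9 * l * (a + (b + c))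
    ≡ 54 * (a * b * c) + 9 * l * (a * a + b * b + c * c) + (9 * e + 9 * (x + l * a + (y + l * b + (z + l * c))))
  arith = solve-∀

lowDegree-step : ∀ {m} l (H : Graph3 (suc m)) v → ¬ HighDegree l H v →
  slack l * (9 * edges₆ H) + 3 * (suc m * suc m) ≤ slack l * (9 * edges₆ (delete H v)) + 6 * slack l * (suc m * suc m)
lowDegree-step {m} l H v low = linear 0 (+-mono-≤ (*-monoʳ-≤ (slack l) (*-monoʳ-≤ 9 (delete-edges H v))) (*-monoʳ-≤ 3 (<⇒≤ (≰⇒> low))))
  (arith (slack l) (edges₆ H) (edges₆ (delete H v)) (degree₂ H v) (suc m * suc m))
  where
  arith : ∀ B e e′ d k → B * (9 * e) + 3 * k + (B * (9 * (e′ + 3 * d)) + 3 * (2 * B * k)) + 0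
    ≡ B * (9 * e′) + 6 * B * k + (B * (9 * e) + 3 * (9 * B * d + k))
  arith = solve-∀

highDegree? : ∀ {n} l (H : Graph3 n) → (∀ v → HighDegree l H v) ⊎ ∃ λ v → ¬ HighDegree l H v
highDegree? {n} l H with any? (λ v → ¬? (high? v))
  where
  high? : ∀ v → Dec (HighDegree l H v)
  high? v = 2 * slack l * (n * n) ≤? 9 * slack l * degree₂ H v + n * n
... | yes (v , low) = inj₂ (v , low)
... | no none       = inj₁ λ v → decidable-stable (2 * slack l * (n * n) ≤? 9 * slack l * degree₂ H v + n * n) λ low → none (v , low)

excess-step : ∀ B l m {e e′ x y} .{{_ : NonZero B}} → 6 * B ≤ m →
  B * (9 * e) + 3 * (suc m * suc m) ≤ B * (9 * e′) + 6 * B * (suc m * suc m) →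
  9 * e′ ≤ 2 * (m * m * m) + 3 * l * (m * m) + x → x ≤ suc y →
  9 * e ≤ 2 * (suc m * suc m * suc m) + 3 * l * (suc m * suc m) + y
excess-step B l m {e} {e′} {x} {y} big low ih shrink = *-cancelˡ-≤ B
  (linear (2 * (m * m) + B * (6 * l * m + 3 * l) + (5 * m + 3 + B))
    (+-mono-≤ low (+-mono-≤ (*-monoʳ-≤ B ih) (+-mono-≤ (*-monoʳ-≤ B shrink) (*-monoʳ-≤ (suc m) big)))) (arith B e e′ m l x y))
  where
  arith : ∀ B e e′ m l x y →
    B * (9 * e) + (B * (9 * e′) + 6 * B * (suc m * suc m) + (B * (2 * (m * m * m) + 3 * l * (m * m) + x) + (B * suc y + suc m * m))) + (2 * (m * m) + B * (6 * l * m + 3 * l) + (5 * m + 3 + B))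
    ≡ B * (2 * (suc m * suc m * suc m) + 3 * l * (suc m * suc m) + y) + (B * (9 * e) + 3 * (suc m * suc m) + (B * (9 * e′) + (B * x + suc m * (6 * B))))
  arith = solve-∀

-- Progressive induction: deleting a vertex of low degree decreases the excess by more than one, and the
-- excess at the threshold is at most 9 (threshold l)³.
excess : ∀ l k n → n ≡ k + threshold l → (H : Graph3 n) → Free (suc l) H →
  9 * edges₆ H ≤ 2 * (n * n * n) + 3 * l * (n * n) + (9 * (threshold l * threshold l * threshold l) ∸ k)
excess l zero    N refl H free = ≤-trans (*-monoʳ-≤ 9 (≤-trans (∑-bound (N * N) λ a → ∑-bound N λ b → ∑⟦⟧≤n _) (≤-reflexive (sym (*-assoc N N N)))))
  (m≤n+m (9 * (N * N * N)) (2 * (N * N * N) + 3 * l * (N * N)))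
excess l (suc k) (suc m) refl H free with highDegree? l H
... | inj₁ high      = ≤-trans (decomposed-≤ l H (m≤n+m _ (suc k)) (decomposition l H free (m≤n+m _ (suc k)) high))
    (m≤m+n (2 * (suc m * suc m * suc m) + 3 * l * (suc m * suc m)) _)
... | inj₂ (v , low) = excess-step (slack l) l m {e = edges₆ H} {e′ = edges₆ (delete H v)}
    {x = 9 * (threshold l * threshold l * threshold l) ∸ k} {y = 9 * (threshold l * threshold l * threshold l) ∸ suc k} {{>-nonZero (≤-trans (s≤s z≤n) (200≤slack l))}} big (lowDegree-step l H v low)
    (excess l k m refl (delete H v) (delete-free H v free)) (shrink (9 * (threshold l * threshold l * threshold l)) k)
  where
  shrink : ∀ a k → a ∸ k ≤ suc (a ∸ suc k)
  shrink zero    zero    = z≤n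
  shrink zero    (suc k) = z≤n
  shrink (suc a) zero    = ≤-refl
  shrink (suc a) (suc k) = shrink a k
  big : 6 * slack l ≤ m
  big = ≤-trans (≤-trans (*-monoˡ-≤ (slack l) (m≤m+n 6 94)) (threshold-≥₁ l)) (m≤n+m _ k)

-- The extremal construction

Sum : ℕ → ℕ → Set
Sum a b = Fin a ⊎ Fin b

∑⊎ : ∀ {a b} → (Sum a b → ℕ) → ℕ
∑⊎ f = ∑ (λ i → f (inj₁ i)) + ∑ (λ j → f (inj₂ j))

∑-splitAt : ∀ a {b} (f : Sum a b → ℕ) → ∑ (λ w → f (splitAt a w)) ≡ ∑⊎ f
∑-splitAt a {b} f = trans (∑-↑ a (λ w → f (splitAt a w)))
  (cong₂ _+_ (∑-cong λ i → cong f (splitAt-↑ˡ a i b)) (∑-cong λ j → cong f (splitAt-↑ʳ a b j)))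

record SumGraph (a b : ℕ) : Set where
  field
    adj    : Sum a b → Sum a b → Sum a b → Bool
    adj₁₂  : ∀ x y z → adj x y z ≡ adj y x z
    adj₂₃  : ∀ x y z → adj x y z ≡ adj x z y
    adj-xx : ∀ x z → adj x x z ≡ false

  graph : Graph3 (a + b)
  graph = record
    { edge   = λ u v w → adj (splitAt a u) (splitAt a v) (splitAt a w)
    ; swap₁₂ = λ u v w → adj₁₂ (splitAt a u) (splitAt a v) (splitAt a w)
    ; swap₂₃ = λ u v w → adj₂₃ (splitAt a u) (splitAt a v) (splitAt a w)
    ; noLoop = λ u w → adj-xx (splitAt a u) (splitAt a w)
    }

  graph-codeg : ∀ u v → codeg graph u v ≡ ∑⊎ (λ z → ⟦ adj (splitAt a u) (splitAt a v) z ⟧)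
  graph-codeg u v = trans (codeg-∑ graph u v) (∑-splitAt a λ z → ⟦ adj (splitAt a u) (splitAt a v) z ⟧)

  graph-edges : edges₆ graph ≡ ∑⊎ (λ x → ∑⊎ λ y → ∑⊎ λ z → ⟦ adj x y z ⟧)
  graph-edges = trans (∑∑-cong λ u v → ∑-splitAt a λ z → ⟦ adj (splitAt a u) (splitAt a v) z ⟧)
    (trans (∑-cong λ u → ∑-splitAt a λ y → ∑⊎ λ z → ⟦ adj (splitAt a u) y z ⟧)
           (∑-splitAt a λ x → ∑⊎ λ y → ∑⊎ λ z → ⟦ adj x y z ⟧))

module DisjointUnion {a b} (G : Graph3 a) (H : Graph3 b) where

  sumGraph : SumGraph a b
  sumGraph = record
    { adj = adj
    ; adj₁₂ = λ where
        (inj₁ x) (inj₁ y) (inj₁ z) → swap₁₂ G x y z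
        (inj₁ x) (inj₁ y) (inj₂ z) → refl
        (inj₁ x) (inj₂ y) (inj₁ z) → refl
        (inj₁ x) (inj₂ y) (inj₂ z) → refl
        (inj₂ x) (inj₁ y) (inj₁ z) → refl
        (inj₂ x) (inj₁ y) (inj₂ z) → refl
        (inj₂ x) (inj₂ y) (inj₁ z) → refl
        (inj₂ x) (inj₂ y) (inj₂ z) → swap₁₂ H x y z
    ; adj₂₃ = λ where
        (inj₁ x) (inj₁ y) (inj₁ z) → swap₂₃ G x y z
        (inj₁ x) (inj₁ y) (inj₂ z) → refl
        (inj₁ x) (inj₂ y) (inj₁ z) → refl
        (inj₁ x) (inj₂ y) (inj₂ z) → refl
        (inj₂ x) (inj₁ y) (inj₁ z) → refl
        (inj₂ x) (inj₁ y) (inj₂ z) → refl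
        (inj₂ x) (inj₂ y) (inj₁ z) → refl
        (inj₂ x) (inj₂ y) (inj₂ z) → swap₂₃ H x y z
    ; adj-xx = λ where
        (inj₁ x) (inj₁ z) → noLoop G x z
        (inj₁ x) (inj₂ z) → refl
        (inj₂ x) (inj₁ z) → refl
        (inj₂ x) (inj₂ z) → noLoop H x z
    }
    where
    adj : Sum a b → Sum a b → Sum a b → Bool
    adj (inj₁ x) (inj₁ y) (inj₁ z) = edge G x y z
    adj (inj₁ x) (inj₁ y) (inj₂ z) = false
    adj (inj₁ x) (inj₂ y) _        = false
    adj (inj₂ x) (inj₁ y) _        = false
    adj (inj₂ x) (inj₂ y) (inj₁ z) = false
    adj (inj₂ x) (inj₂ y) (inj₂ z) = edge H x y z

  open SumGraph sumGraph

  union : Graph3 (a + b)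
  union = graph

  union-codeg : ∀ {t} → (∀ x y → codeg G x y < t) → (∀ x y → codeg H x y < t) → 0 < t → ∀ u v → codeg union u v < t
  union-codeg {t} g h 0<t u v rewrite graph-codeg u v with splitAt a u | splitAt a v
  ... | inj₁ x | inj₁ y rewrite ∑-zero {b} {λ _ → 0} (λ _ → refl) | +-identityʳ (∑ (χ G x y)) | sym (codeg-∑ G x y) = g x y
  ... | inj₁ x | inj₂ y rewrite ∑-zero {a} {λ _ → 0} (λ _ → refl) | ∑-zero {b} {λ _ → 0} (λ _ → refl) = 0<t
  ... | inj₂ x | inj₁ y rewrite ∑-zero {a} {λ _ → 0} (λ _ → refl) | ∑-zero {b} {λ _ → 0} (λ _ → refl) = 0<t
  ... | inj₂ x | inj₂ y rewrite ∑-zero {a} {λ _ → 0} (λ _ → refl) | sym (codeg-∑ H x y) = h x y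

  union-edges : edges₆ union ≡ edges₆ G + edges₆ H
  union-edges = trans graph-edges (cong₂ _+_ (∑-cong first) (∑-cong second))
    where
    zero-row : ∀ {m} → ∑ {m} (λ _ → 0) ≡ 0
    zero-row = ∑-zero λ _ → refl
    first : ∀ x → ∑⊎ (λ y → ∑⊎ λ z → ⟦ adj (inj₁ x) y z ⟧) ≡ ∑∑ (χ G x)
    first x = trans (cong₂ _+_ (∑-cong λ y → trans (cong (∑ (χ G x y) +_) zero-row) (+-identityʳ _))
                               (∑-zero λ y → cong₂ _+_ zero-row zero-row)) (+-identityʳ _)
    second : ∀ x → ∑⊎ (λ y → ∑⊎ λ z → ⟦ adj (inj₂ x) y z ⟧) ≡ ∑∑ (χ H x)
    second x = cong₂ _+_ (∑-zero λ y → cong₂ _+_ zero-row zero-row) (∑-cong λ y → cong (_+ ∑ (χ H x y)) zero-row)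

injection-≤ : ∀ {t n} (P : Fin n → Bool) (h : Fin t → Fin n) → (∀ i j → h i ≡ h j → i ≡ j) → (∀ i → P (h i) ≡ true) → t ≤ ∑ (λ x → ⟦ P x ⟧)
injection-≤ {t} P h inj holds = begin
  t                                       ≡⟨ trans (∑-const t 1) (*-identityʳ t) ⟨
  ∑ {t} (λ _ → 1)                         ≡⟨ ∑-cong (λ i → sym (∑-point₁ (h i))) ⟩
  ∑ (λ i → ∑ λ x → ⟦ h i == x ⟧)          ≡⟨ ∑-swap _ ⟩
  ∑ (λ x → ∑ λ i → ⟦ h i == x ⟧)          ≤⟨ ∑-mono fibre ⟩
  ∑ (λ x → ⟦ P x ⟧)                       ∎
  where
  open ≤-Reasoning
  fibre : ∀ x → ∑ (λ i → ⟦ h i == x ⟧) ≤ ⟦ P x ⟧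
  fibre x with P x in eq
  ... | true  = ∑⟦⟧≤1 (λ i → h i == x) λ i j p q → inj i j (trans (==⇒≡ {i = h i} p) (sym (==⇒≡ {i = h j} q)))
  ... | false = ≤-reflexive (∑-zero λ i → cong ⟦_⟧ (≢⇒== {i = h i} {x} λ { refl → case trans (sym (holds i)) eq of λ () }))

module Join {n} (π : Fin n → Fin 3) (U : Graph3 n) (mono : ∀ {u v w} → edge U u v w ≡ true → π u ≡ π v) where

  private
    Γ : Fin n → Fin n → Fin n → Bool
    Γ u v w = rainbow (π u) (π v) (π w)

  joined : Graph3 n
  joined = record
    { edge   = λ u v w → Γ u v w ∨ edge U u v w
    ; swap₁₂ = λ u v w → cong₂ _∨_ (rainbow-swap (π u) (π v) (π w)) (swap₁₂ U u v w)
    ; swap₂₃ = λ u v w → cong₂ _∨_ (rainbow-swap₂₃ (π u) (π v) (π w)) (swap₂₃ U u v w)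
    ; noLoop = λ u w → cong₂ _∨_ {u = edge U u u w} (cong (λ b → not b ∧ (not (π u == π w) ∧ not (π u == π w))) (==-refl (π u))) (noLoop U u w)
    }
    where
    rainbow-swap₂₃ : ∀ x y z → rainbow x y z ≡ rainbow x z y
    rainbow-swap₂₃ = from-yes (all? λ (x : Fin 3) → all? λ (y : Fin 3) → all? λ (z : Fin 3) → rainbow x y z Boolₚ.≟ rainbow x z y)

  private
    rainbow⇒≢ : ∀ x y z → rainbow x y z ≡ true → x ≢ y
    rainbow⇒≢ x y z r refl rewrite ==-refl x = case r of λ ()

    in-U : ∀ {u v w} → edge joined u v w ≡ true → π u ≡ π v → edge U u v w ≡ true
    in-U {u} {v} {w} e eq rewrite eq | ==-refl (π v) = e

    in-Γ : ∀ {u v w} → edge joined u v w ≡ true → π u ≢ π v → Γ u v w ≡ true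
    in-Γ {u} {v} {w} e ne with Γ u v w
    ... | true  = refl
    ... | false = ⊥-elim (ne (mono e))

    T⇒≡ : ∀ {b} → T b → b ≡ true
    T⇒≡ {true} _ = refl

    too-many : ∀ {t} → (∀ u v → codeg U u v < t) → ∀ u v (h : Fin t → Fin n) → (∀ i j → h i ≡ h j → i ≡ j) →
      (∀ i → edge U u v (h i) ≡ true) → ⊥
    too-many small u v h inj e = <⇒≱ (small u v) (≤-trans (injection-≤ (edge U u v) h inj e) (≤-reflexive (sym (codeg-∑ U u v))))

  joined-free : ∀ {t} → (∀ u v → codeg U u v < t) → Free t joined
  joined-free {t} small (f₁ , f₂ , f₄ , f₅ , h , _ , _ , _ , _ , _ , _ , inj , _ , e , es) = go (π f₁ ≟ π f₂)
    where
    unique : ∀ x y z w → rainbow x y z ≡ true → rainbow x y w ≡ true → z ≡ w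
    unique x y z w r s with rainbow-third x y z | rainbow-third x y w
    ... | inj₁ eq | _       = ⊥-elim (rainbow⇒≢ x y z r eq)
    ... | inj₂ _  | inj₁ eq = ⊥-elim (rainbow⇒≢ x y z r eq)
    ... | inj₂ p  | inj₂ q  = trans (sym (==⇒≡ {i = third x y} (trans (sym p) r))) (==⇒≡ {i = third x y} (trans (sym q) s))
    e₁ : ∀ i → edge joined f₁ f₂ (h i) ≡ true
    e₁ i = T⇒≡ (proj₁ (es i))
    e₂ : ∀ i → edge joined (h i) f₄ f₅ ≡ true
    e₂ i = T⇒≡ (proj₂ (es i))
    e₀ : edge joined f₁ f₂ f₄ ≡ true
    e₀ = T⇒≡ e
    go : Dec (π f₁ ≡ π f₂) → ⊥
    go (yes same)  = too-many small f₁ f₂ h (λ _ _ → inj) λ i → in-U (e₁ i) same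
    go (no differ) = too-many small f₄ f₅ h (λ _ _ → inj) λ i →
      trans (edge-rotate U f₄ f₅ (h i)) (trans (edge-rotate U f₅ (h i) f₄) (in-U (e₂ i)
        (unique (π f₁) (π f₂) (π (h i)) (π f₄) (in-Γ {w = h i} (e₁ i) differ) (in-Γ {w = f₄} e₀ differ))))

  open Coloured π

  joined-edges : edges₆ joined ≡ 6 * (partSize 0F * partSize 1F * partSize 2F) + edges₆ U
  joined-edges = trans (∑³-cong pointwise) (trans (∑³-+ _ _) (cong (_+ edges₆ U) rainbowTriples))
    where
    pointwise : ∀ a b c → χ joined a b c ≡ ⟦ Γ a b c ⟧ + χ U a b c
    pointwise a b c with edge U a b c in e
    ... | false with Γ a b c
    ...   | true  = refl
    ...   | false = refl
    pointwise a b c | true rewrite mono e | ==-refl (π b) = refl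

module ThreeParts {s₀ s₁ s₂} (G₀ : Graph3 s₀) (G₁ : Graph3 s₁) (G₂ : Graph3 s₂) where

  private
    open DisjointUnion G₁ G₂ using () renaming (union to U₁₂; union-codeg to codeg₁₂; union-edges to edges₁₂)
    open DisjointUnion G₀ U₁₂ using (union; union-codeg; union-edges)
    last : Sum s₁ s₂ → Fin 3
    last (inj₁ _) = 1F
    last (inj₂ _) = 2F
    colour : Sum s₀ (s₁ + s₂) → Fin 3
    colour (inj₁ _) = 0F
    colour (inj₂ y) = last (splitAt s₁ y)
    π : Fin (s₀ + (s₁ + s₂)) → Fin 3
    π v = colour (splitAt s₀ v)
    mono₁₂ : ∀ u v w → edge U₁₂ u v w ≡ true → last (splitAt s₁ u) ≡ last (splitAt s₁ v)
    mono₁₂ u v w e with splitAt s₁ u | splitAt s₁ v | splitAt s₁ w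
    ... | inj₁ _ | inj₁ _ | _ = refl
    ... | inj₂ _ | inj₂ _ | _ = refl
    mono : ∀ {u v w} → edge union u v w ≡ true → π u ≡ π v
    mono {u} {v} {w} e with splitAt s₀ u | splitAt s₀ v | splitAt s₀ w
    ... | inj₁ _ | inj₁ _ | _      = refl
    ... | inj₂ x | inj₂ y | inj₂ z = mono₁₂ x y z e
    open Join π union mono
    open Coloured π
    count : ∀ i → partSize i ≡ ∑⊎ (λ x → ⟦ i == colour x ⟧)
    count i = ∑-splitAt s₀ λ x → ⟦ i == colour x ⟧
    ones : ∀ m → ∑ {m} (λ _ → 1) ≡ m
    ones m = trans (∑-const m 1) (*-identityʳ m)
    zeros : ∀ m → ∑ {m} (λ _ → 0) ≡ 0
    zeros m = ∑-zero λ _ → refl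
    part₀-size : partSize 0F ≡ s₀
    part₀-size = trans (count 0F) (trans (cong₂ _+_ (ones s₀) (trans (∑-splitAt s₁ λ y → ⟦ 0F == last y ⟧) (cong₂ _+_ (zeros s₁) (zeros s₂)))) (+-identityʳ s₀))
    part₁-size : partSize 1F ≡ s₁
    part₁-size = trans (count 1F) (cong₂ _+_ (zeros s₀) (trans (∑-splitAt s₁ λ y → ⟦ 1F == last y ⟧) (trans (cong₂ _+_ (ones s₁) (zeros s₂)) (+-identityʳ s₁))))
    part₂-size : partSize 2F ≡ s₂
    part₂-size = trans (count 2F) (cong₂ _+_ (zeros s₀) (trans (∑-splitAt s₁ λ y → ⟦ 2F == last y ⟧) (cong₂ _+_ (zeros s₁) (ones s₂))))

  threeParts : ∀ {t} → 0 < t → (∀ a b → codeg G₀ a b < t) → (∀ a b → codeg G₁ a b < t) → (∀ a b → codeg G₂ a b < t) →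
    Σ (Graph3 (s₀ + (s₁ + s₂))) λ H → Free t H × edges₆ H ≡ 6 * (s₀ * s₁ * s₂) + (edges₆ G₀ + (edges₆ G₁ + edges₆ G₂))
  threeParts 0<t c₀ c₁ c₂ = joined , joined-free (union-codeg c₀ (codeg₁₂ c₁ c₂ 0<t) 0<t) ,
    trans joined-edges (cong₂ _+_ (cong (6 *_) (cong₂ _*_ (cong₂ _*_ part₀-size part₁-size) part₂-size)) (trans union-edges (cong (edges₆ G₀ +_) edges₁₂)))

-- Dense packings

module _ {A : Set} where

  total : (A → ℕ) → List A → ℕ
  total f []       = 0
  total f (x ∷ xs) = f x + total f xs

  total-mono : ∀ {f g : A → ℕ} xs → (∀ x → f x ≤ g x) → total f xs ≤ total g xs
  total-mono []       le = z≤n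
  total-mono (x ∷ xs) le = +-mono-≤ (le x) (total-mono xs le)

  total-≤-length : ∀ {f : A → ℕ} xs → (∀ x → f x ≤ 1) → total f xs ≤ length xs
  total-≤-length []       le = z≤n
  total-≤-length (x ∷ xs) le = +-mono-≤ (le x) (total-≤-length xs le)

  total-+ : ∀ (f g : A → ℕ) xs → total (λ x → f x + g x) xs ≡ total f xs + total g xs
  total-+ f g []       = refl
  total-+ f g (x ∷ xs) = trans (cong (f x + g x +_) (total-+ f g xs)) (arith (f x) (g x) (total f xs) (total g xs))
    where
    arith : ∀ a b c d → a + b + (c + d) ≡ a + c + (b + d)
    arith = solve-∀

  total-const : ∀ k (xs : List A) → total (λ _ → k) xs ≡ length xs * k
  total-const k []       = refl
  total-const k (x ∷ xs) = cong (k +_) (total-const k xs)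

  ∑-total : ∀ {n} (f : A → Fin n → ℕ) xs → ∑ (λ i → total (λ x → f x i) xs) ≡ total (λ x → ∑ (f x)) xs
  ∑-total f []       = ∑-zero λ _ → refl
  ∑-total f (x ∷ xs) = trans (∑-+ (f x) _) (cong (∑ (f x) +_) (∑-total f xs))

  any-≤ : ∀ (p : A → Bool) xs → ⟦ any p xs ⟧ ≤ total (λ x → ⟦ p x ⟧) xs
  any-≤ p []       = z≤n
  any-≤ p (x ∷ xs) with p x
  ... | true  = s≤s z≤n
  ... | false = any-≤ p xs

  any-elim : ∀ (p : A → Bool) xs → any p xs ≡ true → ∃ λ x → p x ≡ true
  any-elim p (x ∷ xs) e with p x in px
  ... | true  = x , px
  ... | false = any-elim p xs e

  any-exclusive : ∀ (p : A → Bool) {xs} → AllPairs (λ x y → p x ≡ true → p y ≡ true → ⊥) xs → total (λ x → ⟦ p x ⟧) xs ≤ ⟦ any p xs ⟧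
  any-exclusive p [] = z≤n
  any-exclusive p {x ∷ xs} (ps ∷ pss) with p x
  ... | false = any-exclusive p pss
  ... | true  = ≤-reflexive (cong suc (none xs ps))
    where
    none : ∀ xs → All (λ y → true ≡ true → p y ≡ true → ⊥) xs → total (λ x → ⟦ p x ⟧) xs ≡ 0
    none []       []       = refl
    none (y ∷ ys) (q ∷ qs) rewrite not-true (q refl) = none ys qs

does⇒ : ∀ {P : Set} (d : Dec P) → does d ≡ true → P
does⇒ (yes p) _ = p

multiple-unique-< : ∀ M k {i j s x y} → i < j → y < M → k + x ≡ i * M + s → k + y ≡ j * M + s → ⊥
multiple-unique-< M k {i} {j} {s} {x} {y} i<j y<M ex ey = <⇒≱ y<M (+-cancelˡ-≤ (k + x) M y (begin
  k + x + M         ≡⟨ cong (_+ M) ex ⟩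
  i * M + s + M     ≡⟨ arith i M s ⟩
  suc i * M + s     ≤⟨ +-monoˡ-≤ s (*-monoˡ-≤ M i<j) ⟩
  j * M + s         ≡⟨ ey ⟨
  k + y             ≤⟨ m≤m+n (k + y) x ⟩
  k + y + x         ≡⟨ swap k x y ⟩
  k + x + y         ∎))
  where
  open ≤-Reasoning
  arith : ∀ i M s → i * M + s + M ≡ suc i * M + s
  arith = solve-∀
  swap : ∀ k x y → k + y + x ≡ k + x + y
  swap = solve-∀

multiple-unique : ∀ M k {i j s x y} → x < M → y < M → k + x ≡ i * M + s → k + y ≡ j * M + s → x ≡ y
multiple-unique M k {i} {j} {s} {x} {y} x<M y<M ex ey with <-cmp i j
... | tri≈ _ refl _ = +-cancelˡ-≡ k x y (trans ex (sym ey))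
... | tri< i<j _ _  = ⊥-elim (multiple-unique-< M k i<j y<M ex ey)
... | tri> _ _ j<i  = ⊥-elim (multiple-unique-< M k j<i x<M ey ex)


residue-unique : ∀ M {i j s t} → s < M → t < M → i * M + s ≡ j * M + t → s ≡ t
residue-unique M {i} {j} {s} {t} s<M t<M eq with <-cmp i j
... | tri≈ _ refl _ = +-cancelˡ-≡ (i * M) s t eq
... | tri< i<j _ _  = ⊥-elim (<⇒≱ s<M (too-big i<j eq))
  where
  too-big : ∀ {i j s t} → i < j → i * M + s ≡ j * M + t → M ≤ s
  too-big {i} {j} {s} {t} i<j eq = +-cancelˡ-≤ (i * M) M s (≤-trans (≤-reflexive (+-comm (i * M) M))
    (≤-trans (*-monoˡ-≤ M i<j) (≤-trans (m≤m+n (j * M) t) (≤-reflexive (sym eq)))))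
... | tri> _ _ j<i  = ⊥-elim (<⇒≱ t<M (+-cancelˡ-≤ (j * M) M t (≤-trans (≤-reflexive (+-comm (j * M) M))
    (≤-trans (*-monoˡ-≤ M j<i) (≤-trans (m≤m+n (i * M) s) (≤-reflexive eq))))))

Zone : Set
Zone = Fin 4

-- The zones cut [0 , 6 m) into four intervals, in units of m; a doubled point a in zone z is joined to the
-- point b with 2 a + b = wraps z * M + s.
start width wraps : Zone → ℕ
start 0F                   = 0
start 1F             = 2
start 2F       = 3
start 3F = 4
width 0F                   = 2
width 1F             = 1
width 2F       = 1
width 3F = 2
wraps 0F                   = 1
wraps 1F             = 1
wraps 2F       = 2
wraps 3F = 2

module Design (c₀ m r : ℕ) (r≤5 : r ≤ 5) (m-large : c₀ + 6 ≤ m) where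

  C M : ℕ
  C = c₀ + 6
  M = 6 * m + r

  InZone : Zone → ℕ → Set
  InZone z a = start z * m + C ≤ a × a + C < (start z + width z) * m

  in-zone? : ∀ z a → Dec (InZone z a)
  in-zone? z a = (start z * m + C ≤? a) ×-dec (a + C <? (start z + width z) * m)

  zone-order : ∀ {z z′ a b} → InZone z a → InZone z′ b → start z + width z ≤ start z′ → a < b
  zone-order {z} {z′} {a} {b} (_ , a<) (b≥ , _) le = ≤-trans (s≤s (m≤m+n a C)) (≤-trans a< (≤-trans (*-monoˡ-≤ m le) (≤-trans (m≤m+n _ C) b≥)))

  zone-unique : ∀ {z z′ a} → InZone z a → InZone z′ a → z ≡ z′
  zone-unique {z} {z′} {a} p q with separated z z′
    where
    separated : ∀ z z′ → (z ≡ z′ ⊎ start z + width z ≤ start z′) ⊎ start z′ + width z′ ≤ start z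
    separated = from-yes (all? λ (z : Zone) → all? λ (z′ : Zone) →
      ((z ≟ z′) ⊎-dec (start z + width z ≤? start z′)) ⊎-dec (start z′ + width z′ ≤? start z))
  ... | inj₁ (inj₁ eq) = eq
  ... | inj₁ (inj₂ le) = ⊥-elim (<-irrefl refl (zone-order {z} {z′} p q le))
  ... | inj₂ le        = ⊥-elim (<-irrefl refl (zone-order {z′} {z} q p le))

  record Colour : Set where
    field
      shift     : ℕ
      shift≤    : shift ≤ c₀
      gets      : Fin 2 → Zone → Bool
      exclusive : ∀ z → gets 0F z ∧ gets 1F z ≡ false
  open Colour public

  Doubled : ℕ → Zone → ℕ → ℕ → Set
  Doubled s z a b = InZone z a × 2 * a + b ≡ wraps z * M + s

  private
    2s+10<3C : ∀ {s} → s ≤ c₀ → 2 * s + 10 < 3 * C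
    2s+10<3C {s} s≤ = linear (c₀ + 7) (*-monoʳ-≤ 2 s≤) (arith s c₀)
      where
      arith : ∀ s c → suc (2 * s + 10) + 2 * c + (c + 7) ≡ 3 * (c + 6) + 2 * s
      arith = solve-∀

  no-return-same : ∀ {s s′ z a b} t → t ≤ 2 → s ≤ c₀ → s′ ≤ c₀ → start z ≡ 2 * t ⊎ start z + width z ≡ 2 * t → InZone z a →
    2 * a + b ≡ t * M + s → 2 * b + a ≡ t * M + s′ → ⊥
  no-return-same {s} {s′} {z} {a} {b} t t≤2 s≤ s′≤ end (lo , hi) e e′ = absurd end
    where
    3a : 3 * a + s′ ≡ t * M + 2 * s
    3a = +-cancelʳ-≡ (2 * b + a) _ _ (trans (r₁ a b s′) (trans (cong (λ x → x + x + s′) e) (trans (r₂ (t * M) s s′) (cong (t * M + 2 * s +_) (sym e′)))))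
      where
      r₁ : ∀ a b s → 3 * a + s + (2 * b + a) ≡ (2 * a + b) + (2 * a + b) + s
      r₁ = solve-∀
      r₂ : ∀ k s s′ → k + s + (k + s) + s′ ≡ k + 2 * s + (k + s′)
      r₂ = solve-∀
    arith₁ : ∀ t m r s s′ a C → 3 * C + (3 * a + (t * (6 * m + r) + 2 * s + 2 * 5)) + s′ ≡ 2 * s + 10 + (3 * (2 * t * m + C) + (3 * a + s′ + t * r))
    arith₁ = solve-∀
    arith₂ : ∀ t m r s s′ a C → 3 * C + (3 * (2 * t * m) + (3 * a + s′)) + (3 + 2 * s + t * r + s′ + 10) ≡ 2 * s′ + 10 + (3 * (suc a + C) + (t * (6 * m + r) + 2 * s))
    arith₂ = solve-∀
    absurd : start z ≡ 2 * t ⊎ start z + width z ≡ 2 * t → ⊥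
    absurd (inj₁ eq) = <⇒≱ (2s+10<3C s≤) (linear s′ (+-mono-≤ (*-monoʳ-≤ 3 (≤-trans (≤-reflexive (cong (λ k → k * m + C) (sym eq))) lo))
      (+-mono-≤ (≤-reflexive 3a) (*-mono-≤ t≤2 r≤5))) (arith₁ t m r s s′ a C))
    absurd (inj₂ eq) = <⇒≱ (2s+10<3C s′≤) (linear (3 + 2 * s + t * r + s′ + 10) (+-mono-≤ (*-monoʳ-≤ 3 (≤-trans hi (≤-reflexive (cong (_* m) eq))))
      (≤-reflexive (sym 3a))) (arith₂ t m r s s′ a C))

  private
    wraps-cases : ∀ z → wraps z ≡ 1 ⊎ wraps z ≡ 2
    wraps-cases = from-yes (all? λ (z : Zone) → (wraps z ℕₚ.≟ 1) ⊎-dec (wraps z ℕₚ.≟ 2))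

    turning : ∀ z → start z ≡ 2 * wraps z ⊎ start z + width z ≡ 2 * wraps z
    turning = from-yes (all? λ (z : Zone) → (start z ℕₚ.≟ 2 * wraps z) ⊎-dec (start z + width z ℕₚ.≟ 2 * wraps z))

    C≤zone : ∀ {z a} → InZone z a → C ≤ a
    C≤zone {z} (lo , _) = ≤-trans (m≤n+m C (start z * m)) lo

    no-return-mixed : ∀ {s s′ a b} → s ≤ c₀ → b < M → C ≤ a → 2 * a + b ≡ 1 * M + s → 2 * b + a ≡ 2 * M + s′ → ⊥
    no-return-mixed {s} {s′} {a} {b} s≤ b<M C≤a e e′ = <⇒≱ b<M (linear (s′ + 6) (+-mono-≤ (+-mono-≤ C≤a s≤) (+-mono-≤ (≤-reflexive e) (≤-reflexive (sym e′))))
      (arith M a b c₀ s s′))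
      where
      arith : ∀ M a b c s s′ → M + (a + c + (1 * M + s + (2 * b + a))) + (s′ + 6) ≡ b + (c + 6 + s + (2 * a + b + (2 * M + s′)))
      arith = solve-∀

  no-return : ∀ {s s′ z z′ a b} → s ≤ c₀ → s′ ≤ c₀ → a < M → b < M → Doubled s z a b → Doubled s′ z′ b a → ⊥
  no-return {z = z} {z′} s≤ s′≤ a<M b<M (p , e) (p′ , e′) with wraps-cases z | wraps-cases z′ | turning z
  ... | inj₁ w | inj₁ w′ | end rewrite w | w′ = no-return-same {z = z} 1 (s≤s z≤n) s≤ s′≤ end p e e′
  ... | inj₂ w | inj₂ w′ | end rewrite w | w′ = no-return-same {z = z} 2 ≤-refl s≤ s′≤ end p e e′
  ... | inj₁ w | inj₂ w′ | _   rewrite w | w′ = no-return-mixed s≤ b<M (C≤zone {z} p) e e′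
  ... | inj₂ w | inj₁ w′ | _   rewrite w | w′ = no-return-mixed s′≤ a<M (C≤zone {z′} p′) e′ e

  partner : ∀ {s z a} → s ≤ c₀ → InZone z a → ∃ λ b → b < M × 2 * a + b ≡ wraps z * M + s
  partner {s} {z} {a} s≤ (lo , hi) with m≤n⇒∃[o]m+o≡n below
    where
    upper : ∀ z → start z + width z ≤ 3 * wraps z
    upper = from-yes (all? λ (z : Zone) → start z + width z ≤? 3 * wraps z)
    below : 2 * a ≤ wraps z * M + s
    below = linear (2 * suc C + wraps z * r + s) (*-monoʳ-≤ 2 (≤-trans hi (*-monoˡ-≤ m (upper z)))) (arith a C (wraps z) m r s)
      where
      arith : ∀ a C w m r s → 2 * a + 2 * (3 * w * m) + (2 * suc C + w * r + s) ≡ w * (6 * m + r) + s + 2 * (suc a + C)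
      arith = solve-∀
  ... | b , e = b , +-cancelˡ-< (2 * a) b M (subst (_< 2 * a + M) (sym e) above) , e
    where
    lower : ∀ z → 3 * wraps z ≤ start z + 3
    lower = from-yes (all? λ (z : Zone) → 3 * wraps z ≤? start z + 3)
    bound : wraps z * r + s + 1 ≤ 2 * C + r
    bound with wraps z | wraps-cases z
    ... | _ | inj₁ refl = linear (c₀ + 11) s≤ (arith₁ s c₀ r)
      where
      arith₁ : ∀ s c r → 1 * r + s + 1 + c + (c + 11) ≡ 2 * (c + 6) + r + s
      arith₁ = solve-∀
    ... | _ | inj₂ refl = linear (c₀ + 6) (+-mono-≤ s≤ r≤5) (arith₂ s c₀ r)
      where
      arith₂ : ∀ s c r → 2 * r + s + 1 + (c + 5) + (c + 6) ≡ 2 * (c + 6) + r + (s + r)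
      arith₂ = solve-∀
    above : wraps z * M + s < 2 * a + M
    above = linear 0 (+-mono-≤ (*-monoʳ-≤ 2 lo) (+-mono-≤ (*-monoʳ-≤ (2 * m) (lower z)) bound)) (arith (wraps z) m r s a C (start z))
      where
      arith : ∀ w m r s a C t → suc (w * (6 * m + r) + s) + (2 * a + (2 * m * (t + 3) + (2 * C + r))) + 0
        ≡ 2 * a + (6 * m + r) + (2 * (t * m + C) + (2 * m * (3 * w) + (w * r + s + 1)))
      arith = solve-∀

  Vertex : Set
  Vertex = Fin M

  residue : ℕ → ℕ → Bool
  residue s k = does (any? λ (i : Fin 3) → k ℕₚ.≟ toℕ i * M + s)

  R : ℕ → Vertex → Vertex → Vertex → Bool
  R s a b c = residue s (toℕ a + toℕ b + toℕ c)

  R-elim : ∀ s a b c → R s a b c ≡ true → ∃ λ i → toℕ a + toℕ b + toℕ c ≡ i * M + s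
  R-elim s a b c e with does⇒ (any? λ (i : Fin 3) → toℕ a + toℕ b + toℕ c ℕₚ.≟ toℕ i * M + s) e
  ... | i , eq = toℕ i , eq

  R-intro : ∀ s a b c (i : Fin 3) → toℕ a + toℕ b + toℕ c ≡ toℕ i * M + s → R s a b c ≡ true
  R-intro s a b c i eq = dec-true (any? λ (i : Fin 3) → toℕ a + toℕ b + toℕ c ℕₚ.≟ toℕ i * M + s) (i , eq)

  Joins : Colour → Fin 2 → Vertex → Vertex → Set
  Joins col ε a b = ∃ λ z → gets col ε z ≡ true × Doubled (shift col) z (toℕ a) (toℕ b)

  joins? : ∀ col ε a b → Dec (Joins col ε a b)
  joins? col ε a b = any? λ z → (gets col ε z Boolₚ.≟ true) ×-dec (in-zone? z (toℕ a) ×-dec (2 * toℕ a + toℕ b ℕₚ.≟ wraps z * M + shift col))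

  W : Colour → Fin 2 → Vertex → Vertex → Bool
  W col ε a b = does (joins? col ε a b)

  W-elim : ∀ col ε a b → W col ε a b ≡ true → Joins col ε a b
  W-elim col ε a b = does⇒ (joins? col ε a b)

  W-asym : ∀ col col′ ε ε′ a b → W col ε a b ≡ true → W col′ ε′ b a ≡ true → ⊥
  W-asym col col′ ε ε′ a b w w′ with W-elim col ε a b w | W-elim col′ ε′ b a w′
  ... | z , _ , d | z′ , _ , d′ = no-return {z = z} {z′} (shift≤ col) (shift≤ col′) (toℕ<n a) (toℕ<n b) d d′

  W-shift : ∀ col col′ ε ε′ a b → W col ε a b ≡ true → W col′ ε′ a b ≡ true → shift col ≡ shift col′
  W-shift col col′ ε ε′ a b w w′ with W-elim col ε a b w | W-elim col′ ε′ a b w′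
  ... | z , _ , p , e | z′ , _ , p′ , e′ with zone-unique {z} {z′} p p′
  ...   | refl = +-cancelˡ-≡ (wraps z * M) _ _ (trans (sym e) e′)

  W-apex : ∀ col ε ε′ a b → W col ε a b ≡ true → W col ε′ a b ≡ true → ε ≡ ε′
  W-apex col ε ε′ a b w w′ with W-elim col ε a b w | W-elim col ε′ a b w′
  ... | z , g , p , e | z′ , g′ , p′ , e′ with zone-unique {z} {z′} p p′
  W-apex col 0F       0F       a b _ _ | z , g , _ | .z , g′ , _ | refl = refl
  W-apex col 1F 1F a b _ _ | z , g , _ | .z , g′ , _ | refl = refl
  W-apex col 0F       1F a b _ _ | z , g , _ | .z , g′ , _ | refl = case trans (sym (exclusive col z)) (∧-intro g g′) of λ ()
  W-apex col 1F 0F       a b _ _ | z , g , _ | .z , g′ , _ | refl = case trans (sym (exclusive col z)) (∧-intro g′ g) of λ ()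

  W-end : ∀ col ε a b → W col ε a b ≡ true → ∃ λ i → toℕ a + toℕ b + toℕ a ≡ i * M + shift col
  W-end col ε a b w with W-elim col ε a b w
  ... | z , _ , _ , e = wraps z , trans (arith (toℕ a) (toℕ b)) e
    where
    arith : ∀ a b → a + b + a ≡ 2 * a + b
    arith = solve-∀

  distinct : Vertex → Vertex → Vertex → Bool
  distinct a b c = not (a == b) ∧ (not (b == c) ∧ not (a == c))

  apex : Colour → Fin 2 → Vertex → Vertex → Bool
  apex col ε a b = W col ε a b ∨ W col ε b a

  apex-elim : ∀ col ε a b → apex col ε a b ≡ true → W col ε a b ≡ true ⊎ W col ε b a ≡ true
  apex-elim col ε a b e with W col ε a b
  ... | true  = inj₁ refl
  ... | false = inj₂ e

  apex-irreflexive : ∀ col ε a → apex col ε a a ≡ false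
  apex-irreflexive col ε a with W col ε a a in eq
  ... | true  = ⊥-elim (W-asym col col ε ε a a eq eq)
  ... | false = refl

  module Packing (cs : List Colour) where

    triple : Vertex → Vertex → Vertex → Bool
    triple a b c = distinct a b c ∧ any (λ col → R (shift col) a b c) cs

    apexPair : Fin 2 → Vertex → Vertex → Bool
    apexPair ε a b = any (λ col → apex col ε a b) cs

    private
      any-cong : ∀ {p q : Colour → Bool} xs → (∀ x → p x ≡ q x) → any p xs ≡ any q xs
      any-cong []       e = refl
      any-cong (x ∷ xs) e = cong₂ _∨_ (e x) (any-cong xs e)

      triple₁₂ : ∀ a b c → triple a b c ≡ triple b a c
      triple₁₂ a b c = cong₂ _∧_ (cong₂ _∧_ (cong not (==-sym a b)) (Boolₚ.∧-comm (not (b == c)) (not (a == c))))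
        (any-cong cs λ col → cong (residue (shift col)) (cong (_+ toℕ c) (+-comm (toℕ a) (toℕ b))))

      triple₂₃ : ∀ a b c → triple a b c ≡ triple a c b
      triple₂₃ a b c = cong₂ _∧_ (trans (perm (not (a == b)) (not (b == c)) (not (a == c))) (cong (λ x → not (a == c) ∧ (not x ∧ not (a == b))) (==-sym b c)))
        (any-cong cs λ col → cong (residue (shift col)) (arith (toℕ a) (toℕ b) (toℕ c)))
        where
        perm : ∀ x y z → x ∧ (y ∧ z) ≡ z ∧ (y ∧ x)
        perm true  y     z     = trans (Boolₚ.∧-comm y z) (cong (z ∧_) (sym (Boolₚ.∧-identityʳ y)))
        perm false true  true  = refl
        perm false true  false = refl
        perm false false true  = refl
        perm false false false = refl
        arith : ∀ a b c → a + b + c ≡ a + c + b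
        arith = solve-∀

      apexPair-sym : ∀ ε a b → apexPair ε a b ≡ apexPair ε b a
      apexPair-sym ε a b = any-cong cs λ col → Boolₚ.∨-comm (W col ε a b) (W col ε b a)

      apexPair-irreflexive : ∀ ε a → apexPair ε a a ≡ false
      apexPair-irreflexive ε a = trans (any-cong cs λ col → apex-irreflexive col ε a) (none cs)
        where
        none : ∀ (xs : List Colour) → any (λ _ → false) xs ≡ false
        none []       = refl
        none (x ∷ xs) = none xs

      adj : Sum 2 M → Sum 2 M → Sum 2 M → Bool
      adj (inj₁ ε) (inj₁ _) _        = false
      adj (inj₁ ε) (inj₂ a) (inj₁ _) = false
      adj (inj₁ ε) (inj₂ a) (inj₂ b) = apexPair ε a b
      adj (inj₂ a) (inj₁ ε) (inj₁ _) = false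
      adj (inj₂ a) (inj₁ ε) (inj₂ b) = apexPair ε a b
      adj (inj₂ a) (inj₂ b) (inj₁ ε) = apexPair ε a b
      adj (inj₂ a) (inj₂ b) (inj₂ c) = triple a b c

    sumGraph : SumGraph 2 M
    sumGraph = record
      { adj = adj
      ; adj₁₂ = λ where
          (inj₁ x) (inj₁ y) z        → refl
          (inj₁ x) (inj₂ y) (inj₁ z) → refl
          (inj₁ x) (inj₂ y) (inj₂ z) → refl
          (inj₂ x) (inj₁ y) (inj₁ z) → refl
          (inj₂ x) (inj₁ y) (inj₂ z) → refl
          (inj₂ x) (inj₂ y) (inj₁ z) → apexPair-sym z x y
          (inj₂ x) (inj₂ y) (inj₂ z) → triple₁₂ x y z
      ; adj₂₃ = λ where
          (inj₁ x) (inj₁ y) (inj₁ z) → refl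
          (inj₁ x) (inj₁ y) (inj₂ z) → refl
          (inj₁ x) (inj₂ y) (inj₁ z) → refl
          (inj₁ x) (inj₂ y) (inj₂ z) → apexPair-sym x y z
          (inj₂ x) (inj₁ y) (inj₁ z) → refl
          (inj₂ x) (inj₁ y) (inj₂ z) → refl
          (inj₂ x) (inj₂ y) (inj₁ z) → refl
          (inj₂ x) (inj₂ y) (inj₂ z) → triple₂₃ x y z
      ; adj-xx = λ where
          (inj₁ x) z        → refl
          (inj₂ x) (inj₁ z) → apexPair-irreflexive z x
          (inj₂ x) (inj₂ z) → cong (λ b → (not b ∧ (not (x == z) ∧ not (x == z))) ∧ any (λ col → R (shift col) x x z) cs) (==-refl x)
      }

    open SumGraph sumGraph using (graph; graph-codeg; graph-edges)

    packing : Graph3 (2 + M)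
    packing = graph

    private
      through : Colour → Vertex → Vertex → Sum 2 M → Bool
      through col a b (inj₁ ε) = apex col ε a b
      through col a b (inj₂ c) = distinct a b c ∧ R (shift col) a b c

      apex-end : ∀ col ε a b → apex col ε a b ≡ true → ∀ c → R (shift col) a b c ≡ true → c ≡ a ⊎ c ≡ b
      apex-end col ε a b w c r with apex-elim col ε a b w | R-elim (shift col) a b c r
      ... | inj₁ w′ | i , e with W-end col ε a b w′
      ...   | j , e′ = inj₁ (toℕ-injective (multiple-unique M (toℕ a + toℕ b) {i} {j} (toℕ<n c) (toℕ<n a) e e′))
      apex-end col ε a b w c r | inj₂ w′ | i , e with W-end col ε b a w′
      ...   | j , e′ = inj₂ (toℕ-injective (multiple-unique M (toℕ a + toℕ b) {i} {j} (toℕ<n c) (toℕ<n b) e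
                         (trans (cong (_+ toℕ b) (+-comm (toℕ a) (toℕ b))) e′)))

      distinct-ends : ∀ {a b c r} → distinct a b c ∧ r ≡ true → (c ≡ a ⊎ c ≡ b) → ⊥
      distinct-ends {a} {b} {c} d end with ∧-true {distinct a b c} d
      distinct-ends {a} {b} {c} _ (inj₁ refl) | d , _ rewrite ==-refl a with a == b | b == a
      ... | true  | _     = case d of λ ()
      ... | false | true  = case d of λ ()
      ... | false | false = case d of λ ()
      distinct-ends {a} {b} {c} _ (inj₂ refl) | d , _ rewrite ==-refl b with a == b
      ... | true  = case d of λ ()
      ... | false = case d of λ ()

      through-unique : ∀ col a b x y → through col a b x ≡ true → through col a b y ≡ true → x ≡ y
      through-unique col a b (inj₁ ε) (inj₁ ε′) p q with apex-elim col ε a b p | apex-elim col ε′ a b q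
      ... | inj₁ w | inj₁ w′ = cong inj₁ (W-apex col ε ε′ a b w w′)
      ... | inj₂ w | inj₂ w′ = cong inj₁ (W-apex col ε ε′ b a w w′)
      ... | inj₁ w | inj₂ w′ = ⊥-elim (W-asym col col ε ε′ a b w w′)
      ... | inj₂ w | inj₁ w′ = ⊥-elim (W-asym col col ε ε′ b a w w′)
      through-unique col a b (inj₁ ε) (inj₂ c) p q = ⊥-elim (distinct-ends q (apex-end col ε a b p c (proj₂ (∧-true {distinct a b c} q))))
      through-unique col a b (inj₂ c) (inj₁ ε) p q = ⊥-elim (distinct-ends p (apex-end col ε a b q c (proj₂ (∧-true {distinct a b c} p))))
      through-unique col a b (inj₂ c) (inj₂ d) p q with R-elim (shift col) a b c (proj₂ (∧-true {distinct a b c} p)) | R-elim (shift col) a b d (proj₂ (∧-true {distinct a b d} q))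
      ... | i , e | j , e′ = cong inj₂ (toℕ-injective (multiple-unique M (toℕ a + toℕ b) {i} {j} (toℕ<n c) (toℕ<n d) e e′))

      through-≤1 : ∀ col a b → ∑⊎ (λ x → ⟦ through col a b x ⟧) ≤ 1
      through-≤1 col a b = ≤-trans (≤-reflexive (sym (∑-splitAt 2 λ x → ⟦ through col a b x ⟧)))
        (∑⟦⟧≤1 (λ w → through col a b (splitAt 2 w)) λ i j p q → splitAt-inj i j (through-unique col a b _ _ p q))
        where
        splitAt-inj : ∀ (i j : Fin (2 + M)) → splitAt 2 i ≡ splitAt 2 j → i ≡ j
        splitAt-inj i j e = trans (sym (join-splitAt 2 M i)) (trans (cong (join 2 M) e) (join-splitAt 2 M j))

      base-codeg : ∀ a b → ∑⊎ (λ z → ⟦ adj (inj₂ a) (inj₂ b) z ⟧) ≤ length cs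
      base-codeg a b = begin
        ∑ (λ ε → ⟦ apexPair ε a b ⟧) + ∑ (λ c → ⟦ triple a b c ⟧)
          ≤⟨ +-mono-≤ (∑-mono λ ε → any-≤ (λ col → apex col ε a b) cs) (∑-mono λ c → triple-≤ c) ⟩
        ∑ (λ ε → total (λ col → ⟦ apex col ε a b ⟧) cs) + ∑ (λ c → total (λ col → ⟦ distinct a b c ∧ R (shift col) a b c ⟧) cs)
          ≡⟨ cong₂ _+_ (∑-total (λ col ε → ⟦ apex col ε a b ⟧) cs) (∑-total (λ col c → ⟦ distinct a b c ∧ R (shift col) a b c ⟧) cs) ⟩
        total (λ col → ∑ (λ ε → ⟦ apex col ε a b ⟧)) cs + total (λ col → ∑ (λ c → ⟦ distinct a b c ∧ R (shift col) a b c ⟧)) cs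
          ≡⟨ total-+ _ _ cs ⟨
        total (λ col → ∑⊎ (λ x → ⟦ through col a b x ⟧)) cs
          ≤⟨ total-≤-length cs (λ col → through-≤1 col a b) ⟩
        length cs ∎
        where
        open ≤-Reasoning
        triple-≤ : ∀ c → ⟦ triple a b c ⟧ ≤ total (λ col → ⟦ distinct a b c ∧ R (shift col) a b c ⟧) cs
        triple-≤ c with distinct a b c
        ... | true  = any-≤ (λ col → R (shift col) a b c) cs
        ... | false = z≤n

    incidence : Colour → Fin 2 → Vertex → ℕ
    incidence col ε a = ∑ (λ b → ⟦ W col ε a b ⟧) + ∑ (λ b → ⟦ W col ε b a ⟧)

    private
      apex-codeg : (∀ ε a → total (λ col → incidence col ε a) cs ≤ length cs) → ∀ ε a → ∑ (λ b → ⟦ apexPair ε a b ⟧) ≤ length cs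
      apex-codeg capacity ε a = begin
        ∑ (λ b → ⟦ apexPair ε a b ⟧)
          ≤⟨ ∑-mono (λ b → any-≤ (λ col → apex col ε a b) cs) ⟩
        ∑ (λ b → total (λ col → ⟦ apex col ε a b ⟧) cs)
          ≡⟨ ∑-total (λ col b → ⟦ apex col ε a b ⟧) cs ⟩
        total (λ col → ∑ (λ b → ⟦ apex col ε a b ⟧)) cs
          ≤⟨ total-mono cs (λ col → ≤-trans (∑-mono λ b → ∨-≤ (W col ε a b) (W col ε b a)) (≤-reflexive (∑-+ _ _))) ⟩
        total (λ col → incidence col ε a) cs
          ≤⟨ capacity ε a ⟩
        length cs ∎
        where
        open ≤-Reasoning
        ∨-≤ : ∀ x y → ⟦ x ∨ y ⟧ ≤ ⟦ x ⟧ + ⟦ y ⟧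
        ∨-≤ true  y = s≤s z≤n
        ∨-≤ false y = ≤-refl

    packing-codeg : (∀ ε a → total (λ col → incidence col ε a) cs ≤ length cs) → ∀ u v → codeg packing u v < suc (length cs)
    packing-codeg capacity u v = s≤s (≤-trans (≤-reflexive (graph-codeg u v)) (bound (splitAt 2 u) (splitAt 2 v)))
      where
      bound : ∀ x y → ∑⊎ (λ z → ⟦ adj x y z ⟧) ≤ length cs
      bound (inj₁ x) (inj₁ y) = ≤-trans (≤-reflexive (cong₂ _+_ (∑-zero λ _ → refl) (∑-zero λ _ → refl))) z≤n
      bound (inj₁ x) (inj₂ y) = ≤-trans (≤-reflexive (cong (_+ ∑ (λ b → ⟦ apexPair x y b ⟧)) (∑-zero λ _ → refl))) (apex-codeg capacity x y)
      bound (inj₂ x) (inj₁ y) = ≤-trans (≤-reflexive (cong (_+ ∑ (λ b → ⟦ apexPair y x b ⟧)) (∑-zero λ _ → refl))) (apex-codeg capacity y x)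
      bound (inj₂ x) (inj₂ y) = base-codeg x y

    private
      c₀<M : c₀ < M
      c₀<M = ≤-trans (≤-trans (≤-trans (s≤s (m≤m+n c₀ 5)) (≤-reflexive (sym (+-suc c₀ 5)))) m-large) (≤-trans (m≤n*m m 6) (m≤m+n (6 * m) r))

      completes : ∀ s → s ≤ c₀ → ∀ (a b : Vertex) → ∃ λ c → R s a b c ≡ true
      completes s s≤ a b = find (k ≤? s) (k ≤? M + s)
        where
        k : ℕ
        k = toℕ a + toℕ b
        intro : ∀ (i : Fin 3) {c} (c<M : c < M) → k + c ≡ toℕ i * M + s → ∃ λ c → R s a b c ≡ true
        intro i c<M eq = fromℕ< c<M , R-intro s a b (fromℕ< c<M) i (trans (cong (k +_) (toℕ-fromℕ< c<M)) eq)
        find : Dec (k ≤ s) → Dec (k ≤ M + s) → ∃ λ c → R s a b c ≡ true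
        find (yes p) _ = intro 0F (≤-<-trans (m∸n≤m s k) (≤-<-trans s≤ c₀<M)) (m+[n∸m]≡n p)
        find (no ¬p) (yes q) = intro 1F (+-cancelˡ-< k _ M (subst (_< k + M) (sym (m+[n∸m]≡n q)) (≤-trans (+-monoʳ-< M (≰⇒> ¬p)) (≤-reflexive (+-comm M k)))))
          (trans (m+[n∸m]≡n q) (cong (_+ s) (sym (+-identityʳ M))))
        find (no ¬p) (no ¬q) = intro 2F (+-cancelˡ-< k _ M (subst (_< k + M) (sym (m+[n∸m]≡n low)) (≤-trans (s≤s (≤-reflexive (arith M s))) (+-monoˡ-≤ M (≰⇒> ¬q)))))
          (m+[n∸m]≡n low)
          where
          low : k ≤ 2 * M + s
          low = ≤-trans (+-mono-≤ (<⇒≤ (toℕ<n a)) (≤-trans (<⇒≤ (toℕ<n b)) (m≤m+n M 0))) (m≤m+n (2 * M) s)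
          arith : ∀ M s → 2 * M + s ≡ M + s + M
          arith = solve-∀

      coincident : Colour → Vertex → Vertex → Vertex → ℕ
      coincident col a b c = ⟦ a == b ⟧ * ⟦ R (shift col) a b c ⟧

      coincident-∑ : ∀ col → ∑³ (coincident col) ≤ M
      coincident-∑ col = ≤-trans (≤-reflexive (∑∑-cong λ a b → ∑-*ˡ ⟦ a == b ⟧ _))
        (≤-trans (≤-reflexive (∑-cong λ a → ∑-point a λ b → ∑ λ c → ⟦ R (shift col) a b c ⟧))
          (≤-trans (∑-bound 1 λ a → ∑⟦⟧≤1 (R (shift col) a a) (unique a)) (≤-reflexive (*-identityʳ M))))
        where
        unique : ∀ a c d → R (shift col) a a c ≡ true → R (shift col) a a d ≡ true → c ≡ d
        unique a c d p q with R-elim (shift col) a a c p | R-elim (shift col) a a d q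
        ... | i , e | j , e′ = toℕ-injective (multiple-unique M (toℕ a + toℕ a) {i} {j} (toℕ<n c) (toℕ<n d) e e′)

      R-rotate : ∀ s a b c → R s b c a ≡ R s a b c
      R-rotate s a b c = cong (residue s) (arith (toℕ a) (toℕ b) (toℕ c))
        where
        arith : ∀ a b c → b + c + a ≡ a + b + c
        arith = solve-∀

      coincidences : Colour → Vertex → Vertex → Vertex → ℕ
      coincidences col a b c = coincident col a b c + coincident col b c a + coincident col c a b

      coincidences-∑ : ∀ col → ∑³ (coincidences col) ≤ 3 * M
      coincidences-∑ col = ≤-trans (≤-reflexive (trans (∑³-+₃ (coincident col) (λ a b c → coincident col b c a) (λ a b c → coincident col c a b))
          (cong₂ (λ x y → ∑³ (coincident col) + x + y) (∑³-rotate (coincident col)) (trans (∑³-rotate (λ a b c → coincident col b c a)) (∑³-rotate (coincident col))))))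
        (≤-trans (+-mono-≤ (+-mono-≤ (coincident-∑ col) (coincident-∑ col)) (coincident-∑ col)) (≤-reflexive (arith M)))
        where
        arith : ∀ M → M + M + M ≡ 3 * M
        arith = solve-∀

      DistinctShifts : Set
      DistinctShifts = AllPairs (λ c d → shift c ≢ shift d) cs

      triples-pointwise : DistinctShifts → ∀ a b c →
        total (λ col → ⟦ R (shift col) a b c ⟧) cs ≤ ⟦ triple a b c ⟧ + total (λ col → coincidences col a b c) cs
      triples-pointwise ds a b c with a == b in ab | b == c in bc | a == c in ac
      ... | false | false | false = ≤-trans (any-exclusive (λ col → R (shift col) a b c) (AllPairs.map (λ {x} {y} → apart {x} {y}) ds)) (m≤m+n _ _)
        where
        apart : ∀ {x y} → shift x ≢ shift y → R (shift x) a b c ≡ true → R (shift y) a b c ≡ true → ⊥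
        apart {x} {y} ne p q with R-elim (shift x) a b c p | R-elim (shift y) a b c q
        ... | i , e | j , e′ = ne (residue-unique M {i} {j} (≤-<-trans (shift≤ x) c₀<M) (≤-<-trans (shift≤ y) c₀<M) (trans (sym e) e′))
      ... | true | _ | _ = total-mono cs (λ col → ≤-trans (≤-reflexive (sym (+-identityʳ _))) (≤-trans (m≤m+n _ _) (m≤m+n _ _))) ⟫ _
        where
        _⟫_ : ∀ {x y} → x ≤ y → ∀ z → x ≤ z + y
        p ⟫ z = ≤-trans p (m≤n+m _ z)
      ... | false | true | _ = ≤-trans (total-mono cs λ col → ≤-trans (≤-reflexive (trans (cong ⟦_⟧ (sym (R-rotate (shift col) a b c))) (sym (+-identityʳ ⟦ R (shift col) b c a ⟧)))) (m≤m+n (1 * ⟦ R (shift col) b c a ⟧) _)) (m≤n+m _ 0)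
      ... | false | false | true rewrite trans (==-sym c a) ac = ≤-trans (total-mono cs λ col → ≤-trans (≤-reflexive (trans (cong ⟦_⟧ (R-rotate (shift col) c a b)) (sym (+-identityʳ ⟦ R (shift col) c a b ⟧)))) (m≤n+m (1 * ⟦ R (shift col) c a b ⟧) 0)) (m≤n+m _ 0)

      triples-∑ : DistinctShifts → length cs * (M * M) ≤ ∑³ (λ a b c → ⟦ triple a b c ⟧) + length cs * (3 * M)
      triples-∑ ds = begin
        length cs * (M * M)
          ≡⟨ total-const (M * M) cs ⟨
        total (λ _ → M * M) cs
          ≤⟨ total-mono cs full ⟩
        total (λ col → ∑³ (λ a b c → ⟦ R (shift col) a b c ⟧)) cs
          ≡⟨ ∑³-total (λ col a b c → ⟦ R (shift col) a b c ⟧) ⟨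
        ∑³ (λ a b c → total (λ col → ⟦ R (shift col) a b c ⟧) cs)
          ≤⟨ ∑³-mono (triples-pointwise ds) ⟩
        ∑³ (λ a b c → ⟦ triple a b c ⟧ + total (λ col → coincidences col a b c) cs)
          ≡⟨ trans (∑³-+ _ _) (cong (∑³ (λ a b c → ⟦ triple a b c ⟧) +_) (∑³-total coincidences)) ⟩
        ∑³ (λ a b c → ⟦ triple a b c ⟧) + total (λ col → ∑³ (coincidences col)) cs
          ≤⟨ +-monoʳ-≤ (∑³ λ a b c → ⟦ triple a b c ⟧) (≤-trans (total-mono cs coincidences-∑) (≤-reflexive (total-const (3 * M) cs))) ⟩
        ∑³ (λ a b c → ⟦ triple a b c ⟧) + length cs * (3 * M) ∎
        where
        open ≤-Reasoning
        ∑³-total : ∀ (f : Colour → Vertex → Vertex → Vertex → ℕ) → ∑³ (λ a b c → total (λ col → f col a b c) cs) ≡ total (λ col → ∑³ (f col)) cs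
        ∑³-total f = trans (∑∑-cong λ a b → ∑-total (λ col → f col a b) cs)
          (trans (∑-cong λ a → ∑-total (λ col b → ∑ (f col a b)) cs) (∑-total (λ col a → ∑∑ (f col a)) cs))
        full : ∀ col → M * M ≤ ∑³ (λ a b c → ⟦ R (shift col) a b c ⟧)
        full col = begin
          M * M                  ≡⟨ ∑-const M M ⟨
          ∑ {M} (λ _ → M)        ≡⟨ ∑-cong {M} (λ a → trans (∑-const M 1) (*-identityʳ M)) ⟨
          ∑∑ {M} {M} (λ _ _ → 1) ≤⟨ ∑∑-mono (λ a b → let (c , r) = completes (shift col) (shift≤ col) a b in
                                       ≤-trans (≤-reflexive (cong ⟦_⟧ (sym r))) (term≤∑ (λ c → ⟦ R (shift col) a b c ⟧) c)) ⟩
          ∑³ (λ a b c → ⟦ R (shift col) a b c ⟧) ∎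

    apexEdges : Colour → ℕ
    apexEdges col = ∑ λ ε → ∑∑ λ a b → ⟦ W col ε a b ⟧

    private
      apexPairs-∑ : DistinctShifts → 2 * total apexEdges cs ≤ ∑ (λ ε → ∑∑ λ a b → ⟦ apexPair ε a b ⟧)
      apexPairs-∑ ds = begin
        2 * total apexEdges cs
          ≡⟨ cong (2 *_) (sym (trans (∑-cong λ ε → trans (∑-cong λ a → ∑-total (λ col b → ⟦ W col ε a b ⟧) cs) (∑-total (λ col a → ∑ λ b → ⟦ W col ε a b ⟧) cs))
               (∑-total (λ col ε → ∑∑ λ a b → ⟦ W col ε a b ⟧) cs))) ⟩
        2 * ∑ (λ ε → ∑∑ λ a b → t ε a b)
          ≡⟨ trans (sym (∑-*ˡ 2 _)) (∑-cong λ ε → trans (cong (∑∑ (t ε) +_) (+-identityʳ _)) (trans (cong (∑∑ (t ε) +_) (∑-swap (t ε))) (sym (∑∑-+ (t ε) (λ a b → t ε b a))))) ⟩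
        ∑ (λ ε → ∑∑ λ a b → t ε a b + t ε b a)
          ≤⟨ ∑-mono (λ ε → ∑∑-mono (pointwise ε)) ⟩
        ∑ (λ ε → ∑∑ λ a b → ⟦ apexPair ε a b ⟧) ∎
        where
        open ≤-Reasoning
        t : Fin 2 → Vertex → Vertex → ℕ
        t ε a b = total (λ col → ⟦ W col ε a b ⟧) cs
        pointwise : ∀ ε a b → t ε a b + t ε b a ≤ ⟦ apexPair ε a b ⟧
        pointwise ε a b = begin
          t ε a b + t ε b a
            ≡⟨ total-+ (λ col → ⟦ W col ε a b ⟧) (λ col → ⟦ W col ε b a ⟧) cs ⟨
          total (λ col → ⟦ W col ε a b ⟧ + ⟦ W col ε b a ⟧) cs
            ≤⟨ total-mono cs one-way ⟩
          total (λ col → ⟦ apex col ε a b ⟧) cs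
            ≤⟨ any-exclusive (λ col → apex col ε a b) (AllPairs.map (λ {x} {y} → apart {x} {y}) ds) ⟩
          ⟦ apexPair ε a b ⟧ ∎
          where
          one-way : ∀ col → ⟦ W col ε a b ⟧ + ⟦ W col ε b a ⟧ ≤ ⟦ apex col ε a b ⟧
          one-way col with W col ε a b in p | W col ε b a in q
          ... | true  | true  = ⊥-elim (W-asym col col ε ε a b p q)
          ... | true  | false = ≤-refl
          ... | false | _     = ≤-refl
          apart : ∀ {x y} → shift x ≢ shift y → apex x ε a b ≡ true → apex y ε a b ≡ true → ⊥
          apart {x} {y} ne p q with apex-elim x ε a b p | apex-elim y ε a b q
          ... | inj₁ w | inj₁ w′ = ne (W-shift x y ε ε a b w w′)
          ... | inj₂ w | inj₂ w′ = ne (W-shift x y ε ε b a w w′)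
          ... | inj₁ w | inj₂ w′ = W-asym x y ε ε a b w w′
          ... | inj₂ w | inj₁ w′ = W-asym x y ε ε b a w w′

      edges-split : 3 * ∑ (λ ε → ∑∑ λ a b → ⟦ apexPair ε a b ⟧) + ∑³ (λ a b c → ⟦ triple a b c ⟧) ≤ edges₆ packing
      edges-split = begin
        3 * A + ∑³ (λ a b c → ⟦ triple a b c ⟧)
          ≡⟨ arith A (∑³ λ a b c → ⟦ triple a b c ⟧) ⟩
        A + (A + (A + ∑³ (λ a b c → ⟦ triple a b c ⟧)))
          ≡⟨ cong (A +_) (trans (cong₂ _+_ (∑-swap λ ε a → ∑ λ b → ⟦ apexPair ε a b ⟧)
               (trans (cong (_+ ∑³ (λ a b c → ⟦ triple a b c ⟧)) (trans (∑-swap λ ε a → ∑ λ b → ⟦ apexPair ε a b ⟧) (∑-cong λ a → ∑-swap λ ε b → ⟦ apexPair ε a b ⟧)))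
                 (sym (∑∑-+ (λ a b → ∑ λ ε → ⟦ apexPair ε a b ⟧) (λ a b → ∑ λ c → ⟦ triple a b c ⟧))))) (sym (∑-+ _ _))) ⟩
        A + ∑ (λ a → ∑ (λ ε → ∑ λ b → ⟦ apexPair ε a b ⟧) + ∑ (λ b → ∑⊎ λ z → ⟦ adj (inj₂ a) (inj₂ b) z ⟧))
          ≤⟨ +-mono-≤ (∑-mono λ ε → ≤-trans (∑-mono λ a → m≤n+m (∑ λ b → ⟦ apexPair ε a b ⟧) _) (m≤n+m _ (∑ λ ε′ → ∑⊎ {2} {M} λ z → 0)))
                      (∑-mono λ a → +-monoˡ-≤ _ (∑-mono λ ε → m≤n+m (∑ λ b → ⟦ apexPair ε a b ⟧) _)) ⟩
        ∑⊎ (λ x → ∑⊎ λ y → ∑⊎ λ z → ⟦ adj x y z ⟧)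
          ≡⟨ graph-edges ⟨
        edges₆ packing ∎
        where
        open ≤-Reasoning
        A : ℕ
        A = ∑ λ ε → ∑∑ λ a b → ⟦ apexPair ε a b ⟧
        arith : ∀ A t → 3 * A + t ≡ A + (A + (A + t))
        arith = solve-∀

    packing-edges : AllPairs (λ c d → shift c ≢ shift d) cs →
      length cs * (M * M) + 6 * total apexEdges cs ≤ edges₆ packing + length cs * (3 * M)
    packing-edges ds = linear 0 (+-mono-≤ (triples-∑ ds) (+-mono-≤ (*-monoʳ-≤ 3 (apexPairs-∑ ds)) edges-split))
      (arith (length cs * (M * M)) (total apexEdges cs) (∑³ λ a b c → ⟦ triple a b c ⟧) (length cs * (3 * M)) (∑ λ ε → ∑∑ λ a b → ⟦ apexPair ε a b ⟧) (edges₆ packing))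
      where
      arith : ∀ x y t z A e → x + 6 * y + (t + z + (3 * A + e)) + 0 ≡ e + z + (x + (3 * (2 * y) + (3 * A + t)))
      arith = solve-∀

∑₂≤1 : ∀ {n} (P Q : Fin n → Bool) → (∀ i j → P i ≡ true → P j ≡ true → i ≡ j) → (∀ i j → Q i ≡ true → Q j ≡ true → i ≡ j) →
  (∀ i j → P i ≡ true → Q j ≡ true → ⊥) → ∑ (λ i → ⟦ P i ⟧) + ∑ (λ i → ⟦ Q i ⟧) ≤ 1
∑₂≤1 P Q uP uQ PQ with any? (λ i → P i Boolₚ.≟ true)
... | yes (i , p) = ≤-trans (+-mono-≤ (∑⟦⟧≤1 P uP) (≤-reflexive (∑-zero λ j → cong ⟦_⟧ (not-true (PQ i j p))))) ≤-refl
... | no none     = ≤-trans (+-mono-≤ (≤-reflexive (∑-zero λ j → cong ⟦_⟧ (not-true λ p → none (j , p)))) (∑⟦⟧≤1 Q uQ)) ≤-refl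

module Colouring (q m r : ℕ) (r≤5 : r ≤ 5) (m-large : 4 * q + 6 ≤ m) where

  open Design (4 * q) m r r≤5 m-large

  zoneSize : Zone → ℕ
  zoneSize z = ∑ λ (a : Vertex) → ⟦ does (in-zone? z (toℕ a)) ⟧

  zoneSize-≥ : ∀ z → width z * m ≤ zoneSize z + (C + C)
  zoneSize-≥ z = ≤-trans (≤-trans (m≤n+m∸n (width z * m) (C + C)) (≤-reflexive (+-comm (C + C) _)))
    (+-monoˡ-≤ (C + C) (injection-≤ (λ a → does (in-zone? z (toℕ a))) h h-inj λ i → dec-true (in-zone? z (toℕ (h i))) (subst (InZone z) (sym (toℕ-fromℕ< (h< i))) (m≤m+n _ (toℕ i) , hi i))))
    where
    offset : Fin (width z * m ∸ (C + C)) → ℕ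
    offset i = start z * m + C + toℕ i
    ends : ∀ z → start z + width z ≤ 6
    ends = from-yes (all? λ (z : Zone) → start z + width z ≤? 6)
    hi : ∀ i → offset i + C < (start z + width z) * m
    hi i = linear 0 (m≤o∸n⇒m+n≤o (suc (toℕ i)) (C+C≤ i) (toℕ<n i)) (arith (start z) (width z) m C (toℕ i))
      where
      C+C≤ : Fin (width z * m ∸ (C + C)) → C + C ≤ width z * m
      C+C≤ i = <⇒≤ (m∸n≢0⇒n<m λ eq → n≮0 (≤-trans (toℕ<n i) (≤-reflexive eq)))
      arith : ∀ s w m C i → suc (s * m + C + i + C) + w * m + 0 ≡ (s + w) * m + (suc i + (C + C))
      arith = solve-∀
    h< : ∀ i → offset i < M
    h< i = ≤-trans (s≤s (m≤m+n (offset i) C)) (≤-trans (hi i) (≤-trans (*-monoˡ-≤ m (ends z)) (m≤m+n (6 * m) r)))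
    h : Fin (width z * m ∸ (C + C)) → Vertex
    h i = fromℕ< (h< i)
    h-inj : ∀ i j → h i ≡ h j → i ≡ j
    h-inj i j eq = toℕ-injective (+-cancelˡ-≡ (start z * m + C) _ _ (trans (sym (toℕ-fromℕ< (h< i))) (trans (cong toℕ eq) (toℕ-fromℕ< (h< j)))))

  W-degree : ∀ col ε → ∑ (λ z → ⟦ gets col ε z ⟧ * zoneSize z) ≤ ∑∑ (λ a b → ⟦ W col ε a b ⟧)
  W-degree col ε = ≤-trans (≤-reflexive (trans (∑-cong λ z → trans (sym (∑-*ˡ ⟦ gets col ε z ⟧ _)) (∑-cong λ a → sym (⟦⟧-∧ (gets col ε z) _))) (∑-swap _)))
    (∑-mono row)
    where
    row : ∀ a → ∑ (λ z → ⟦ gets col ε z ∧ does (in-zone? z (toℕ a)) ⟧) ≤ ∑ (λ b → ⟦ W col ε a b ⟧)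
    row a with any? (λ z → gets col ε z ∧ does (in-zone? z (toℕ a)) Boolₚ.≟ true)
    ... | no none = ≤-trans (≤-reflexive (∑-zero λ z → cong ⟦_⟧ (not-true λ p → none (z , p)))) z≤n
    ... | yes (z , p) = ≤-trans (∑⟦⟧≤1 (λ z → gets col ε z ∧ does (in-zone? z (toℕ a))) unique) (joined (partner {z = z} (shift≤ col) in-z))
      where
      in-z : InZone z (toℕ a)
      in-z = does⇒ (in-zone? z (toℕ a)) (proj₂ (∧-true {gets col ε z} p))
      unique : ∀ z z′ → gets col ε z ∧ does (in-zone? z (toℕ a)) ≡ true → gets col ε z′ ∧ does (in-zone? z′ (toℕ a)) ≡ true → z ≡ z′
      unique z z′ p q = zone-unique {z} {z′} (does⇒ (in-zone? z (toℕ a)) (proj₂ (∧-true {gets col ε z} p)))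
        (does⇒ (in-zone? z′ (toℕ a)) (proj₂ (∧-true {gets col ε z′} q)))
      joined : (∃ λ b → b < M × 2 * toℕ a + b ≡ wraps z * M + shift col) → 1 ≤ ∑ (λ b → ⟦ W col ε a b ⟧)
      joined (b , b<M , e) = ≤-trans (≤-reflexive (cong ⟦_⟧ (sym (dec-true (joins? col ε a (fromℕ< b<M))
        (z , proj₁ (∧-true p) , in-z , trans (cong (2 * toℕ a +_) (toℕ-fromℕ< b<M)) e))))) (term≤∑ (λ b → ⟦ W col ε a b ⟧) (fromℕ< b<M))

  low : Zone → Bool
  low 0F                   = true
  low 1F             = true
  low 2F       = false
  low 3F = false

  split : Bool → Fin 2 → Zone → Bool
  split b 0F       z = if b then low z else not (low z)
  split b 1F z = if b then not (low z) else low z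

  split-exclusive : ∀ b z → split b 0F z ∧ split b 1F z ≡ false
  split-exclusive true  = from-yes (all? λ (z : Zone) → split true 0F z ∧ split true 1F z Boolₚ.≟ false)
  split-exclusive false = from-yes (all? λ (z : Zone) → split false 0F z ∧ split false 1F z Boolₚ.≟ false)

  splitColour : Bool → ∀ s → s ≤ 4 * q → Colour
  splitColour b s s≤ = record { shift = s ; shift≤ = s≤ ; gets = split b ; exclusive = split-exclusive b }

  -- For odd l, the last colour uses only the outermost zones, in which no doubled point is reached from another.
  extreme : Fin 2 → Zone → Bool
  extreme 0F       z = 3F == z
  extreme 1F z = 0F == z

  oddColour : Colour
  oddColour = record { shift = 4 * q ; shift≤ = ≤-refl ; gets = extreme
    ; exclusive = from-yes (all? λ (z : Zone) → extreme 0F z ∧ extreme 1F z Boolₚ.≟ false) }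

  out-unique : ∀ col ε a b b′ → W col ε a b ≡ true → W col ε a b′ ≡ true → b ≡ b′
  out-unique col ε a b b′ w w′ with W-elim col ε a b w | W-elim col ε a b′ w′
  ... | z , _ , p , e | z′ , _ , p′ , e′ with zone-unique {z} {z′} p p′
  ...   | refl = toℕ-injective (+-cancelˡ-≡ (2 * toℕ a) _ _ (trans e (sym e′)))

  same-wraps-unique : ∀ col ε {w} → (∀ z → gets col ε z ≡ true → wraps z ≡ w) → ∀ a b b′ → W col ε b a ≡ true → W col ε b′ a ≡ true → b ≡ b′
  same-wraps-unique col ε one a b b′ w w′ with W-elim col ε b a w | W-elim col ε b′ a w′
  ... | z , g , _ , e | z′ , g′ , _ , e′ = toℕ-injective (*-cancelˡ-≡ (toℕ b) (toℕ b′) 2 (+-cancelʳ-≡ (toℕ a) _ _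
      (trans e (trans (cong (λ k → k * M + shift col) (trans (one z g) (sym (one z′ g′)))) (sym e′)))))

  wrapsOf : Bool → Fin 2 → ℕ
  wrapsOf true  0F       = 1
  wrapsOf true  1F = 2
  wrapsOf false 0F       = 2
  wrapsOf false 1F = 1

  split-wraps : ∀ b ε z → split b ε z ≡ true → wraps z ≡ wrapsOf b ε
  split-wraps b ε z g = does⇒ (wraps z ℕₚ.≟ wrapsOf b ε) (trans (sym (cong (λ x → not x ∨ does (wraps z ℕₚ.≟ wrapsOf b ε)) g)) (table b ε z))
    where
    table : ∀ b ε z → not (split b ε z) ∨ does (wraps z ℕₚ.≟ wrapsOf b ε) ≡ true
    table true  = from-yes (all? λ (ε : Fin 2) → all? λ (z : Zone) → not (split true ε z) ∨ does (wraps z ℕₚ.≟ wrapsOf true ε) Boolₚ.≟ true)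
    table false = from-yes (all? λ (ε : Fin 2) → all? λ (z : Zone) → not (split false ε z) ∨ does (wraps z ℕₚ.≟ wrapsOf false ε) Boolₚ.≟ true)

  odd≢even : ∀ x y → 1 + 2 * x ≡ 2 * y → ⊥
  odd≢even zero    (suc y) e = case trans e (+-suc (suc y) (y + 0)) of λ ()
  odd≢even (suc x) (suc y) e = odd≢even x y (+-cancelˡ-≡ 2 _ _ (trans (arith x) (trans e (arith′ y))))
    where
    arith : ∀ x → 2 + (1 + 2 * x) ≡ 1 + 2 * suc x
    arith = solve-∀
    arith′ : ∀ y → 2 * suc y ≡ 2 + 2 * y
    arith′ = solve-∀

  private
    incidenceOf : Colour → Fin 2 → Vertex → ℕ
    incidenceOf col ε a = ∑ (λ b → ⟦ W col ε a b ⟧) + ∑ (λ b → ⟦ W col ε b a ⟧)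

  extreme-capacity : ∀ ε a → incidenceOf oddColour ε a ≤ 1
  extreme-capacity ε a = ∑₂≤1 (λ b → W oddColour ε a b) (λ b → W oddColour ε b a) (out-unique oddColour ε a)
    (same-wraps-unique oddColour ε {extremeWraps ε} (λ z g → extreme-wraps ε z g) a) (λ b b′ w w′ → apart ε b b′ (W-elim oddColour ε a b w) (W-elim oddColour ε b′ a w′))
    where
    extremeWraps : Fin 2 → ℕ
    extremeWraps 0F       = 2
    extremeWraps 1F = 1
    extreme-wraps : ∀ ε z → extreme ε z ≡ true → wraps z ≡ extremeWraps ε
    extreme-wraps 0F       z g = cong wraps (sym (==⇒≡ {i = 3F} {z} g))
    extreme-wraps 1F z g = cong wraps (sym (==⇒≡ {i = 0F} {z} g))
    apart : ∀ ε b b′ → Joins oddColour ε a b → Joins oddColour ε b′ a → ⊥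
    apart 0F b b′ (z , g , (lo , _) , _) (z′ , g′ , (lo′ , _) , e) with ==⇒≡ {i = 3F} {z} g | ==⇒≡ {i = 3F} {z′} g′
    ... | refl | refl = <⇒≱ {10} {18} (m≤m+n 11 7) (linear (8 * q) (+-mono-≤ (*-monoʳ-≤ 2 lo′) (+-mono-≤ lo (+-mono-≤ (≤-reflexive e) (*-monoʳ-≤ 2 r≤5))))
        (arith m q (toℕ b′) (toℕ a) r))
      where
      arith : ∀ m q b a r → 18 + (2 * b + (a + (2 * (6 * m + r) + 4 * q + 2 * 5))) + 8 * q
        ≡ 10 + (2 * (4 * m + (4 * q + 6)) + (4 * m + (4 * q + 6) + (2 * b + a + 2 * r)))
      arith = solve-∀
    apart 1F b b′ (z , g , (_ , hi) , _) (z′ , g′ , (_ , hi′) , e) with ==⇒≡ {i = 0F} {z} g | ==⇒≡ {i = 0F} {z′} g′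
    ... | refl | refl = <⇒≱ {0} {21} (s≤s z≤n) (linear (16 * q + r) (+-mono-≤ (*-monoʳ-≤ 2 hi′) (+-mono-≤ hi (≤-reflexive (sym e))))
        (arith m q (toℕ b′) (toℕ a) r))
      where
      arith : ∀ m q b a r → 21 + (2 * (2 * m) + (2 * m + (2 * b + a))) + (16 * q + r)
        ≡ 0 + (2 * suc (b + (4 * q + 6)) + (suc (a + (4 * q + 6)) + (1 * (6 * m + r) + 4 * q)))
      arith = solve-∀

  -- As M + p is even, the points reached from doubled points by the two colours differ in parity.
  split-capacity : ∀ s p k (s≤ : s ≤ 4 * q) (s′≤ : s + 1 + p ≤ 4 * q) → M + p ≡ 2 * k → ∀ ε a →
    incidenceOf (splitColour true s s≤) ε a + incidenceOf (splitColour false (s + 1 + p) s′≤) ε a ≤ 2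
  split-capacity s p k s≤ s′≤ even ε a = ≤-trans (≤-reflexive (interchange (∑ λ b → ⟦ W lo ε a b ⟧) (∑ λ b → ⟦ W lo ε b a ⟧) (∑ λ b → ⟦ W up ε a b ⟧) (∑ λ b → ⟦ W up ε b a ⟧)))
    (+-mono-≤
      (∑₂≤1 (λ b → W lo ε a b) (λ b → W up ε a b) (out-unique lo ε a) (out-unique up ε a) out-apart)
      (∑₂≤1 (λ b → W lo ε b a) (λ b → W up ε b a) (same-wraps-unique lo ε (split-wraps true ε) a) (same-wraps-unique up ε (split-wraps false ε) a)
        (λ b b′ w w′ → in-apart ε b b′ (W-elim lo ε b a w) (W-elim up ε b′ a w′))))
    where
    lo up : Colour
    lo = splitColour true s s≤
    up = splitColour false (s + 1 + p) s′≤
    interchange : ∀ a b c d → a + b + (c + d) ≡ a + c + (b + d)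
    interchange = solve-∀
    table : ∀ ε z → split true ε z ∧ split false ε z ≡ false
    table = from-yes (all? λ (ε : Fin 2) → all? λ (z : Zone) → split true ε z ∧ split false ε z Boolₚ.≟ false)
    out-apart : ∀ b b′ → W lo ε a b ≡ true → W up ε a b′ ≡ true → ⊥
    out-apart b b′ w w′ with W-elim lo ε a b w | W-elim up ε a b′ w′
    ... | z , g , d , _ | z′ , g′ , d′ , _ with zone-unique {z} {z′} d d′
    ...   | refl = case trans (sym (table ε z)) (∧-intro g g′) of λ ()
    in-apart : ∀ ε b b′ → Joins lo ε b a → Joins up ε b′ a → ⊥
    in-apart 0F b b′ (z , g , _ , e) (z′ , g′ , _ , e′) rewrite split-wraps true 0F z g | split-wraps false 0F z′ g′ =
      odd≢even (toℕ b + k) (toℕ b′) (+-cancelˡ-≡ (toℕ a + M + s) _ _ (begin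
        toℕ a + M + s + (1 + 2 * (toℕ b + k))            ≡⟨ r₁ (toℕ a) M s (toℕ b) k ⟩
        (2 * toℕ b + toℕ a) + M + s + 1 + 2 * k          ≡⟨ cong₂ (λ x y → x + M + s + 1 + y) e (sym even) ⟩
        (1 * M + s) + M + s + 1 + (M + p)                ≡⟨ r₂ M s p ⟩
        (2 * M + (s + 1 + p)) + M + s                    ≡⟨ cong (λ x → x + M + s) (sym e′) ⟩
        (2 * toℕ b′ + toℕ a) + M + s                     ≡⟨ r₃ (toℕ a) M s (toℕ b′) ⟩
        toℕ a + M + s + 2 * toℕ b′                       ∎))
      where
      open ≡-Reasoning
      r₁ : ∀ a M s b k → a + M + s + (1 + 2 * (b + k)) ≡ (2 * b + a) + M + s + 1 + 2 * k
      r₁ = solve-∀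
      r₂ : ∀ M s p → (1 * M + s) + M + s + 1 + (M + p) ≡ (2 * M + (s + 1 + p)) + M + s
      r₂ = solve-∀
      r₃ : ∀ a M s b → (2 * b + a) + M + s ≡ a + M + s + 2 * b
      r₃ = solve-∀
    in-apart 1F b b′ (z , g , _ , e) (z′ , g′ , _ , e′) rewrite split-wraps true 1F z g | split-wraps false 1F z′ g′ =
      odd≢even (toℕ b + p) (toℕ b′ + k) (+-cancelˡ-≡ (toℕ a + M + s) _ _ (begin
        toℕ a + M + s + (1 + 2 * (toℕ b + p))            ≡⟨ r₁ (toℕ a) M s (toℕ b) p ⟩
        (2 * toℕ b + toℕ a) + M + s + 1 + 2 * p          ≡⟨ cong (λ x → x + M + s + 1 + 2 * p) e ⟩
        (2 * M + s) + M + s + 1 + 2 * p                  ≡⟨ r₂ M s p ⟩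
        (1 * M + (s + 1 + p)) + M + s + (M + p)          ≡⟨ cong₂ (λ x y → x + M + s + y) (sym e′) even ⟩
        (2 * toℕ b′ + toℕ a) + M + s + 2 * k             ≡⟨ r₃ (toℕ a) M s (toℕ b′) k ⟩
        toℕ a + M + s + 2 * (toℕ b′ + k)                 ∎))
      where
      open ≡-Reasoning
      r₁ : ∀ a M s b p → a + M + s + (1 + 2 * (b + p)) ≡ (2 * b + a) + M + s + 1 + 2 * p
      r₁ = solve-∀
      r₂ : ∀ M s p → (2 * M + s) + M + s + 1 + 2 * p ≡ (1 * M + (s + 1 + p)) + M + s + (M + p)
      r₂ = solve-∀
      r₃ : ∀ a M s b k → (2 * b + a) + M + s + 2 * k ≡ a + M + s + 2 * (b + k)
      r₃ = solve-∀

  private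
    ∑-Fin2 : (f : Fin 2 → ℕ) → ∑ f ≡ f 0F + f 1F
    ∑-Fin2 f = trans (∑-suc f) (cong (f 0F +_) (trans (∑-suc λ i → f (suc i)) (trans (cong (f 1F +_) (∑-[] λ i → f (suc (suc i)))) (+-identityʳ _))))

    ∑-Fin4 : (f : Fin 4 → ℕ) → ∑ f ≡ f 0F + (f 1F + (f 2F + f 3F))
    ∑-Fin4 f = trans (∑-suc f) (cong (f 0F +_) (∑-Fin3 λ i → f (suc i)))

    apexEdgesOf : Colour → ℕ
    apexEdgesOf col = ∑ λ ε → ∑∑ λ a b → ⟦ W col ε a b ⟧

    zoneTotal : Colour → Fin 2 → ℕ
    zoneTotal col ε = ⟦ gets col ε 0F ⟧ * zoneSize 0F + (⟦ gets col ε 1F ⟧ * zoneSize 1F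
      + (⟦ gets col ε 2F ⟧ * zoneSize 2F + ⟦ gets col ε 3F ⟧ * zoneSize 3F))

    apexEdges-≥ : ∀ col → zoneTotal col 0F + zoneTotal col 1F ≤ apexEdgesOf col
    apexEdges-≥ col = ≤-trans (≤-reflexive (sym (trans (∑-Fin2 _) (cong₂ _+_ (∑-Fin4 _) (∑-Fin4 _))))) (∑-mono (W-degree col))

    allZones : 6 * m ≤ zoneSize 0F + (zoneSize 1F + (zoneSize 2F + zoneSize 3F)) + 8 * C
    allZones = linear 0 (+-mono-≤ (zoneSize-≥ 0F) (+-mono-≤ (zoneSize-≥ 1F) (+-mono-≤ (zoneSize-≥ 2F) (zoneSize-≥ 3F))))
      (arith m C (zoneSize 0F) (zoneSize 1F) (zoneSize 2F) (zoneSize 3F))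
      where
      arith : ∀ m C x y z w → 6 * m + (x + (C + C) + (y + (C + C) + (z + (C + C) + (w + (C + C))))) + 0
        ≡ x + (y + (z + w)) + 8 * C + (2 * m + (1 * m + (1 * m + 2 * m)))
      arith = solve-∀

    split-apexEdges : ∀ b s (s≤ : s ≤ 4 * q) → 6 * m ≤ apexEdgesOf (splitColour b s s≤) + 8 * C
    split-apexEdges true  s s≤ = ≤-trans allZones (+-monoˡ-≤ (8 * C) (≤-trans (≤-reflexive (arith (zoneSize 0F) (zoneSize 1F) (zoneSize 2F) (zoneSize 3F)))
      (apexEdges-≥ (splitColour true s s≤))))
      where
      arith : ∀ x y z w → x + (y + (z + w)) ≡ 1 * x + (1 * y + (0 * z + 0 * w)) + (0 * x + (0 * y + (1 * z + 1 * w)))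
      arith = solve-∀
    split-apexEdges false s s≤ = ≤-trans allZones (+-monoˡ-≤ (8 * C) (≤-trans (≤-reflexive (arith (zoneSize 0F) (zoneSize 1F) (zoneSize 2F) (zoneSize 3F)))
      (apexEdges-≥ (splitColour false s s≤))))
      where
      arith : ∀ x y z w → x + (y + (z + w)) ≡ 0 * x + (0 * y + (1 * z + 1 * w)) + (1 * x + (1 * y + (0 * z + 0 * w)))
      arith = solve-∀

    extreme-apexEdges : 4 * m ≤ apexEdgesOf oddColour + 4 * C
    extreme-apexEdges = linear 0 (+-mono-≤ (apexEdges-≥ oddColour) (+-mono-≤ (zoneSize-≥ 0F) (zoneSize-≥ 3F)))
      (arith m C (zoneSize 0F) (zoneSize 1F) (zoneSize 2F) (zoneSize 3F) (apexEdgesOf oddColour))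
      where
      arith : ∀ m C x y z w e → 4 * m + (e + (x + (C + C) + (w + (C + C)))) + 0
        ≡ e + 4 * C + (0 * x + (0 * y + (0 * z + 1 * w)) + (1 * x + (0 * y + (0 * z + 0 * w))) + (2 * m + 2 * m))
      arith = solve-∀

  module _ (p k : ℕ) (p≤1 : p ≤ 1) (even : M + p ≡ 2 * k) where

    private
      lower≤ : ∀ {j} → j < q → 4 * j ≤ 4 * q
      lower≤ j<q = *-monoʳ-≤ 4 (<⇒≤ j<q)

      upper≤ : ∀ {j} → j < q → 4 * j + 1 + p ≤ 4 * q
      upper≤ {j} j<q = linear 2 (+-mono-≤ (*-monoʳ-≤ 4 j<q) p≤1) (arith j p q)
        where
        arith : ∀ j p q → 4 * j + 1 + p + (4 * q + 1) + 2 ≡ 4 * q + (4 * suc j + p)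
        arith = solve-∀

    pairColours : ∀ j → j ≤ q → List Colour
    pairColours zero    le = []
    pairColours (suc j) le = splitColour true (4 * j) (lower≤ le) ∷ splitColour false (4 * j + 1 + p) (upper≤ le) ∷ pairColours j (<⇒≤ le)

    pair-length : ∀ j le → length (pairColours j le) ≡ 2 * j
    pair-length zero    le = refl
    pair-length (suc j) le = trans (cong (λ x → suc (suc x)) (pair-length j (<⇒≤ le))) (cong suc (sym (+-suc j (j + 0))))

    pair-shifts : ∀ j le → All (λ c → shift c < 4 * j) (pairColours j le)
    pair-shifts zero    le = []
    pair-shifts (suc j) le = linear 3 (z≤n {0}) (arith₁ j) ∷ linear 1 p≤1 (arith₂ j p) ∷ All.map (λ lt → ≤-trans lt (*-monoʳ-≤ 4 (n≤1+n j))) (pair-shifts j (<⇒≤ le))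
      where
      arith₁ : ∀ j → suc (4 * j) + 0 + 3 ≡ 4 * suc j + 0
      arith₁ = solve-∀
      arith₂ : ∀ j p → suc (4 * j + 1 + p) + 1 + 1 ≡ 4 * suc j + p
      arith₂ = solve-∀

    pair-distinct : ∀ j le → AllPairs (λ c d → shift c ≢ shift d) (pairColours j le)
    pair-distinct zero    le = []
    pair-distinct (suc j) le =
      ((λ eq → <⇒≢ (≤-trans (≤-reflexive (+-comm 1 (4 * j))) (m≤m+n (4 * j + 1) p)) eq) ∷ All.map (λ lt eq → <⇒≢ lt (sym eq)) (pair-shifts j (<⇒≤ le)))
      ∷ All.map (λ lt eq → <⇒≢ (≤-trans lt (≤-trans (m≤m+n (4 * j) 1) (m≤m+n (4 * j + 1) p))) (sym eq)) (pair-shifts j (<⇒≤ le))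
      ∷ pair-distinct j (<⇒≤ le)

    pair-capacity : ∀ j le ε a → total (λ col → incidenceOf col ε a) (pairColours j le) ≤ length (pairColours j le)
    pair-capacity zero    le ε a = z≤n
    pair-capacity (suc j) le ε a = ≤-trans (≤-reflexive (sym (+-assoc (incidenceOf (splitColour true (4 * j) (lower≤ le)) ε a) _ _)))
      (+-mono-≤ (split-capacity (4 * j) p k (lower≤ le) (upper≤ le) even ε a) (pair-capacity j (<⇒≤ le) ε a))

    pair-apexEdges : ∀ j le → 12 * m * j ≤ total apexEdgesOf (pairColours j le) + 16 * C * j
    pair-apexEdges zero    le = ≤-trans (≤-reflexive (*-zeroʳ (12 * m))) z≤n
    pair-apexEdges (suc j) le = linear 0 (+-mono-≤ (split-apexEdges true (4 * j) (lower≤ le)) (+-mono-≤ (split-apexEdges false (4 * j + 1 + p) (upper≤ le)) (pair-apexEdges j (<⇒≤ le))))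
      (arith m C j (apexEdgesOf (splitColour true (4 * j) (lower≤ le))) (apexEdgesOf (splitColour false (4 * j + 1 + p) (upper≤ le))) (total apexEdgesOf (pairColours j (<⇒≤ le))))
      where
      arith : ∀ m C j x y t → 12 * m * suc j + (x + 8 * C + (y + 8 * C + (t + 16 * C * j))) + 0
        ≡ x + (y + t) + 16 * C * suc j + (6 * m + (6 * m + 12 * m * j))
      arith = solve-∀

    private
      cs : List Colour
      cs = pairColours q ≤-refl

    evenPacking : Σ (Graph3 (2 + M)) λ G → (∀ u v → codeg G u v < suc (2 * q)) ×
      2 * q * (M * M) + 6 * q * M ≤ edges₆ G + (96 * C * q + 60 * q)
    evenPacking = packing , subst (λ L → ∀ u v → codeg packing u v < suc L) (pair-length q ≤-refl) (packing-codeg (pair-capacity q ≤-refl)) ,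
      linear 0 (+-mono-≤ edges (+-mono-≤ (*-monoʳ-≤ 6 (pair-apexEdges q ≤-refl)) (*-monoʳ-≤ (12 * q) r≤5))) (arith m r q C (edges₆ packing) (total apexEdgesOf cs))
      where
      open Packing cs using (packing; packing-codeg; packing-edges)
      edges : 2 * q * (M * M) + 6 * total apexEdgesOf cs ≤ edges₆ packing + 2 * q * (3 * M)
      edges = subst (λ L → L * (M * M) + 6 * total apexEdgesOf cs ≤ edges₆ packing + L * (3 * M)) (pair-length q ≤-refl) (packing-edges (pair-distinct q ≤-refl))
      arith : ∀ m r q C e t → 2 * q * ((6 * m + r) * (6 * m + r)) + 6 * q * (6 * m + r) + (e + 2 * q * (3 * (6 * m + r)) + (6 * (t + 16 * C * q) + 12 * q * 5)) + 0
        ≡ e + (96 * C * q + 60 * q) + (2 * q * ((6 * m + r) * (6 * m + r)) + 6 * t + (6 * (12 * m * q) + 12 * q * r))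
      arith = solve-∀

    oddPacking : Σ (Graph3 (2 + M)) λ G → (∀ u v → codeg G u v < suc (1 + 2 * q)) ×
      (1 + 2 * q) * (M * M) + 6 * q * M + M ≤ edges₆ G + (96 * C * q + 60 * q + 24 * C + 20)
    oddPacking = packing , subst (λ L → ∀ u v → codeg packing u v < suc (suc L)) (pair-length q ≤-refl)
        (packing-codeg λ ε a → +-mono-≤ (extreme-capacity ε a) (pair-capacity q ≤-refl ε a)) ,
      linear 0 (+-mono-≤ edges (+-mono-≤ (*-monoʳ-≤ 6 (+-mono-≤ extreme-apexEdges (pair-apexEdges q ≤-refl))) (*-monoʳ-≤ (12 * q + 4) r≤5)))
        (arith m r q C (edges₆ packing) (total apexEdgesOf cs) (apexEdgesOf oddColour))
      where
      open Packing (oddColour ∷ cs) using (packing; packing-codeg; packing-edges)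
      edges : (1 + 2 * q) * (M * M) + 6 * (apexEdgesOf oddColour + total apexEdgesOf cs) ≤ edges₆ packing + (1 + 2 * q) * (3 * M)
      edges = subst (λ L → (1 + L) * (M * M) + 6 * (apexEdgesOf oddColour + total apexEdgesOf cs) ≤ edges₆ packing + (1 + L) * (3 * M)) (pair-length q ≤-refl)
        (packing-edges (All.map (λ lt eq → <⇒≢ lt (sym eq)) (pair-shifts q ≤-refl) ∷ pair-distinct q ≤-refl))
      arith : ∀ m r q C e t x → (1 + 2 * q) * ((6 * m + r) * (6 * m + r)) + 6 * q * (6 * m + r) + (6 * m + r)
          + (e + (1 + 2 * q) * (3 * (6 * m + r)) + (6 * (x + 4 * C + (t + 16 * C * q)) + (12 * q + 4) * 5)) + 0
        ≡ e + (96 * C * q + 60 * q + 24 * C + 20) + ((1 + 2 * q) * ((6 * m + r) * (6 * m + r)) + 6 * (x + t) + (6 * (4 * m + 12 * m * q) + (12 * q + 4) * r))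
      arith = solve-∀

-- Part sizes

evenUp : ∀ n → ∃ λ p → ∃ λ k → p ≤ 1 × n + p ≡ 2 * k
evenUp zero    = 0 , 0 , z≤n , refl
evenUp (suc n) with evenUp n
... | zero  , k , _ , e = 1 , suc k , ≤-refl , trans (trans (+-comm (suc n) 1) (cong (λ x → suc (suc x)) (trans (sym (+-identityʳ n)) e))) (sym (arith k))
  where
  arith : ∀ k → 2 * suc k ≡ suc (suc (2 * k))
  arith = solve-∀
... | suc zero , k , _ , e = 0 , k , z≤n , trans (+-identityʳ (suc n)) (trans (+-comm 1 n) e)
... | suc (suc _) , k , s≤s () , e

halve : ∀ l → ∃ λ q → l ≡ 2 * q ⊎ l ≡ 1 + 2 * q
halve zero    = 0 , inj₁ refl
halve (suc l) with halve l
... | q , inj₁ e = q , inj₂ (cong suc e)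
... | q , inj₂ e = suc q , inj₁ (trans (cong suc e) (cong suc (sym (+-suc q (q + 0)))))

opaque
  packingConstant : ℕ → ℕ → ℕ
  packingConstant q C = 96 * C * q + 64 * q + 24 * C + 22

  even-bound : ∀ q C M e → 2 * q * (M * M) + 6 * q * M ≤ e + (96 * C * q + 60 * q) →
    2 * q * ((2 + M) * (2 + M)) ≤ e + 2 * q * (2 + M) + 2 * (2 + M) + packingConstant q C
  even-bound q C M e many = linear (2 * M + 4 + 24 * C + 22) many (arith q M C e)
    where
    arith : ∀ q M C e → 2 * q * ((2 + M) * (2 + M)) + (e + (96 * C * q + 60 * q)) + (2 * M + 4 + 24 * C + 22)
      ≡ e + 2 * q * (2 + M) + 2 * (2 + M) + (96 * C * q + 64 * q + 24 * C + 22) + (2 * q * (M * M) + 6 * q * M)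
    arith = solve-∀

  odd-bound : ∀ q C M e → (1 + 2 * q) * (M * M) + 6 * q * M + M ≤ e + (96 * C * q + 60 * q + 24 * C + 20) →
    (1 + 2 * q) * ((2 + M) * (2 + M)) ≤ e + (1 + 2 * q) * (2 + M) + 2 * (2 + M) + packingConstant q C
  odd-bound q C M e many = linear 4 many (arith q M C e)
    where
    arith : ∀ q M C e → (1 + 2 * q) * ((2 + M) * (2 + M)) + (e + (96 * C * q + 60 * q + 24 * C + 20)) + 4
      ≡ e + (1 + 2 * q) * (2 + M) + 2 * (2 + M) + (96 * C * q + 64 * q + 24 * C + 22) + ((1 + 2 * q) * (M * M) + 6 * q * M + M)
    arith = solve-∀

Packed : ℕ → ℕ → ℕ → Set
Packed l K N = Σ (Graph3 N) λ G → (∀ u v → codeg G u v < suc l) × l * (N * N) ≤ edges₆ G + l * N + 2 * N + K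

private
  even-packed : ∀ q C M → (Σ (Graph3 (2 + M)) λ G → (∀ u v → codeg G u v < suc (2 * q)) ×
    2 * q * (M * M) + 6 * q * M ≤ edges₆ G + (96 * C * q + 60 * q)) → Packed (2 * q) (packingConstant q C) (2 + M)
  even-packed q C M (G , small , many) = G , small , even-bound q C M (edges₆ G) many

  odd-packed : ∀ q C M → (Σ (Graph3 (2 + M)) λ G → (∀ u v → codeg G u v < suc (1 + 2 * q)) ×
    (1 + 2 * q) * (M * M) + 6 * q * M + M ≤ edges₆ G + (96 * C * q + 60 * q + 24 * C + 20)) → Packed (1 + 2 * q) (packingConstant q C) (2 + M)
  odd-packed q C M (G , small , many) = G , small , odd-bound q C M (edges₆ G) many

  packed : ∀ {l} q m r → l ≡ 2 * q ⊎ l ≡ 1 + 2 * q → r ≤ 5 → 4 * q + 6 ≤ m → Packed l (packingConstant q (4 * q + 6)) (2 + (6 * m + r))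
  packed q m r half r≤5 large = go half (evenUp (6 * m + r))
    where
    go : ∀ {l} → l ≡ 2 * q ⊎ l ≡ 1 + 2 * q → (∃ λ p → ∃ λ k → p ≤ 1 × 6 * m + r + p ≡ 2 * k) → Packed l (packingConstant q (4 * q + 6)) (2 + (6 * m + r))
    go (inj₁ refl) (p , k , p≤1 , even) = even-packed q (4 * q + 6) (6 * m + r) (Colouring.evenPacking q m r r≤5 large p k p≤1 even)
    go (inj₂ refl) (p , k , p≤1 , even) = odd-packed q (4 * q + 6) (6 * m + r) (Colouring.oddPacking q m r r≤5 large p k p≤1 even)

private
  ≤-/6 : ∀ a M → a * 6 ≤ M → a ≤ M / 6
  ≤-/6 a M le = ≤-trans (≤-reflexive (sym (m*n/n≡m a 6))) (/-monoˡ-≤ 6 le)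

  packed-all : ∀ {l K} c → (∀ m r → r ≤ 5 → c ≤ m → Packed l K (2 + (6 * m + r))) → ∀ N → 2 + c * 6 ≤ N → Packed l K N
  packed-all {l} {K} c build (suc (suc M)) (s≤s (s≤s large)) = subst (λ M → Packed l K (2 + M)) (sym M≡)
    (build (M / 6) (M % 6) (≤-pred (m%n<n M 6)) (≤-/6 c M large))
    where
    M≡ : M ≡ 6 * (M / 6) + M % 6
    M≡ = trans (m≡m%n+[m/n]*n M 6) (trans (+-comm (M % 6) (M / 6 * 6)) (cong (_+ M % 6) (*-comm (M / 6) 6)))

packing-bound : ∀ l → ∃ λ K → ∃ λ N₀ → ∀ N → N₀ ≤ N → Packed l K N
packing-bound l with halve l
... | q , half = packingConstant q (4 * q + 6) , 2 + (4 * q + 6) * 6 , packed-all (4 * q + 6) λ m r → packed q m r half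

data Balanced (n p₁ p₂ p₃ : ℕ) : Set where
  residue₀ : ∀ m → n ≡ 3 * m     → p₁ ≡ m → p₂ ≡ m     → p₃ ≡ m     → Balanced n p₁ p₂ p₃
  residue₁ : ∀ m → n ≡ 3 * m + 1 → p₁ ≡ m → p₂ ≡ m     → p₃ ≡ suc m → Balanced n p₁ p₂ p₃
  residue₂ : ∀ m → n ≡ 3 * m + 2 → p₁ ≡ m → p₂ ≡ suc m → p₃ ≡ suc m → Balanced n p₁ p₂ p₃

balanced : ∀ n → Balanced n (part₁ n) (part₂ n) (part₃ n)
balanced n = cases (n % 3) (n / 3) (m%n<n n 3) (m≡m%n+[m/n]*n n 3)
  where
  quotient : ∀ r m → r < 3 → (r + m * 3) / 3 ≡ m
  quotient r m r<3 = trans (+-distrib-/-∣ʳ r {m * 3} (divides m refl)) (cong₂ _+_ (m<n⇒m/n≡0 r<3) (m*n/n≡m m 3))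
  shift₁ : ∀ r m k → r + m * 3 + k ≡ (r + k) + m * 3
  shift₁ = solve-∀
  cases : ∀ r m {n} → r < 3 → n ≡ r + m * 3 → Balanced n (part₁ n) (part₂ n) (part₃ n)
  cases zero m _ refl = residue₀ m (*-comm m 3) (quotient 0 m (s≤s z≤n))
    (trans (cong (_/ 3) (shift₁ 0 m 1)) (quotient 1 m (s≤s (s≤s z≤n)))) (trans (cong (_/ 3) (shift₁ 0 m 2)) (quotient 2 m ≤-refl))
  cases (suc zero) m _ refl = residue₁ m (trans (+-comm 1 (m * 3)) (cong (_+ 1) (*-comm m 3))) (quotient 1 m (s≤s (s≤s z≤n)))
    (trans (cong (_/ 3) (shift₁ 1 m 1)) (quotient 2 m ≤-refl)) (trans (cong (_/ 3) (shift₁ 1 m 2)) (quotient 0 (suc m) (s≤s z≤n)))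
  cases (suc (suc zero)) m _ refl = residue₂ m (trans (+-comm 2 (m * 3)) (cong (_+ 2) (*-comm m 3))) (quotient 2 m ≤-refl)
    (trans (cong (_/ 3) (shift₁ 2 m 1)) (quotient 0 (suc m) (s≤s z≤n))) (trans (cong (_/ 3) (shift₁ 2 m 2)) (quotient 1 (suc m) (s≤s (s≤s z≤n))))
  cases (suc (suc (suc r))) m (s≤s (s≤s (s≤s ()))) _

balanced-sum : ∀ {n p₁ p₂ p₃} → Balanced n p₁ p₂ p₃ → p₁ + (p₂ + p₃) ≡ n
balanced-sum (residue₀ m refl refl refl refl) = arith m
  where
  arith : ∀ m → m + (m + m) ≡ 3 * m
  arith = solve-∀
balanced-sum (residue₁ m refl refl refl refl) = arith m
  where
  arith : ∀ m → m + (m + suc m) ≡ 3 * m + 1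
  arith = solve-∀
balanced-sum (residue₂ m refl refl refl refl) = arith m
  where
  arith : ∀ m → m + (suc m + suc m) ≡ 3 * m + 2
  arith = solve-∀

balanced-product : ∀ {n p₁ p₂ p₃} → Balanced n p₁ p₂ p₃ → n * n * n ≤ 27 * (p₁ * p₂ * p₃) + 3 * n + 2
balanced-product (residue₀ m refl refl refl refl) = linear (3 * (3 * m) + 2) (z≤n {0}) (arith m)
  where
  arith : ∀ m → 3 * m * (3 * m) * (3 * m) + 0 + (3 * (3 * m) + 2) ≡ 27 * (m * m * m) + 3 * (3 * m) + 2 + 0
  arith = solve-∀
balanced-product (residue₁ m refl refl refl refl) = linear 4 (z≤n {0}) (arith m)
  where
  arith : ∀ m → (3 * m + 1) * (3 * m + 1) * (3 * m + 1) + 0 + 4 ≡ 27 * (m * m * suc m) + 3 * (3 * m + 1) + 2 + 0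
  arith = solve-∀
balanced-product (residue₂ m refl refl refl refl) = linear 0 (z≤n {0}) (arith m)
  where
  arith : ∀ m → (3 * m + 2) * (3 * m + 2) * (3 * m + 2) + 0 + 0 ≡ 27 * (m * suc m * suc m) + 3 * (3 * m + 2) + 2 + 0
  arith = solve-∀

balanced-≥ : ∀ {n p₁ p₂ p₃} N → Balanced n p₁ p₂ p₃ → 3 * N + 2 ≤ n → N ≤ p₁ × N ≤ p₂ × N ≤ p₃
balanced-≥ N (residue₀ m refl refl refl refl) le = N≤m , N≤m , N≤m
  where
  N≤m : N ≤ m
  N≤m = *-cancelˡ-≤ 3 (≤-trans (m≤m+n (3 * N) 2) le)
balanced-≥ N (residue₁ m refl refl refl refl) le = N≤m , N≤m , ≤-trans N≤m (n≤1+n m)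
  where
  N≤m : N ≤ m
  N≤m = *-cancelˡ-≤ 3 (+-cancelʳ-≤ 1 (3 * N) (3 * m) (≤-trans (+-monoʳ-≤ (3 * N) (m≤m+n 1 1)) le))
balanced-≥ N (residue₂ m refl refl refl refl) le = N≤m , ≤-trans N≤m (n≤1+n m) , ≤-trans N≤m (n≤1+n m)
  where
  N≤m : N ≤ m
  N≤m = *-cancelˡ-≤ 3 (+-cancelʳ-≤ 2 (3 * N) (3 * m) le)

module Size (l K : ℕ) where

  smallest : ℕ
  smallest = l + 27 * K + 22

  spread : ℕ
  spread = 6 * l + 24 + 72 * smallest + (27 * K + 4)

  enough : ℕ
  enough = 3 * smallest + spread

module Final (l K : ℕ) {n p₁ p₂ p₃ d₁ d₂ d₃ : ℕ} (bal : Balanced n p₁ p₂ p₃)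
  (dense₁ : l * (p₁ * p₁) ≤ 6 * d₁ + l * p₁ + 2 * p₁ + K)
  (dense₂ : l * (p₂ * p₂) ≤ 6 * d₂ + l * p₂ + 2 * p₂ + K)
  (dense₃ : l * (p₃ * p₃) ≤ 6 * d₃ + l * p₃ + 2 * p₃ + K) where

  open Size l K

  extremal : ℕ
  extremal = 6 * (p₁ * p₂ * p₃) + 6 * (d₁ + d₂ + d₃)

  private
    error : ℕ → ℕ
    error n = 24 * n + 9 * l * n + 27 * K + 4

  margin⇒≤ : ∀ e → 9 * e + error n ≤ 2 * (n * n * n) + 3 * l * (n * n) → e ≤ extremal
  margin⇒≤ e margin = *-cancelˡ-≤ 9 (core n (sym (balanced-sum bal)) (balanced-product bal) margin)
    where
    sum-square : ∀ a b c → (a + (b + c)) * (a + (b + c)) ≤ 3 * (a * a + b * b + c * c)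
    sum-square a b c = linear 0 (*-monoʳ-≤ 2 (products≤squares a b c)) (arith a b c)
      where
      arith : ∀ a b c → (a + (b + c)) * (a + (b + c)) + 2 * (a * a + b * b + c * c) + 0 ≡ 3 * (a * a + b * b + c * c) + 2 * (a * b + b * c + c * a)
      arith = solve-∀
    arith : ∀ l K a b c e x y z s t →
      9 * e + (2 * s + 3 * l * ((a + (b + c)) * (a + (b + c))) + (2 * (27 * t + 3 * (a + (b + c)) + 2) + (3 * l * (3 * (a * a + b * b + c * c))
        + 9 * (6 * x + l * a + 2 * a + K + (6 * y + l * b + 2 * b + K + (6 * z + l * c + 2 * c + K)))))) + 0
      ≡ 9 * (6 * t + 6 * (x + y + z)) + ((9 * e + (24 * (a + (b + c)) + 9 * l * (a + (b + c)) + 27 * K + 4))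
        + (2 * s + (3 * l * ((a + (b + c)) * (a + (b + c))) + 9 * (l * (a * a) + (l * (b * b) + l * (c * c))))))
    arith = solve-∀
    core : ∀ n → n ≡ p₁ + (p₂ + p₃) → n * n * n ≤ 27 * (p₁ * p₂ * p₃) + 3 * n + 2 →
      9 * e + error n ≤ 2 * (n * n * n) + 3 * l * (n * n) → 9 * e ≤ 9 * extremal
    core n eq product margin = combine (n * n * n) eq product margin
      where
      combine : ∀ s → n ≡ p₁ + (p₂ + p₃) → s ≤ 27 * (p₁ * p₂ * p₃) + 3 * n + 2 → 9 * e + error n ≤ 2 * s + 3 * l * (n * n) → 9 * e ≤ 9 * extremal
      combine s refl product margin = linear 0
        (+-mono-≤ margin (+-mono-≤ (*-monoʳ-≤ 2 product) (+-mono-≤ (*-monoʳ-≤ (3 * l) (sum-square p₁ p₂ p₃)) (*-monoʳ-≤ 9 (+-mono-≤ dense₁ (+-mono-≤ dense₂ dense₃))))))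
        (arith l K p₁ p₂ p₃ e d₁ d₂ d₃ s (p₁ * p₂ * p₃))

  -- s is the size of a part and g six times the number of edges inside it.
  record Inside (s g : ℕ) : Set where
    field
      general : g + l * s ≤ l * (s * s)
      at₁     : s ≡ p₁ → g ≤ 6 * d₁
      at₂     : s ≡ p₂ → g ≤ 6 * d₂
      at₃     : s ≡ p₃ → g ≤ 6 * d₃

  private
    wide : ∀ c x y → 3 ≤ x + y → enough ≤ 3 * c + (2 * y + x) →
      54 * ((c + y + x) * (c + y) * c) + 9 * l * ((c + y + x) * (c + y + x) + (c + y) * (c + y) + c * c) + (24 * (3 * c + (2 * y + x)) + 27 * K + 4)
      ≤ 2 * ((3 * c + (2 * y + x)) * (3 * c + (2 * y + x)) * (3 * c + (2 * y + x))) + 3 * l * ((3 * c + (2 * y + x)) * (3 * c + (2 * y + x)))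
    wide c x y 3≤x+y large = linear 0 key (arith l K c x y)
      where
      q u : ℕ
      q = x * x + x * y + y * y
      u = 2 * y + x
      arith : ∀ l K c x y →
        54 * ((c + y + x) * (c + y) * c) + 9 * l * ((c + y + x) * (c + y + x) + (c + y) * (c + y) + c * c) + (24 * (3 * c + (2 * y + x)) + 27 * K + 4)
          + (18 * (c * (x * x + x * y + y * y)) + 2 * ((2 * y + x) * ((2 * y + x) * (2 * y + x)))) + 0
        ≡ 2 * ((3 * c + (2 * y + x)) * (3 * c + (2 * y + x)) * (3 * c + (2 * y + x))) + 3 * l * ((3 * c + (2 * y + x)) * (3 * c + (2 * y + x)))
          + (6 * (l * (x * x + x * y + y * y)) + 72 * c + 24 * (2 * y + x) + (27 * K + 4))
      arith = solve-∀
      7≤q : 7 ≤ q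
      7≤q = ≰⇒> λ q≤6 → <⇒≱ (m≤m+n 25 2) (≤-trans (≤-trans (*-monoʳ-≤ 3 (*-mono-≤ 3≤x+y 3≤x+y)) (linear 0 (2xy≤x²+y² x y) (arith₁ x y))) (*-monoʳ-≤ 4 q≤6))
        where
        arith₁ : ∀ x y → 3 * ((x + y) * (x + y)) + (x * x + y * y) + 0 ≡ 4 * (x * x + x * y + y * y) + 2 * (x * y)
        arith₁ = solve-∀
      3≤u : 3 ≤ u
      3≤u = ≤-trans 3≤x+y (linear y (z≤n {0}) (arith₁ x y))
        where
        arith₁ : ∀ x y → x + y + 0 + y ≡ 2 * y + x + 0
        arith₁ = solve-∀
      q≤u² : q ≤ u * u
      q≤u² = linear (3 * (y * y) + 3 * (x * y)) (z≤n {0}) (arith₁ x y)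
        where
        arith₁ : ∀ x y → x * x + x * y + y * y + 0 + (3 * (y * y) + 3 * (x * y)) ≡ (2 * y + x) * (2 * y + x) + 0
        arith₁ = solve-∀
      high-c : ∀ {c q u} → smallest ≤ c → 7 ≤ q → 3 ≤ u → 6 * (l * q) + 72 * c + 24 * u + (27 * K + 4) ≤ 18 * (c * q) + 2 * (u * (u * u))
      high-c {c} {q} {u} c≥ 7≤q 3≤u with m≤n⇒∃[o]m+o≡n c≥ | m≤n⇒∃[o]m+o≡n 7≤q | m≤n⇒∃[o]m+o≡n 3≤u
      ... | c′ , refl | q′ , refl | v , refl = linear
        (6 * (27 * K + 22 + c′) * (7 + q′) + 12 * ((l + 27 * K + 22 + c′) * q′) + (l + 11 * (l + 27 * K + 22 + c′) + c′) + (30 * v + 18 * (v * v) + 2 * (v * (v * v))))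
        (z≤n {0}) (arith₁ l K c′ q′ v)
        where
        arith₁ : ∀ l K c q v → 6 * (l * (7 + q)) + 72 * (l + 27 * K + 22 + c) + 24 * (3 + v) + (27 * K + 4) + 0
          + (6 * (27 * K + 22 + c) * (7 + q) + 12 * ((l + 27 * K + 22 + c) * q) + (l + 11 * (l + 27 * K + 22 + c) + c) + (30 * v + 18 * (v * v) + 2 * (v * (v * v))))
          ≡ 18 * ((l + 27 * K + 22 + c) * (7 + q)) + 2 * ((3 + v) * ((3 + v) * (3 + v))) + 0
        arith₁ = solve-∀
      high-u : ∀ {c q u} → c ≤ smallest → q ≤ u * u → spread ≤ u → 1 ≤ u * u → 6 * (l * q) + 72 * c + 24 * u + (27 * K + 4) ≤ 18 * (c * q) + 2 * (u * (u * u))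
      high-u {c} {q} {u} c≤ q≤ u≥ u²≥1 = ≤-trans (begin
        6 * (l * q) + 72 * c + 24 * u + (27 * K + 4)
          ≤⟨ +-mono-≤ (+-mono-≤ (+-mono-≤ (*-monoʳ-≤ 6 (*-monoʳ-≤ l q≤)) (≤-trans (*-monoʳ-≤ 72 c≤) (grow (72 * smallest)))) (*-monoʳ-≤ 24 u≤u²)) (grow (27 * K + 4)) ⟩
        6 * (l * (u * u)) + 72 * smallest * (u * u) + 24 * (u * u) + (27 * K + 4) * (u * u)
          ≡⟨ collect l smallest (27 * K + 4) (u * u) ⟩
        (6 * l + 24 + 72 * smallest + (27 * K + 4)) * (u * u)
          ≤⟨ *-monoˡ-≤ (u * u) u≥ ⟩
        u * (u * u)
          ≤⟨ m≤n*m (u * (u * u)) 2 ⟩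
        2 * (u * (u * u)) ∎) (m≤n+m _ (18 * (c * q)))
        where
        open ≤-Reasoning
        grow : ∀ k → k ≤ k * (u * u)
        grow k = ≤-trans (≤-reflexive (sym (*-identityʳ k))) (*-monoʳ-≤ k u²≥1)
        u≤u² : u ≤ u * u
        u≤u² = m≤m*m u
          where
          m≤m*m : ∀ u → u ≤ u * u
          m≤m*m zero    = z≤n
          m≤m*m (suc u) = m≤m*n (suc u) (suc u)
        collect : ∀ l s k w → 6 * (l * w) + 72 * s * w + 24 * w + k * w ≡ (6 * l + 24 + 72 * s + k) * w
        collect = solve-∀
      key : 6 * (l * q) + 72 * c + 24 * u + (27 * K + 4) ≤ 18 * (c * q) + 2 * (u * (u * u))
      key with ≤-total smallest c
      ... | inj₁ le = high-c le 7≤q 3≤u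
      ... | inj₂ le = high-u le q≤u² (+-cancelˡ-≤ (3 * smallest) spread u (≤-trans large (+-monoˡ-≤ u (*-monoʳ-≤ 3 le)))) (*-mono-≤ (≤-trans (s≤s z≤n) 3≤u) (≤-trans (s≤s z≤n) 3≤u))

  private
    residues : ∀ {i j s t} → s < 3 → t < 3 → 3 * i + s ≡ 3 * j + t → s ≡ t
    residues {i} {j} {s} {t} s<3 t<3 eq = residue-unique 3 {i} {j} s<3 t<3 (trans (cong (_+ s) (*-comm i 3)) (trans eq (cong (_+ t) (*-comm 3 j))))

    shape₀ : ∀ {n p₁ p₂ p₃} c → n ≡ 3 * c → Balanced n p₁ p₂ p₃ → p₁ ≡ c × p₂ ≡ c × p₃ ≡ c
    shape₀ c e (residue₀ m refl refl refl refl) with *-cancelˡ-≡ m c 3 e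
    ... | refl = refl , refl , refl
    shape₀ c e (residue₁ m refl _ _ _) = case residues {m} {c} {1} {0} (s≤s (s≤s z≤n)) (s≤s z≤n) (trans e (sym (+-identityʳ (3 * c)))) of λ ()
    shape₀ c e (residue₂ m refl _ _ _) = case residues {m} {c} {2} {0} ≤-refl (s≤s z≤n) (trans e (sym (+-identityʳ (3 * c)))) of λ ()

    shape₁ : ∀ {n p₁ p₂ p₃} c → n ≡ 3 * c + 1 → Balanced n p₁ p₂ p₃ → p₁ ≡ c × p₂ ≡ c × p₃ ≡ suc c
    shape₁ c e (residue₀ m refl _ _ _) = case residues {m} {c} {0} {1} (s≤s z≤n) (s≤s (s≤s z≤n)) (trans (+-identityʳ (3 * m)) e) of λ ()
    shape₁ c e (residue₁ m refl refl refl refl) with *-cancelˡ-≡ m c 3 (+-cancelʳ-≡ 1 (3 * m) (3 * c) e)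
    ... | refl = refl , refl , refl
    shape₁ c e (residue₂ m refl _ _ _) = case residues {m} {c} {2} {1} ≤-refl (s≤s (s≤s z≤n)) e of λ ()

    shape₂ : ∀ {n p₁ p₂ p₃} c → n ≡ 3 * c + 2 → Balanced n p₁ p₂ p₃ → p₁ ≡ c × p₂ ≡ suc c × p₃ ≡ suc c
    shape₂ c e (residue₀ m refl _ _ _) = case residues {m} {c} {0} {2} (s≤s z≤n) ≤-refl (trans (+-identityʳ (3 * m)) e) of λ ()
    shape₂ c e (residue₁ m refl _ _ _) = case residues {m} {c} {1} {2} (s≤s (s≤s z≤n)) ≤-refl e of λ ()
    shape₂ c e (residue₂ m refl refl refl refl) with *-cancelˡ-≡ m c 3 (+-cancelʳ-≡ 2 (3 * m) (3 * c) e)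
    ... | refl = refl , refl , refl

    balanced-sizes : ∀ {a b c ga gb gc e} → a * b * c ≡ p₁ * p₂ * p₃ → ga + (gb + gc) ≤ 6 * d₁ + (6 * d₂ + 6 * d₃) →
      e ≤ 6 * (a * b * c) + (ga + (gb + gc)) → e ≤ extremal
    balanced-sizes eq g≤ e≤ = ≤-trans e≤ (+-mono-≤ (≤-reflexive (cong (6 *_) eq)) (≤-trans g≤ (≤-reflexive (arith d₁ d₂ d₃))))
      where
      arith : ∀ x y z → 6 * x + (6 * y + 6 * z) ≡ 6 * (x + y + z)
      arith = solve-∀

    wide-sizes : ∀ c x y {ga gb gc e} → 3 ≤ x + y → n ≡ 3 * c + (2 * y + x) → enough ≤ n →
      Inside (c + y + x) ga → Inside (c + y) gb → Inside c gc →
      e ≤ 6 * ((c + y + x) * (c + y) * c) + (ga + (gb + gc)) → e ≤ extremal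
    wide-sizes c x y {ga} {gb} {gc} {e} 3≤ eq large A B C e≤ = margin⇒≤ e (subst (λ n → 9 * e + error n ≤ 2 * (n * n * n) + 3 * l * (n * n)) (sym eq)
      (≤-trans (linear 0 (+-mono-≤ (*-monoʳ-≤ 9 e≤) (*-monoʳ-≤ 9 (+-mono-≤ (Inside.general A) (+-mono-≤ (Inside.general B) (Inside.general C))))) (arith l K c x y e ga gb gc))
        (wide c x y 3≤ (≤-trans large (≤-reflexive eq)))))
      where
      arith : ∀ l K c x y e ga gb gc →
        9 * e + (24 * (3 * c + (2 * y + x)) + 9 * l * (3 * c + (2 * y + x)) + 27 * K + 4)
          + (9 * (6 * ((c + y + x) * (c + y) * c) + (ga + (gb + gc))) + 9 * (l * ((c + y + x) * (c + y + x)) + (l * ((c + y) * (c + y)) + l * (c * c)))) + 0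
        ≡ 54 * ((c + y + x) * (c + y) * c) + 9 * l * ((c + y + x) * (c + y + x) + (c + y) * (c + y) + c * c) + (24 * (3 * c + (2 * y + x)) + 27 * K + 4)
          + (9 * e + 9 * (ga + l * (c + y + x) + (gb + l * (c + y) + (gc + l * c))))
      arith = solve-∀

    c-large : ∀ c u → enough ≤ 3 * c + u → u ≤ 4 → l + K + 2 ≤ c
    c-large c u large u≤4 = *-cancelˡ-≤ 3 (linear (6 * l + 84 + 78 * K + 72 * smallest + 27 * K) (+-mono-≤ large u≤4) (arith l K c u smallest))
      where
      arith : ∀ l K c u s → 3 * (l + K + 2) + (3 * c + u + 4) + (6 * l + 84 + 78 * K + 72 * s + 27 * K)
        ≡ 3 * c + (3 * (l + 27 * K + 22) + (6 * l + 24 + 72 * s + (27 * K + 4)) + u)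
      arith = solve-∀

  sorted-sizes : ∀ c x y {ga gb gc e} → n ≡ 3 * c + (2 * y + x) → enough ≤ n →
    Inside (c + y + x) ga → Inside (c + y) gb → Inside c gc →
    e ≤ 6 * ((c + y + x) * (c + y) * c) + (ga + (gb + gc)) → e ≤ extremal
  sorted-sizes c zero zero {ga} {gb} {gc} {e} eq large A B C e≤ = go (shape₀ c (trans eq (+-identityʳ (3 * c))) bal)
    where
    c+0 : c + 0 ≡ c
    c+0 = +-identityʳ c
    c+0+0 : c + 0 + 0 ≡ c
    c+0+0 = trans (+-identityʳ (c + 0)) c+0
    go : p₁ ≡ c × p₂ ≡ c × p₃ ≡ c → e ≤ extremal
    go (e₁ , e₂ , e₃) = balanced-sizes {c + 0 + 0} {c + 0} {c} {ga} {gb} {gc} (cong₂ _*_ (cong₂ _*_ (trans c+0+0 (sym e₁)) (trans c+0 (sym e₂))) (sym e₃))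
      (+-mono-≤ (Inside.at₁ A (trans c+0+0 (sym e₁))) (+-mono-≤ (Inside.at₂ B (trans c+0 (sym e₂))) (Inside.at₃ C (sym e₃)))) e≤
  sorted-sizes c (suc zero) zero {ga} {gb} {gc} {e} eq large A B C e≤ = go (shape₁ c eq bal)
    where
    c+0 : c + 0 ≡ c
    c+0 = +-identityʳ c
    c+0+1 : c + 0 + 1 ≡ suc c
    c+0+1 = trans (cong (_+ 1) c+0) (+-comm c 1)
    swapped : ∀ a b c → a * b * c ≡ b * c * a
    swapped = solve-∀
    go : p₁ ≡ c × p₂ ≡ c × p₃ ≡ suc c → e ≤ extremal
    go (e₁ , e₂ , e₃) = balanced-sizes {c + 0 + 1} {c + 0} {c} {ga} {gb} {gc} (trans (swapped (c + 0 + 1) (c + 0) c) (cong₂ _*_ (cong₂ _*_ (trans c+0 (sym e₁)) (sym e₂)) (trans c+0+1 (sym e₃))))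
      (≤-trans (+-mono-≤ (Inside.at₃ A (trans c+0+1 (sym e₃))) (+-mono-≤ (Inside.at₁ B (trans c+0 (sym e₁))) (Inside.at₂ C (sym e₂)))) (≤-reflexive (arith (6 * d₁) (6 * d₂) (6 * d₃)))) e≤
      where
      arith : ∀ x y z → z + (x + y) ≡ x + (y + z)
      arith = solve-∀
  sorted-sizes c zero (suc zero) {ga} {gb} {gc} {e} eq large A B C e≤ = go (shape₂ c eq bal)
    where
    c+1 : c + 1 ≡ suc c
    c+1 = +-comm c 1
    c+1+0 : c + 1 + 0 ≡ suc c
    c+1+0 = trans (+-identityʳ (c + 1)) c+1
    swapped : ∀ a b c → a * b * c ≡ c * a * b
    swapped = solve-∀
    go : p₁ ≡ c × p₂ ≡ suc c × p₃ ≡ suc c → e ≤ extremal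
    go (e₁ , e₂ , e₃) = balanced-sizes {c + 1 + 0} {c + 1} {c} {ga} {gb} {gc} (trans (swapped (c + 1 + 0) (c + 1) c) (cong₂ _*_ (cong₂ _*_ (sym e₁) (trans c+1+0 (sym e₂))) (trans c+1 (sym e₃))))
      (≤-trans (+-mono-≤ (Inside.at₂ A (trans c+1+0 (sym e₂))) (+-mono-≤ (Inside.at₃ B (trans c+1 (sym e₃))) (Inside.at₁ C (sym e₁)))) (≤-reflexive (arith (6 * d₁) (6 * d₂) (6 * d₃)))) e≤
      where
      arith : ∀ x y z → y + (z + x) ≡ x + (y + z)
      arith = solve-∀
  sorted-sizes c (suc zero) (suc zero) {ga} {gb} {gc} {e} eq large A B C e≤ = go (shape₀ (suc c) (trans eq (arith₀ c)) bal)
    where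
    arith₀ : ∀ c → 3 * c + 3 ≡ 3 * suc c
    arith₀ = solve-∀
    go : p₁ ≡ suc c × p₂ ≡ suc c × p₃ ≡ suc c → e ≤ extremal
    go (refl , refl , refl) = linear 6 (+-mono-≤ e≤ (+-mono-≤ (Inside.at₂ B (+-comm c 1)) (+-mono-≤ (+-mono-≤ (Inside.general A) (Inside.general C))
        (+-mono-≤ (+-mono-≤ dense₁ dense₃) (*-monoʳ-≤ 2 (c-large c 3 (≤-trans large (≤-reflexive eq)) (m≤m+n 3 1)))))))
      (arith l K c e ga gb gc d₁ d₂ d₃)
      where
      arith : ∀ l K c e ga gb gc x y z →
        e + (6 * ((c + 1 + 1) * (c + 1) * c) + (ga + (gb + gc)) + (6 * y + (l * ((c + 1 + 1) * (c + 1 + 1)) + l * (c * c)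
          + (6 * x + l * suc c + 2 * suc c + K + (6 * z + l * suc c + 2 * suc c + K) + 2 * c)))) + 6
        ≡ 6 * (suc c * suc c * suc c) + 6 * (x + y + z) + (e + (gb + (ga + l * (c + 1 + 1) + (gc + l * c)
          + (l * (suc c * suc c) + l * (suc c * suc c) + 2 * (l + K + 2)))))
      arith = solve-∀
  sorted-sizes c (suc (suc zero)) zero {ga} {gb} {gc} {e} eq large A B C e≤ = go (shape₂ c eq bal)
    where
    go : p₁ ≡ c × p₂ ≡ suc c × p₃ ≡ suc c → e ≤ extremal
    go (refl , refl , refl) = linear 0 (+-mono-≤ e≤ (+-mono-≤ (Inside.at₁ B (+-identityʳ c)) (+-mono-≤ (+-mono-≤ (Inside.general A) (Inside.general C))
        (+-mono-≤ (+-mono-≤ dense₂ dense₃) (*-monoʳ-≤ 2 (c-large c 2 (≤-trans large (≤-reflexive eq)) (m≤m+n 2 2)))))))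
      (arith l K c e ga gb gc d₁ d₂ d₃)
      where
      arith : ∀ l K c e ga gb gc x y z →
        e + (6 * ((c + 0 + 2) * (c + 0) * c) + (ga + (gb + gc)) + (6 * x + (l * ((c + 0 + 2) * (c + 0 + 2)) + l * (c * c)
          + (6 * y + l * suc c + 2 * suc c + K + (6 * z + l * suc c + 2 * suc c + K) + 2 * c)))) + 0
        ≡ 6 * (c * suc c * suc c) + 6 * (x + y + z) + (e + (gb + (ga + l * (c + 0 + 2) + (gc + l * c)
          + (l * (suc c * suc c) + l * (suc c * suc c) + 2 * (l + K + 2)))))
      arith = solve-∀
  sorted-sizes c zero (suc (suc zero)) {ga} {gb} {gc} {e} eq large A B C e≤ = go (shape₁ (suc c) (trans eq (arith₀ c)) bal)
    where
    arith₀ : ∀ c → 3 * c + 4 ≡ 3 * suc c + 1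
    arith₀ = solve-∀
    go : p₁ ≡ suc c × p₂ ≡ suc c × p₃ ≡ suc (suc c) → e ≤ extremal
    go (refl , refl , refl) = linear 12 (+-mono-≤ e≤ (+-mono-≤ (Inside.at₃ A (trans (+-identityʳ (c + 2)) (+-comm c 2))) (+-mono-≤ (+-mono-≤ (Inside.general B) (Inside.general C))
        (+-mono-≤ (+-mono-≤ dense₁ dense₂) (*-monoʳ-≤ 2 (c-large c 4 (≤-trans large (≤-reflexive eq)) ≤-refl))))))
      (arith l K c e ga gb gc d₁ d₂ d₃)
      where
      arith : ∀ l K c e ga gb gc x y z →
        e + (6 * ((c + 2 + 0) * (c + 2) * c) + (ga + (gb + gc)) + (6 * z + (l * ((c + 2) * (c + 2)) + l * (c * c)
          + (6 * x + l * suc c + 2 * suc c + K + (6 * y + l * suc c + 2 * suc c + K) + 2 * c)))) + 12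
        ≡ 6 * (suc c * suc c * suc (suc c)) + 6 * (x + y + z) + (e + (ga + (gb + l * (c + 2) + (gc + l * c)
          + (l * (suc c * suc c) + l * (suc c * suc c) + 2 * (l + K + 2)))))
      arith = solve-∀
  sorted-sizes c (suc (suc (suc x))) y = wide-sizes c (suc (suc (suc x))) y (s≤s (s≤s (s≤s z≤n)))
  sorted-sizes c (suc (suc zero)) (suc y) = wide-sizes c 2 (suc y) (s≤s (s≤s (s≤s z≤n)))
  sorted-sizes c (suc zero) (suc (suc y)) = wide-sizes c 1 (suc (suc y)) (s≤s (s≤s (s≤s z≤n)))
  sorted-sizes c zero (suc (suc (suc y))) = wide-sizes c 0 (suc (suc (suc y))) (s≤s (s≤s (s≤s z≤n)))

  descending : ∀ {a b c ga gb gc e} → c ≤ b → b ≤ a → a + (b + c) ≡ n → enough ≤ n → Inside a ga → Inside b gb → Inside c gc →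
    e ≤ 6 * (a * b * c) + (ga + (gb + gc)) → e ≤ extremal
  descending {c = c} c≤b b≤a eq large A B C e≤ with m≤n⇒∃[o]m+o≡n c≤b
  ... | y , refl with m≤n⇒∃[o]m+o≡n b≤a
  ...   | x , refl = sorted-sizes c x y (trans (sym eq) (arith c x y)) large A B C e≤
    where
    arith : ∀ c x y → c + y + x + (c + y + c) ≡ 3 * c + (2 * y + x)
    arith = solve-∀

  any-sizes : ∀ {a b c ga gb gc e} → a + (b + c) ≡ n → enough ≤ n → Inside a ga → Inside b gb → Inside c gc →
    e ≤ 6 * (a * b * c) + (ga + (gb + gc)) → e ≤ extremal
  any-sizes {a} {b} {c} {ga} {gb} {gc} eq large A B C e≤ with ≤-total a b | ≤-total b c | ≤-total a c
  ... | inj₂ ba | inj₂ cb | _       = descending cb ba eq large A B C e≤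
  ... | inj₁ ab | _       | inj₂ ca = descending ca ab (trans (arith a b c) eq) large B A C (≤-trans e≤ (≤-reflexive (cong₂ _+_ (cong (6 *_) (prod a b c)) (arith gb ga gc))))
    where
    arith : ∀ a b c → b + (a + c) ≡ a + (b + c)
    arith = solve-∀
    prod : ∀ a b c → a * b * c ≡ b * a * c
    prod = solve-∀
  ... | inj₂ ba | inj₁ bc | inj₂ ca = descending bc ca (trans (arith a b c) eq) large A C B (≤-trans e≤ (≤-reflexive (cong₂ _+_ (cong (6 *_) (prod a b c)) (arith ga gc gb))))
    where
    arith : ∀ a b c → a + (c + b) ≡ a + (b + c)
    arith = solve-∀
    prod : ∀ a b c → a * b * c ≡ a * c * b
    prod = solve-∀
  ... | inj₁ ab | inj₂ cb | inj₁ ac = descending ac cb (trans (arith a b c) eq) large B C A (≤-trans e≤ (≤-reflexive (cong₂ _+_ (cong (6 *_) (prod a b c)) (sym (arith ga gb gc)))))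
    where
    arith : ∀ a b c → b + (c + a) ≡ a + (b + c)
    arith = solve-∀
    prod : ∀ a b c → a * b * c ≡ b * c * a
    prod = solve-∀
  ... | inj₂ ba | inj₁ bc | inj₁ ac = descending ba ac (trans (arith a b c) eq) large C A B (≤-trans e≤ (≤-reflexive (cong₂ _+_ (cong (6 *_) (prod a b c)) (sym (arith ga gb gc)))))
    where
    arith : ∀ a b c → c + (a + b) ≡ a + (b + c)
    arith = solve-∀
    prod : ∀ a b c → a * b * c ≡ c * a * b
    prod = solve-∀
  ... | inj₁ ab | inj₁ bc | inj₁ ac = descending ab bc (trans (arith a b c) eq) large C B A (≤-trans e≤ (≤-reflexive (cong₂ _+_ (cong (6 *_) (prod a b c)) (sym (arith ga gb gc)))))
    where
    arith : ∀ a b c → c + (b + a) ≡ a + (b + c)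
    arith = solve-∀
    prod : ∀ a b c → a * b * c ≡ c * b * a
    prod = solve-∀

low-margin : ∀ B l K m e e′ .{{_ : NonZero B}} → B * (34 + 9 * l + 27 * K) ≤ suc m →
  B * (9 * e) + 3 * (suc m * suc m) ≤ B * (9 * e′) + 6 * B * (suc m * suc m) →
  9 * e′ ≤ 2 * (m * m * m) + 3 * l * (m * m) + 0 →
  9 * e + (24 * suc m + 9 * l * suc m + 27 * K + 4) ≤ 2 * (suc m * suc m * suc m) + 3 * l * (suc m * suc m)
low-margin B l K m e e′ large low previous = *-cancelˡ-≤ B
  (linear (2 * (suc m * suc m) + B * (4 * m + 2 + 6 * l * m + 3 * l + 27 * K * m))
    (+-mono-≤ low (+-mono-≤ (*-monoʳ-≤ B previous) (*-monoʳ-≤ (suc m) large))) (arith B l K m e e′))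
  where
  arith : ∀ B l K m e e′ →
    B * (9 * e + (24 * suc m + 9 * l * suc m + 27 * K + 4))
      + (B * (9 * e′) + 6 * B * (suc m * suc m) + (B * (2 * (m * m * m) + 3 * l * (m * m) + 0) + suc m * suc m))
      + (2 * (suc m * suc m) + B * (4 * m + 2 + 6 * l * m + 3 * l + 27 * K * m))
    ≡ B * (2 * (suc m * suc m * suc m) + 3 * l * (suc m * suc m))
      + (B * (9 * e) + 3 * (suc m * suc m) + (B * (9 * e′) + suc m * (B * (34 + 9 * l + 27 * K))))
  arith = solve-∀

module _ {l N d} (max : IsDmax N (suc l) d) where

  Dmax-upper : ∀ {G : Graph3 N} → (∀ a b → codeg G a b < suc l) → edges₆ G ≤ 6 * d
  Dmax-upper {G} small = ≤-trans (≤-reflexive (edges₆-numEdges G)) (*-monoʳ-≤ 6 (proj₂ max G small))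

  Dmax-dense : ∀ {K} → Packed l K N → l * (N * N) ≤ 6 * d + l * N + 2 * N + K
  Dmax-dense {K} (G , small , many) = ≤-trans many (+-monoˡ-≤ K (+-monoˡ-≤ (2 * N) (+-monoˡ-≤ (l * N) (Dmax-upper {G} small))))

Dmax-inside : ∀ {l N d s} → IsDmax N (suc l) d → (G : Graph3 s) → (∀ a b → codeg G a b < suc l) → s ≡ N → edges₆ G ≤ 6 * d
Dmax-inside max G small refl = Dmax-upper max {G} small

Attained : ℕ → ℕ → ℕ → Set
Attained t v n = Σ (Graph3 n) λ H → Free t H × numEdges H ≡ v

attained : ∀ {l a b c d₁ d₂ d₃} → IsDmax a (suc l) d₁ → IsDmax b (suc l) d₂ → IsDmax c (suc l) d₃ →
  Attained (suc l) (a * b * c + (d₁ + d₂ + d₃)) (a + (b + c))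
attained {l} {a} {b} {c} {d₁} {d₂} {d₃} ((G₁ , s₁ , e₁) , _) ((G₂ , s₂ , e₂) , _) ((G₃ , s₃ , e₃) , _) =
  count (ThreeParts.threeParts G₁ G₂ G₃ (s≤s z≤n) s₁ s₂ s₃)
  where
  arith : ∀ p x y z → 6 * p + (6 * x + (6 * y + 6 * z)) ≡ 6 * (p + (x + y + z))
  arith = solve-∀
  count : (Σ (Graph3 (a + (b + c))) λ H → Free (suc l) H × edges₆ H ≡ 6 * (a * b * c) + (edges₆ G₁ + (edges₆ G₂ + edges₆ G₃))) →
    Attained (suc l) (a * b * c + (d₁ + d₂ + d₃)) (a + (b + c))
  count (H , free , e) = H , free , *-cancelˡ-≡ (numEdges H) (a * b * c + (d₁ + d₂ + d₃)) 6 (trans (sym (edges₆-numEdges H)) (trans e (trans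
    (cong (6 * (a * b * c) +_) (cong₂ _+_ (six G₁ e₁) (cong₂ _+_ (six G₂ e₂) (six G₃ e₃)))) (arith (a * b * c) d₁ d₂ d₃))))
    where
    six : ∀ {m d} (G : Graph3 m) → numEdges G ≡ d → edges₆ G ≡ 6 * d
    six G eq = trans (edges₆-numEdges G) (cong (6 *_) eq)

module _ (l K N₀ : ℕ) (pack : ∀ N → N₀ ≤ N → Packed l K N) where

  private
    cube : ℕ
    cube = 9 * (threshold l * threshold l * threshold l)

  size₀ : ℕ
  size₀ = suc (cube + threshold l) + (3 * N₀ + 2) + Size.enough l K + slack l * (34 + 9 * l + 27 * K)

  upper : ∀ {n p₁ p₂ p₃ d₁ d₂ d₃} → size₀ ≤ n → Balanced n p₁ p₂ p₃ →
    IsDmax p₁ (suc l) d₁ → IsDmax p₂ (suc l) d₂ → IsDmax p₃ (suc l) d₃ →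
    (H : Graph3 n) → Free (suc l) H → edges₆ H ≤ 6 * (p₁ * p₂ * p₃) + 6 * (d₁ + d₂ + d₃)
  upper {n} {p₁} {p₂} {p₃} {d₁} {d₂} {d₃} large bal max₁ max₂ max₃ H free = byDegree (highDegree? l H)
    where
    n-excess : suc (cube + threshold l) ≤ n
    n-excess = ≤-trans (≤-trans (m≤m+n _ (3 * N₀ + 2)) (≤-trans (m≤m+n _ (Size.enough l K)) (m≤m+n _ _))) large
    n-parts : 3 * N₀ + 2 ≤ n
    n-parts = ≤-trans (≤-trans (m≤n+m _ (suc (cube + threshold l))) (≤-trans (m≤m+n _ (Size.enough l K)) (m≤m+n _ _))) large
    n-enough : Size.enough l K ≤ n
    n-enough = ≤-trans (≤-trans (m≤n+m (Size.enough l K) (suc (cube + threshold l) + (3 * N₀ + 2))) (m≤m+n _ _)) large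
    n-low : slack l * (34 + 9 * l + 27 * K) ≤ n
    n-low = ≤-trans (m≤n+m _ (suc (cube + threshold l) + (3 * N₀ + 2) + Size.enough l K)) large
    big : N₀ ≤ p₁ × N₀ ≤ p₂ × N₀ ≤ p₃
    big = balanced-≥ N₀ bal n-parts
    open Final l K {d₁ = d₁} {d₂} {d₃} bal (Dmax-dense max₁ (pack p₁ (proj₁ big))) (Dmax-dense max₂ (pack p₂ (proj₁ (proj₂ big)))) (Dmax-dense max₃ (pack p₃ (proj₂ (proj₂ big))))
    inside : ∀ {s} (G : Graph3 s) → (∀ a b → codeg G a b < suc l) → Inside s (edges₆ G)
    inside G small = record
      { general = edges₆-codeg l G small
      ; at₁     = Dmax-inside max₁ G small
      ; at₂     = Dmax-inside max₂ G small
      ; at₃     = Dmax-inside max₃ G small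
      }
    lowCase : ∀ n → suc (cube + threshold l) ≤ n → slack l * (34 + 9 * l + 27 * K) ≤ n → (H : Graph3 n) → Free (suc l) H →
      (∃ λ v → ¬ HighDegree l H v) → 9 * edges₆ H + (24 * n + 9 * l * n + 27 * K + 4) ≤ 2 * (n * n * n) + 3 * l * (n * n)
    lowCase (suc m) (s≤s m-large) low-large H free (v , low) = low-margin (slack l) l K m (edges₆ H) (edges₆ (delete H v))
      {{>-nonZero (≤-trans (s≤s z≤n) (200≤slack l))}} low-large (lowDegree-step l H v low)
      (subst (λ x → 9 * edges₆ (delete H v) ≤ 2 * (m * m * m) + 3 * l * (m * m) + x) (m≤n⇒m∸n≡0 {cube} {m ∸ threshold l} (m+n≤o⇒m≤o∸n cube m-large))
        (excess l (m ∸ threshold l) m (sym (m∸n+n≡m (≤-trans (m≤n+m (threshold l) cube) m-large))) (delete H v) (delete-free H v free)))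
    byDegree : (∀ v → HighDegree l H v) ⊎ (∃ λ v → ¬ HighDegree l H v) → edges₆ H ≤ extremal
    byDegree (inj₂ low)  = margin⇒≤ (edges₆ H) (lowCase n n-excess n-low H free low)
    byDegree (inj₁ high) = any-sizes sizes n-enough (inside G₀ codeg₀) (inside G₁ codeg₁) (inside G₂ codeg₂) edges₆-≤
      where
      open Decomposition (decomposition l H free (≤-trans (m≤n+m (threshold l) (suc cube)) n-excess) high)

theorem1p4 : (t : ℕ) → 1 ≤ t →
    Σ ℕ λ n₀ → (n : ℕ) → n₀ ≤ n →
    (d₁ d₂ d₃ : ℕ) →
    IsDmax (part₁ n) t d₁ → IsDmax (part₂ n) t d₂ → IsDmax (part₃ n) t d₃ →
    IsExF5blowup n t (eT3 n + (d₁ + d₂ + d₃))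
theorem1p4 (suc l) (s≤s _) with packing-bound l
... | K , N₀ , pack = size₀ l K N₀ pack , λ n large d₁ d₂ d₃ max₁ max₂ max₃ →
  subst (Attained (suc l) (eT3 n + (d₁ + d₂ + d₃))) (balanced-sum (balanced n)) (attained max₁ max₂ max₃) ,
  λ H free → *-cancelˡ-≤ 6 (≤-trans (≤-reflexive (sym (edges₆-numEdges H)))
    (≤-trans (upper l K N₀ pack large (balanced n) max₁ max₂ max₃ H free) (≤-reflexive (sym (*-distribˡ-+ 6 (eT3 n) (d₁ + d₂ + d₃))))))
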